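{- Let $k\geq 1$ be a fixed constant. The decision problem $\langle I,T,\mathrm{sup},k,s\rangle$, restricted to inputs in which $I$ is a finite set of boolean attributes (with $|I|\ge k$), $T$ is a database on $I$, and $0<s\le 1$ is a rational, is in $TC^0$.
   Context: An attribute $A$ (categorical or numeric) has a domain $\mathrm{dom}(A)$ containing a special null value $\epsilon$; $A$ is boolean if $\mathrm{dom}(A)=\{\epsilon,c(A)\}$ for a constant $c(A)$. A database $T$ on a finite attribute set $I$ is a relation with duplicates (a finite multiset of tuples) having attribute set $I$; $t[A]$ is the value of $A$ in tuple $t$. An atomic condition on a categorical attribute $A$ is $A=u$ or $A\neq u$ with $u\in \mathrm{dom}(A)\setminus\{\epsilon\}$; on a numeric attribute $A$ it is $A\in[l,u]$ or $A\notin[l,u]$ with numeric values $l\le u$. A tuple $t$ satisfies an atomic condition on $A$ iff $t[A]\neq\epsilon$ and $t[A]$ fulfils the stated relation (so a null value satisfies no condition). A condition is a conjunction $C=C_1\wedge\dots\wedge C_n$ of atomic conditions on distinct attributes; its size is $|C|=n$; $t$ satisfies $C$ iff it satisfies every $C_i$; $T_C$ is the (multi)set of tuples of $T$ satisfying $C$, with $|T_C|$ counted with duplicates. An association rule on $I$ is $B\Rightarrow H$ with $B,H$ conditions on attribute sets $I_B,I_H$ with $\emptyset\subset I_B,I_H\subset I$ and $I_B\cap I_H=\emptyset$; its size is $|B\Rightarrow H|=|B|+|H|$. It is trivial (w.r.t. $T$) if $B\wedge H$ contains at least one atomic condition $C_a$ with $T_{C_a}=T$. The support is $\mathrm{sup}(B\Rightarrow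 H,T)=|T_{B\wedge H}|/|T|$. The problem $\langle I,T,\rho,k,s\rangle$ for an index $\rho$ asks: is there a non-trivial association rule $R$ on $I$ with $|R|\ge k$ and $\rho(R,T)\ge s$? A boolean database $T=\{t_1,\dots,t_m\}$ on $I=\{A_1,\dots,A_n\}$ is presented to a circuit as the $m\times n$ boolean matrix $(x_{i,j})$ with $x_{i,j}=1$ if $t_i[A_j]=c(A_j)$ and $x_{i,j}=0$ if $t_i[A_j]=\epsilon$; the rational $s$ is given as a pair of naturals $(a,b)$ with $s=a/b$. A MAJORITY gate is an unbounded fan-in gate outputting 1 iff more than half of its inputs are non-zero. $TC^0$ is the class of decision problems solved by (logspace-)uniform families of circuits of polynomial size and constant depth with MAJORITY and NOT gates of unbounded fan-in. -}

module Defs where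

open import Level using (Level; _⊔_) renaming (suc to lsuc)
open import Data.Bool using (Bool; true; false; not)
open import Data.Bool.Properties using () renaming (_≟_ to _≟ᵇ_)
open import Data.Fin using (Fin; toℕ)
open import Data.Fin.Properties using (all?)
open import Data.Fin.Subset using (Subset; _⊂_; _∩_; ⊥; ⊤; ∣_∣)
open import Data.Integer using (+_)
open import Data.List using (List; []; _∷_; _++_; [_]; length; map; concatMap; filter; replicate; tabulate; foldr)
open import Data.Maybe using (Maybe; just; nothing; is-just; _<∣>_; maybe′)
import Data.Maybe.Relation.Unary.All as MaybeAll
import Data.Maybe.Relation.Unary.Any as MaybeAny
open import Data.Nat using (ℕ; zero; suc; pred; _+_; _*_; _^_; _≤_; _<?_; _⊓_; NonZero) renaming (_⊔_ to max)
open import Data.Nat.Logarithm using (⌊log₂_⌋)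
open import Data.Product using (∃-syntax; Σ-syntax; _×_; _,_)
open import Data.Rational using (ℚ; _/_; 0ℚ; 1ℚ) renaming (_≤_ to _≤ℚ_; _<_ to _<ℚ_; _≤?_ to _≤ℚ?_)
open import Data.Unit using (tt) renaming (⊤ to Unit)
open import Data.Vec using (Vec; []; _∷_; toList; fromList)
import Data.Vec as Vec
open import Function.Bundles using (_↔_; _⇔_)
open import Function.Definitions using (Injective)
open import Relation.Binary.Definitions using (DecidableEquality)
open import Relation.Binary.PropositionalEquality using (_≡_; _≢_)
open import Relation.Nullary using (¬_; ¬?; _×-dec_; does)
open import Relation.Unary using (Pred; Decidable)

private
  variable
    n N g : ℕ

------------------------------------------------------------------------
-- Databases and association rules

-- An attribute carries its set V of non-null values; its domain is
-- Maybe V, with `nothing` in the role of the null value ε.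
data Attribute : Set₁ where
  categorical : (V : Set) → DecidableEquality V → Attribute
  numeric     : (V : Set) (value : V → ℚ) → Injective _≡_ _≡_ value → Attribute

Value : Attribute → Set
Value (categorical V _) = V
Value (numeric V _ _)   = V

Domain : Attribute → Set
Domain A = Maybe (Value A)

IsBoolean : Attribute → Set
IsBoolean A = ∃[ c ] (∀ (v : Value A) → v ≡ c)

data CategoricalCondition (V : Set) : Set where
  equal unequal : V → CategoricalCondition V

data NumericCondition : Set where
  inside outside : (l u : ℚ) → l ≤ℚ u → NumericCondition

Atomic : Attribute → Set
Atomic (categorical V _) = CategoricalCondition V
Atomic (numeric _ _ _)   = NumericCondition

Fulfils : (A : Attribute) → Atomic A → Value A → Set
Fulfils (categorical _ _)   (equal u)       v = v ≡ u
Fulfils (categorical _ _)   (unequal u)     v = v ≢ u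
Fulfils (numeric _ value _) (inside l u _)  v = l ≤ℚ value v × value v ≤ℚ u
Fulfils (numeric _ value _) (outside l u _) v = ¬ (l ≤ℚ value v × value v ≤ℚ u)

fulfils? : (A : Attribute) (c : Atomic A) → Decidable (Fulfils A c)
fulfils? (categorical _ _≟_) (equal u)       v = v ≟ u
fulfils? (categorical _ _≟_) (unequal u)     v = ¬? (v ≟ u)
fulfils? (numeric _ value _) (inside l u _)  v = (l ≤ℚ? value v) ×-dec (value v ≤ℚ? u)
fulfils? (numeric _ value _) (outside l u _) v = ¬? ((l ≤ℚ? value v) ×-dec (value v ≤ℚ? u))

SatisfiesAtom : (A : Attribute) → Atomic A → Domain A → Set
SatisfiesAtom A c = MaybeAny.Any (Fulfils A c)

satisfiesAtom? : (A : Attribute) (c : Atomic A) → Decidable (SatisfiesAtom A c)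
satisfiesAtom? A c = MaybeAny.dec (fulfils? A c)

Schema : ℕ → Set₁
Schema n = Fin n → Attribute

Tuple : Schema n → Set
Tuple S = ∀ j → Domain (S j)

-- A multiset of tuples, given by an enumeration t₁, …, tₘ of it.
Database : Schema n → Set
Database S = List (Tuple S)

-- A conjunction of atomic conditions on distinct attributes is a partial
-- assignment of atomic conditions to the attributes.
Condition : Schema n → Set
Condition S = ∀ j → Maybe (Atomic (S j))

module _ {n : ℕ} {S : Schema n} where

  attributesOf : Condition S → Subset n
  attributesOf C = Vec.tabulate (λ j → is-just (C j))

  sizeᶜ : Condition S → ℕ
  sizeᶜ C = ∣ attributesOf C ∣

  -- Only used for conditions on disjoint attribute sets, where the left
  -- bias of _<∣>_ is immaterial.
  _∧ᶜ_ : Condition S → Condition S → Condition S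
  (B ∧ᶜ H) j = B j <∣> H j

  Satisfies : Condition S → Tuple S → Set
  Satisfies C t = ∀ j → MaybeAll.All (λ c → SatisfiesAtom (S j) c (t j)) (C j)

  satisfies? : (C : Condition S) → Decidable (Satisfies C)
  satisfies? C t = all? λ j → MaybeAll.dec (λ c → satisfiesAtom? (S j) c (t j)) (C j)

  _⟦_⟧ : Database S → Condition S → Database S
  T ⟦ C ⟧ = filter (satisfies? C) T

record Rule {n : ℕ} (S : Schema n) : Set where
  field
    body head      : Condition S
    body-nonempty  : ⊥ ⊂ attributesOf body
    body-proper    : attributesOf body ⊂ ⊤
    head-nonempty  : ⊥ ⊂ attributesOf head
    head-proper    : attributesOf head ⊂ ⊤
    disjoint       : attributesOf body ∩ attributesOf head ≡ ⊥

  conjunction : Condition S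
  conjunction = body ∧ᶜ head

  size : ℕ
  size = sizeᶜ body + sizeᶜ head

Trivial : {S : Schema n} → Rule S → Database S → Set
Trivial {S = S} R T =
  ∃[ j ] Σ[ c ∈ Atomic (S j) ]
    (Rule.conjunction R j ≡ just c
     × filter (λ t → satisfiesAtom? (S j) c (t j)) T ≡ T)

Index : Set₁
Index = ∀ {n} {S : Schema n} → Rule S → Database S → ℚ

-- The support is 0/0 on the empty database; the value chosen there never
-- matters, as every rule is trivial with respect to the empty database.
sup : Index
sup R []          = 0ℚ
sup R T@(_ ∷ _) = (+ length (T ⟦ Rule.conjunction R ⟧)) / length T

Problem : (S : Schema n) → Database S → Index → ℕ → ℚ → Set
Problem S T ρ k s =
  Σ[ R ∈ Rule S ] (¬ Trivial R T × k ≤ Rule.size R × s ≤ℚ ρ R T)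

------------------------------------------------------------------------
-- The decision problem as a language of bit strings

Word : Set
Word = List Bool

Language : (ℓ : Level) → Set (lsuc ℓ)
Language ℓ = Pred Word ℓ

-- Binary notation, least significant bit first.
binary : Vec Bool n → ℕ
binary []           = 0
binary (true  ∷ bs) = 1 + 2 * binary bs
binary (false ∷ bs) = 2 * binary bs

record BooleanInstance (k : ℕ) : Set₁ where
  field
    {#attributes} : ℕ
    {schema}      : Schema #attributes
    boolean       : ∀ j → IsBoolean (schema j)
    k≤#attributes : k ≤ #attributes
    database      : Database schema
    -- a and b are padded with leading zeros to a common width.
    {width}       : ℕ
    a b           : Vec Bool width
    .{{b≢0}}      : NonZero (binary b)

  threshold : ℚ
  threshold = (+ binary a) / binary b

  field
    0<threshold   : 0ℚ <ℚ threshold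
    threshold≤1   : threshold ≤ℚ 1ℚ

unary : ℕ → Word
unary m = replicate m true ++ [ false ]

-- The bits of the matrix (row by row), of a and of b are preceded by the
-- dimensions in unary, which make the string uniquely decodable. For a
-- non-empty database they at most increase its length by a constant factor.
encode : ∀ {k} → BooleanInstance k → Word
encode I =
  unary (length database) ++ unary #attributes ++ unary width
  ++ concatMap (λ t → tabulate (λ j → is-just (t j))) database
  ++ toList a ++ toList b
  where open BooleanInstance I

BooleanProblem : Index → ℕ → Language (lsuc Level.zero)
BooleanProblem ρ k w =
  Σ[ I ∈ BooleanInstance k ]
    (encode I ≡ w
     × Problem (BooleanInstance.schema I) (BooleanInstance.database I) ρ k
         (BooleanInstance.threshold I))

------------------------------------------------------------------------
-- Threshold circuits

-- A wire leaving one of N inputs or one of g gates; gates are numbered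
-- backwards, 0 being the most recent one.
data Wire (N g : ℕ) : Set where
  input : Fin N → Wire N g
  gate  : Fin g → Wire N g

data Gate (N g : ℕ) : Set where
  NOT      : Wire N g → Gate N g
  MAJORITY : List (Wire N g) → Gate N g

data Gates (N : ℕ) : ℕ → Set where
  []  : Gates N 0
  _▷_ : Gates N g → Gate N g → Gates N (suc g)

infixl 5 _▷_

-- The output of a circuit is that of its last gate.
Circuit : ℕ → Set
Circuit N = ∃[ g ] Gates N (suc g)

gateWires : Gate N g → List (Wire N g)
gateWires (NOT w)       = [ w ]
gateWires (MAJORITY ws) = ws

module _ {N : ℕ} (x : Vec Bool N) where

  wireValue : Vec Bool g → Wire N g → Bool
  wireValue vs (input i) = Vec.lookup x i
  wireValue vs (gate j)  = Vec.lookup vs j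

  gateValue : Vec Bool g → Gate N g → Bool
  gateValue vs (NOT w)       = not (wireValue vs w)
  gateValue vs (MAJORITY ws) =
    does (length ws <? 2 * length (filter (λ w → wireValue vs w ≟ᵇ true) ws))

  gateValues : Gates N g → Vec Bool g
  gateValues []      = []
  gateValues (G ▷ γ) = gateValue (gateValues G) γ ∷ gateValues G

evaluate : Circuit N → Vec Bool N → Bool
evaluate (_ , G) x = Vec.head (gateValues x G)

-- Gates and wires are both counted, since a gate may read the same wire
-- several times.
gatesSize : Gates N g → ℕ
gatesSize []      = 0
gatesSize (G ▷ γ) = gatesSize G + suc (length (gateWires γ))

size : Circuit N → ℕ
size (_ , G) = gatesSize G

wireDepth : Vec ℕ g → Wire N g → ℕ
wireDepth ds (input _) = 0
wireDepth ds (gate j)  = Vec.lookup ds j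

gateDepths : Gates N g → Vec ℕ g
gateDepths []      = []
gateDepths (G ▷ γ) = suc (foldr max 0 (map (wireDepth ds) (gateWires γ))) ∷ ds
  where ds = gateDepths G

depth : Circuit N → ℕ
depth (_ , G) = Vec.foldr′ max 0 (gateDepths G)

-- Circuits are described gate by gate. The numbers of inputs and gates are
-- written in unary; in a description of polynomial size this costs no more
-- than a polynomial blow-up.
data Symbol : Set where
  not-gate majority-gate input-wire gate-wire tick : Symbol

describeWire : Wire N g → List Symbol
describeWire (input i) = input-wire ∷ replicate (toℕ i) tick
describeWire (gate j)  = gate-wire  ∷ replicate (toℕ j) tick

describeGate : Gate N g → List Symbol
describeGate (NOT w)       = not-gate ∷ describeWire w
describeGate (MAJORITY ws) = majority-gate ∷ concatMap describeWire ws

describeGates : Gates N g → List Symbol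
describeGates []      = []
describeGates (G ▷ γ) = describeGates G ++ describeGate γ

describe : Circuit N → List Symbol
describe (_ , G) = describeGates G

------------------------------------------------------------------------
-- Space-bounded Turing transducers

Finite : Set → Set
Finite A = ∃[ m ] (A ↔ Fin m)

data Direction : Set where
  left stay right : Direction

data InputCell (Σᵢ : Set) : Set where
  ⊢ ⊣ : InputCell Σᵢ
  sym : Σᵢ → InputCell Σᵢ

-- The visited part of a two-way infinite tape. The cells to the left of
-- the head are listed from the head outwards, as are those to its right.
record Tape (Γ : Set) : Set where
  constructor tape
  field
    leftCells  : List Γ
    scanned    : Γ
    rightCells : List Γ

module _ {Γ : Set} (blank : Γ) where

  move : Direction → Tape Γ → Tape Γ
  move stay  τ                    = τ
  move left  (tape [] a rs)       = tape [] blank (a ∷ rs)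
  move left  (tape (l ∷ ls) a rs) = tape ls l (a ∷ rs)
  move right (tape ls a [])       = tape (a ∷ ls) blank []
  move right (tape ls a (r ∷ rs)) = tape (a ∷ ls) r rs

  writeMove : Γ × Direction → Tape Γ → Tape Γ
  writeMove (b , d) (tape ls _ rs) = move d (tape ls b rs)

visited : ∀ {Γ} → Tape Γ → ℕ
visited (tape ls _ rs) = length ls + suc (length rs)

-- A deterministic Turing machine with a two-way read-only input tape, a
-- fixed number of work tapes and a one-way write-only output tape. It
-- halts when no action is prescribed.
record Transducer (Σᵢ Σₒ : Set) : Set₁ where
  field
    State       : Set
    stateFinite : Finite State
    start       : State
    Γ           : Set
    Γ-finite    : Finite Γ
    blank       : Γ
    #tapes      : ℕ
    δ           : State → InputCell Σᵢ → Vec Γ #tapes →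
                  Maybe (State × Direction × Vec (Γ × Direction) #tapes × Maybe Σₒ)

module Execution {Σᵢ Σₒ : Set} (M : Transducer Σᵢ Σₒ) (w : List Σᵢ) where
  open Transducer M

  -- Position 0 of the input head is the left end marker, and position
  -- suc (length w) the right one.
  record Configuration : Set where
    constructor config
    field
      state    : State
      position : ℕ
      tapes    : Vec (Tape Γ) #tapes

  read : List Σᵢ → ℕ → InputCell Σᵢ
  read _        zero          = ⊢
  read []       (suc _)       = ⊣
  read (a ∷ _)  (suc zero)    = sym a
  read (_ ∷ as) (suc (suc i)) = read as (suc i)

  moveHead : Direction → ℕ → ℕ
  moveHead left  i = pred i
  moveHead stay  i = i
  moveHead right i = suc i ⊓ suc (length w)

  initial : Configuration
  initial = config start 0 (Vec.replicate #tapes (tape [] blank []))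

  step : Configuration → Maybe (Configuration × Maybe Σₒ)
  step (config q i τs) with δ q (read w i) (Vec.map Tape.scanned τs)
  ... | nothing               = nothing
  ... | just (q′ , d , as , o) =
    just (config q′ (moveHead d i) (Vec.zipWith (writeMove blank) as τs) , o)

  space : Configuration → ℕ
  space c = Vec.sum (Vec.map visited (Configuration.tapes c))

  -- Run b c out: started from c, the machine halts after having written
  -- out, and never uses more than b work tape cells.
  data Run (b : ℕ) (c : Configuration) : List Σₒ → Set where
    halt : space c ≤ b → step c ≡ nothing → Run b c []
    next : ∀ {c′ o out} → space c ≤ b → step c ≡ just (c′ , o) →
           Run b c′ out → Run b c (maybe′ [_] [] o ++ out)

ComputesInSpace : ∀ {Σᵢ Σₒ} → Transducer Σᵢ Σₒ → ℕ → List Σᵢ → List Σₒ → Set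
ComputesInSpace M b w out = Run b initial out
  where open Execution M w

------------------------------------------------------------------------
-- The class TC⁰

PolynomiallyBounded : (ℕ → ℕ) → Set
PolynomiallyBounded f = ∃[ e ] (∀ N → f N ≤ N ^ e + e)

Bounded : (ℕ → ℕ) → Set
Bounded f = ∃[ d ] (∀ N → f N ≤ d)

-- On input 1ᴺ, the description of the N-th circuit is output in space O(log N).
LogspaceUniform : (∀ N → Circuit N) → Set₁
LogspaceUniform C =
  Σ[ M ∈ Transducer Unit Symbol ] ∃[ c ]
    (∀ N → ComputesInSpace M (c * suc ⌊log₂ N ⌋) (replicate N tt) (describe (C N)))

record TC⁰ {ℓ : Level} (L : Language ℓ) : Set (lsuc Level.zero ⊔ ℓ) where
  field
    circuit         : ∀ N → Circuit N
    polynomialSize  : PolynomiallyBounded (λ N → size (circuit N))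
    constantDepth   : Bounded (λ N → depth (circuit N))
    logspaceUniform : LogspaceUniform circuit
    decides         : ∀ w → evaluate (circuit (length w)) (fromList w) ≡ true ⇔ L w

{-# OPTIONS --safe #-}

-- The circuits are obtained from a sentence of first-order logic with
-- arithmetic terms and the quantifier "the weights w(i) of the i < N that
-- satisfy φ add up to more than t". Unfolded over all i < N, its syntax tree is
-- a threshold circuit of constant depth. The number of gates for a subformula
-- depends on N only, so all relative gate addresses are arithmetic terms, and
-- nested loops over counters of polynomial size print the description of the
-- circuit; the counters are kept in binary on tapes of logarithmic length.
--
-- As body and head are non-empty and s > 0, the problem asks for K = max k 2
-- distinct columns, none of them constantly 1, such that c ≥ 1 rows have a 1 in
-- all of them, where c b ≥ a m. The sentence guesses the columns and some
-- v ≤ c, and has to compare v b with a m for binary numbers a and b of linear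
-- length. This holds iff ⌊2^L a / v⌋ ≤ ⌊2^L b / m⌋ for large L, and a digit of
-- such a quotient ⌊t / v⌋ is its parity, which only depends on t modulo 2v:
-- the powers of 2 that make up t may be replaced by small weights.

module Submission where

open import Data.Bool using (Bool; true; false; not; _∧_; if_then_else_; T; _∨_)
open import Data.Bool.Properties using (not-involutive; not-¬; ¬-not) renaming (_≟_ to _≟ᵇ_)
open import Data.Empty using (⊥-elim; ⊥)
import Data.Fin as Fin
open import Data.Fin using (Fin; zero; suc; toℕ; fromℕ<)
import Data.Fin.Properties as Finₚ
open import Data.Fin.Properties using (1↔⊤; +↔⊎; toℕ-fromℕ<; toℕ<n)
import Data.Fin.Subset as Subset
open import Data.Fin.Subset using (Subset; _⊂_; _∩_; _∪_; _∈_; ∣_∣; _∉_)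
open import Data.Fin.Subset.Properties using (p⊆q⇒∣p∣≤∣q∣; p⊂q⇒∣p∣<∣q∣; ∣⊥∣≡0; x∈p∪q⁻; ∉⊥; ∈⊤; ⊥⊆; ⊆⊤; Empty-unique; x∈p∩q⁻)
import Data.Integer as ℤ
open import Data.Integer using (+≤+) renaming (+_ to pos)
import Data.Integer.Properties as ℤₚ
open import Data.List using (List; []; _∷_; _++_; [_]; length; map; replicate; _ʳ++_; foldr; concatMap; filter; tabulate; applyUpTo)
open import Data.List.Properties using (++-assoc; length-++; length-map; length-replicate; ++-identityʳ; map-++; concatMap-++; length-tabulate; filter-all; length-applyUpTo)
open import Data.List.Relation.Unary.All as All using (All; []; _∷_)
import Data.List.Relation.Unary.All.Properties as Allₚ
open import Data.Maybe using (Maybe; just; nothing; maybe; maybe′; is-just; _<∣>_)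
import Data.Maybe.Relation.Unary.All as MaybeAll
import Data.Maybe.Relation.Unary.Any as MaybeAny
open import Data.Nat using (ℕ; zero; suc; pred; _⊓_; _+_; _*_; _≤_; z≤n; s≤s; _^_; _<_; _∸_; _≡ᵇ_; _≤ᵇ_; _<ᵇ_; NonZero; >-nonZero) renaming (_⊔_ to max)
open import Data.Nat.DivMod using (_/_; m/n*n≤m; 0/n≡0; m≡m%n+[m/n]*n; m%n<n)
open import Data.Nat.Logarithm using (⌊log₂_⌋; ⌊log₂⌋-mono-≤; ⌊log₂[2^n]⌋≡n)
open import Data.Nat.Properties
open import Data.Nat.Tactic.RingSolver using (solve-∀)
open import Data.Product using (Σ-syntax; ∃-syntax; _×_; _,_; proj₁; proj₂)
open import Data.Rational using (0ℚ; 1ℚ) renaming (_/_ to _/ℚ_; _≤_ to _≤ℚ_; _<_ to _<ℚ_)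
import Data.Rational.Properties as ℚₚ
open import Data.Rational.Unnormalised using (mkℚᵘ; *≤*)
import Data.Rational.Unnormalised.Properties as ℚᵘₚ
open import Data.Sum using (_⊎_; inj₁; inj₂)
open import Data.Sum.Function.Propositional using (_⊎-↔_)
open import Data.Unit using (tt) renaming (⊤ to Unit)
import Data.Unit.Properties as Unitₚ
import Data.Vec as Vec
open import Data.Vec using (Vec; []; _∷_; lookup; _[_]≔_; toList; fromList)
open import Data.Vec.Properties using (lookup∘updateAt; lookup∘updateAt′; []≔-commutes; []≔-lookup; lookup-map; lookup-replicate; toList∘fromList; zipWith-replicate; length-toList; lookup∘tabulate; []=⇒lookup; lookup⇒[]=)
open import Defs renaming (sym to symbol)
open import Function.Base using (_∘_)
open import Function.Bundles using (mk↔ₛ′; _⇔_; mk⇔)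
open import Function.Construct.Composition using (_↔-∘_)
open import Function.Construct.Symmetry using (↔-sym)
open import Relation.Binary.Definitions using (tri<; tri≈; tri>)
open import Relation.Binary.PropositionalEquality using (_≡_; refl; sym; trans; cong; subst; _≢_; cong₂; subst₂)
open import Relation.Nullary using (yes; no; ¬_)
open import Relation.Unary using (Decidable)

-- Structured tape programs and their compilation to transducers

-- The obstacle is that repetition of a wire is the only way to give it a weight, so weights must
-- stay polynomial in N, whereas the bits of a and b stand for powers of 2 up to 2 ^ (W - 1). A
-- digit of a quotient needs them only modulo twice the divisor, and the divisors are at most m. N
-- digits are enough: two different fractions a / v and b / m differ by at least 1 / (v m), and as
-- there is a column, the word has at least 2 m + W bits, so that v m ≤ 2 ^ (N - W).
--
-- All kinds of atomic conditions reduce to the presence of a value. A rule of positive support has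
-- a row that satisfies all its conditions. A boolean attribute has one non-null value, hence each
-- condition of the rule is satisfied by exactly the non-null entries of its column, and it makes
-- the rule trivial just if that column is full.
--
-- Words that encode no instance must be rejected. The sentence therefore also checks the shape of
-- the word and 0 < a ≤ b, and every accepted word is decoded to an instance, whose attributes are
-- taken to be categorical with a single value.

data Cell : Set where
  blank home : Cell
  bit        : Bool → Cell

cell-finite : Finite Cell
cell-finite = 4 , mk↔ₛ′ to from to∘from from∘to
  where
  to : Cell → Fin 4
  to blank       = zero
  to home        = suc zero
  to (bit false) = suc (suc zero)
  to (bit true)  = suc (suc (suc zero))
  from : Fin 4 → Cell
  from zero                   = blank
  from (suc zero)             = home
  from (suc (suc zero))       = bit false
  from (suc (suc (suc zero))) = bit true
  to∘from : ∀ i → to (from i) ≡ i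
  to∘from zero                   = refl
  to∘from (suc zero)             = refl
  to∘from (suc (suc zero))       = refl
  to∘from (suc (suc (suc zero))) = refl
  from∘to : ∀ c → from (to c) ≡ c
  from∘to blank       = refl
  from∘to home        = refl
  from∘to (bit false) = refl
  from∘to (bit true)  = refl

⊤-finite : Finite Unit
⊤-finite = 1 , ↔-sym 1↔⊤

⊎-finite : ∀ {A B} → Finite A → Finite B → Finite (A ⊎ B)
⊎-finite (m , f) (n , g) = m + n , (↔-sym +↔⊎ ↔-∘ (f ⊎-↔ g))

maybe-finite : ∀ {A} → Finite A → Finite (Maybe A)
maybe-finite {A} fin with ⊎-finite ⊤-finite fin
... | n , f = n , (f ↔-∘ mk↔ₛ′ to from to∘from from∘to)
  where
  to : Maybe A → Unit ⊎ A
  to nothing  = inj₁ tt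
  to (just a) = inj₂ a
  from : Unit ⊎ A → Maybe A
  from (inj₁ _) = nothing
  from (inj₂ a) = just a
  to∘from : ∀ x → to (from x) ≡ x
  to∘from (inj₁ _) = refl
  to∘from (inj₂ _) = refl
  from∘to : ∀ x → from (to x) ≡ x
  from∘to nothing  = refl
  from∘to (just _) = refl

module Commands (R : ℕ) where

  Scan : Set
  Scan = Vec Cell R

  Action : Set
  Action = Direction × Vec (Cell × Direction) R × Maybe Symbol

  data Cmd : Set where
    act   : (InputCell Unit → Scan → Action) → Cmd
    _⨾_   : Cmd → Cmd → Cmd
    while : (InputCell Unit → Scan → Bool) → Cmd → Cmd

  infixr 5 _⨾_

  -- The program counter: one point for each `act` and one for each loop test. Commands are finite
  -- trees, so these are finitely many states.
  Point : Cmd → Set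
  Point (act _)     = Unit
  Point (c ⨾ d)     = Point c ⊎ Point d
  Point (while _ c) = Unit ⊎ Point c

  point-finite : ∀ c → Finite (Point c)
  point-finite (act _)     = ⊤-finite
  point-finite (c ⨾ d)     = ⊎-finite (point-finite c) (point-finite d)
  point-finite (while _ c) = ⊎-finite ⊤-finite (point-finite c)

  entry : ∀ c → Point c
  entry (act _)     = tt
  entry (c ⨾ d)     = inj₁ (entry c)
  entry (while _ c) = inj₁ tt

  stayPut : Scan → Vec (Cell × Direction) R
  stayPut = Vec.map (_, stay)

  -- `nothing` as next point means that control leaves the command; the enclosing command decides
  -- where it continues.
  trans′ : ∀ c → Point c → InputCell Unit → Scan → Maybe (Point c) × Action
  trans′ (act f)     _        i v = nothing , f i v
  trans′ (c ⨾ d)     (inj₁ p) i v with trans′ c p i v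
  ... | q , a = just (maybe inj₁ (inj₂ (entry d)) q) , a
  trans′ (c ⨾ d)     (inj₂ p) i v with trans′ d p i v
  ... | q , a = maybe (just ∘ inj₂) nothing q , a
  trans′ (while b c) (inj₁ _) i v with b i v
  ... | true  = just (inj₂ (entry c)) , stay , stayPut v , nothing
  ... | false = nothing , stay , stayPut v , nothing
  trans′ (while b c) (inj₂ p) i v with trans′ c p i v
  ... | q , a = just (maybe inj₂ (inj₁ tt) q) , a

  machine : Cmd → Transducer Unit Symbol
  machine c = record
    { State = Maybe (Point c) ; stateFinite = maybe-finite (point-finite c) ; start = just (entry c)
    ; Γ = Cell ; Γ-finite = cell-finite ; blank = blank ; #tapes = R ; δ = δ }
    where
    δ : Maybe (Point c) → InputCell Unit → Scan → Maybe (Maybe (Point c) × Action)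
    δ nothing  _ _ = nothing
    δ (just p) i v = just (trans′ c p i v)

  Tapes : Set
  Tapes = Vec (Tape Cell) R

  scan : Tapes → Scan
  scan = Vec.map Tape.scanned

  applyAll : Vec (Cell × Direction) R → Tapes → Tapes
  applyAll = Vec.zipWith (writeMove blank)

  applyAll-stayPut : ∀ {n} (τs : Vec (Tape Cell) n) →
    Vec.zipWith (writeMove blank) (Vec.map (_, stay) (Vec.map Tape.scanned τs)) τs ≡ τs
  applyAll-stayPut []                = refl
  applyAll-stayPut (tape _ _ _ ∷ τs) = cong (_ ∷_) (applyAll-stayPut τs)

  module Semantics (w : List Unit) (S : ℕ) where

    -- Repeated from `Execution`, which depends on the machine: executions of a command must make
    -- sense before the command becomes part of a whole program.
    read : List Unit → ℕ → InputCell Unit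
    read _        zero          = ⊢
    read []       (suc _)       = ⊣
    read (a ∷ _)  (suc zero)    = symbol a
    read (_ ∷ as) (suc (suc i)) = read as (suc i)

    moveHead : Direction → ℕ → ℕ
    moveHead left  i = pred i
    moveHead stay  i = i
    moveHead right i = suc i ⊓ suc (length w)

    Fits : Tapes → Set
    Fits τs = ∀ z → visited (Vec.lookup τs z) ≤ S

    -- Every rule that stands for a machine step demands `Fits`, so the space bound covers all
    -- intermediate configurations and not just the two ends.
    data Exec : Cmd → ℕ → Tapes → List Symbol → ℕ → Tapes → Set where
      act : ∀ {f p τs p′ τs′ o} → Fits τs →
            let a = f (read w p) (scan τs) in
            moveHead (proj₁ a) p ≡ p′ → applyAll (proj₁ (proj₂ a)) τs ≡ τs′ →
            maybe′ [_] [] (proj₂ (proj₂ a)) ≡ o →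
            Exec (act f) p τs o p′ τs′
      seq : ∀ {c d p τs o p′ τs′ o′ p″ τs″} →
            Exec c p τs o p′ τs′ → Exec d p′ τs′ o′ p″ τs″ →
            Exec (c ⨾ d) p τs (o ++ o′) p″ τs″
      stop : ∀ {b c p τs} → Fits τs → b (read w p) (scan τs) ≡ false →
             Exec (while b c) p τs [] p τs
      go  : ∀ {b c p τs o p′ τs′ o′ p″ τs″} → Fits τs → b (read w p) (scan τs) ≡ true →
            Exec c p τs o p′ τs′ → Exec (while b c) p′ τs′ o′ p″ τs″ →
            Exec (while b c) p τs (o ++ o′) p″ τs″

    module Simulation (main : Cmd) where

      private
        M = machine main
        module E = Execution M w

      open E using (config; Run)

      space-bound : ∀ {n} (τs : Vec (Tape Cell) n) →
        (∀ z → visited (Vec.lookup τs z) ≤ S) → Vec.sum (Vec.map visited τs) ≤ n * S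
      space-bound []       h = z≤n
      space-bound (τ ∷ τs) h = +-mono-≤ (h zero) (space-bound τs (h ∘ suc))

      -- The machine behaves on the points of a subcommand as the subcommand does, with leaving it
      -- redirected to the state `q`.
      Embeds : ∀ c → (Point c → Maybe (Point main)) → Maybe (Point main) → Set
      Embeds c ι q = ∀ p i v → Transducer.δ M (ι p) i v ≡
        just (maybe ι q (proj₁ (trans′ c p i v)) , proj₂ (trans′ c p i v))

      read-irrelevant : ∀ u p → E.read u p ≡ read u p
      read-irrelevant _        zero          = refl
      read-irrelevant []       (suc _)       = refl
      read-irrelevant (_ ∷ _)  (suc zero)    = refl
      read-irrelevant (_ ∷ as) (suc (suc i)) = read-irrelevant as (suc i)

      moveHead-irrelevant : ∀ d p → E.moveHead d p ≡ moveHead d p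
      moveHead-irrelevant left  _ = refl
      moveHead-irrelevant stay  _ = refl
      moveHead-irrelevant right _ = refl

      step-by : ∀ {q p τs q′ d as o} →
        Transducer.δ M q (read w p) (scan τs) ≡ just (q′ , d , as , o) →
        E.step (config q p τs) ≡ just (config q′ (moveHead d p) (applyAll as τs) , o)
      step-by {q} {p} {τs} {d = d} {as} {o} eq =
        trans (stepped (subst (λ x → Transducer.δ M q x (scan τs) ≡ _) (sym (read-irrelevant w p)) eq))
              (cong (λ p′ → just (config _ p′ (applyAll as τs) , o)) (moveHead-irrelevant d p))
        where
        stepped : ∀ {q′} → Transducer.δ M q (E.read w p) (scan τs) ≡ just (q′ , d , as , o) →
          E.step (config q p τs) ≡ just (config q′ (E.moveHead d p) (applyAll as τs) , o)
        stepped eq rewrite eq = refl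

      -- In continuation-passing style: the run from the exit state on is given, so that no
      -- concatenation of runs is needed and the embedding alone changes in the induction.
      simulate : ∀ {c p τs o p′ τs′ ι q out} → Embeds c ι q → Exec c p τs o p′ τs′ →
        Run (R * S) (config q p′ τs′) out → Run (R * S) (config (ι (entry c)) p τs) (o ++ out)
      simulate emb (act {τs = τs} fits refl refl refl) k =
        E.next (space-bound τs fits) (step-by (emb _ _ _)) k
      simulate {c = c ⨾ d} {ι = ι} {q = q} {out} emb (seq {o = o} {o′ = o′} e e′) k =
        subst (Run _ _) (sym (++-assoc o o′ out)) (simulate embˡ e (simulate embʳ e′ k))
        where
        embˡ : Embeds c (ι ∘ inj₁) (ι (inj₂ (entry d)))
        embˡ p i v with trans′ c p i v | emb (inj₁ p) i v
        ... | just _  , _ | eq = eq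
        ... | nothing , _ | eq = eq
        embʳ : Embeds d (ι ∘ inj₂) q
        embʳ p i v with trans′ d p i v | emb (inj₂ p) i v
        ... | just _  , _ | eq = eq
        ... | nothing , _ | eq = eq
      simulate {c = while b c} {ι = ι} {q = q} emb (stop {p = p} {τs = τs} fits done) k =
        subst (λ τs′ → Run _ (config q p τs′) _ → Run _ _ _) (applyAll-stayPut τs)
          (E.next (space-bound τs fits) (step-by exit)) k
        where
        exit : Transducer.δ M (ι (inj₁ tt)) (read w p) (scan τs) ≡ just (q , stay , stayPut (scan τs) , nothing)
        exit with emb (inj₁ tt) (read w p) (scan τs)
        ... | eq rewrite done = eq
      simulate {c = while b c} {ι = ι} {q = q} {out} emb (go {p = p} {τs = τs} {o = o} {o′ = o′} fits holding e e′) k =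
        subst (λ τs′ → Run _ (config (ι (inj₂ (entry c))) p τs′) _ → Run _ _ _) (applyAll-stayPut τs)
          (E.next (space-bound τs fits) (step-by enter))
          (subst (Run _ _) (sym (++-assoc o o′ out)) (simulate emb′ e (simulate emb e′ k)))
        where
        enter : Transducer.δ M (ι (inj₁ tt)) (read w p) (scan τs) ≡
                just (ι (inj₂ (entry c)) , stay , stayPut (scan τs) , nothing)
        enter with emb (inj₁ tt) (read w p) (scan τs)
        ... | eq rewrite holding = eq
        emb′ : Embeds c (ι ∘ inj₂) (ι (inj₁ tt))
        emb′ p i v with trans′ c p i v | emb (inj₂ p) i v
        ... | just _  , _ | eq = eq
        ... | nothing , _ | eq = eq

      computes : ∀ {o p′ τs′} → Exec main 0 (Vec.replicate R (tape [] blank [])) o p′ τs′ →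
                 Fits τs′ → ComputesInSpace M (R * S) w (o ++ [])
      computes {τs′ = τs′} e fits = simulate top e (E.halt (space-bound τs′ fits) refl)
        where
        top : Embeds main just nothing
        top p i v with trans′ main p i v
        ... | just _  , _ = refl
        ... | nothing , _ = refl

-- Binary counters

increment : List Bool → List Bool
increment []          = true ∷ []
increment (false ∷ u) = true ∷ u
increment (true ∷ u)  = false ∷ increment u

-- Iterating `increment` makes one execution of `inc` lead from `bits n` to `bits (suc n)` by
-- definition, and each number has one representation, so that counters can be compared bit by bit.
bits : ℕ → List Bool
bits zero    = []
bits (suc n) = increment (bits n)

value : List Bool → ℕ
value []          = 0
value (false ∷ u) = 2 * value u
value (true ∷ u)  = 1 + 2 * value u

value-increment : ∀ u → value (increment u) ≡ suc (value u)
value-increment []          = refl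
value-increment (false ∷ u) = refl
value-increment (true ∷ u)  rewrite value-increment u | +-suc (value u) (value u + 0) = refl

value-bits : ∀ n → value (bits n) ≡ n
value-bits zero    = refl
value-bits (suc n) = trans (value-increment (bits n)) (cong suc (value-bits n))

bits-injective : ∀ {m n} → bits m ≡ bits n → m ≡ n
bits-injective {m} {n} eq = trans (sym (value-bits m)) (trans (cong value eq) (value-bits n))

-- Only a string of ones grows, and L ones already have the value 2 ^ L - 1.
increment-length : ∀ u L → suc (value u) < 2 ^ L → length u ≤ L → length (increment u) ≤ L
increment-length []          zero    (s≤s ()) _
increment-length []          (suc L) _ _ = s≤s z≤n
increment-length (false ∷ u) L       _ h = h
increment-length (true ∷ u)  (suc L) v (s≤s h) = s≤s (increment-length u L v′ h)
  where
  v′ : suc (value u) < 2 ^ L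
  v′ = *-cancelˡ-< 2 _ _ (subst (_< 2 * 2 ^ L) (cong suc (sym (+-suc (value u) (value u + 0)))) v)

bits-length : ∀ n L → n < 2 ^ L → length (bits n) ≤ L
bits-length zero    L _ = z≤n
bits-length (suc n) L h = increment-length (bits n) L
  (subst (λ v → suc v < 2 ^ L) (sym (value-bits n)) h) (bits-length n L (<-trans (n<1+n n) h))

blanks : ℕ → List Cell
blanks j = replicate j blank

cells : List Bool → ℕ → List Cell
cells u j = map bit u ++ blank ∷ blanks j

-- The head stands on the first cell of `u`, or on the blank that ends the number. `j` counts the
-- visited blanks beyond that one; visited cells are never given back, so a reset leaves some.
cursor : List Cell → List Bool → ℕ → Tape Cell
cursor ls []      j = tape ls blank (blanks j)
cursor ls (b ∷ u) j = tape ls (bit b) (cells u j)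

notHome notBlank isOne : Cell → Bool
notHome home    = false
notHome _       = true
notBlank blank  = false
notBlank _      = true
isOne (bit b)   = b
isOne _         = false

-- Two blanks do not agree, since a comparison has to stop where both numbers end; `differ`
-- afterwards tells this case from a true difference.
agree : Cell → Cell → Bool
agree (bit true)  (bit b) = b
agree (bit false) (bit b) = not b
agree _           _       = false

differ : Cell → Cell → Bool
differ blank blank = false
differ a     b     = not (agree a b)

length-cells : ∀ u j → length (cells u j) ≡ suc (length u + j)
length-cells []      j = cong suc (length-replicate j)
length-cells (_ ∷ u) j = cong suc (length-cells u j)

visited-cursor : ∀ ls u j → visited (cursor ls u j) ≡ length ls + suc (length u + j)
visited-cursor ls []      j = cong (λ n → length ls + suc n) (length-replicate j)
visited-cursor ls (_ ∷ u) j = cong (λ n → length ls + suc n) (length-cells u j)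

right-cursor : ∀ ls a u j → move blank right (tape ls a (cells u j)) ≡ cursor (a ∷ ls) u j
right-cursor ls a []      j = refl
right-cursor ls a (_ ∷ u) j = refl

module Counters (R : ℕ) where

  open Commands R public

  on : Fin R → (Cell → Cell × Direction) → Cmd
  on x g = act λ _ v → stay , (stayPut v [ x ]≔ g (lookup v x)) , nothing

  whileAt : Fin R → (Cell → Bool) → Cmd → Cmd
  whileAt x t = while λ _ v → t (lookup v x)

  emit : Symbol → Cmd
  emit s = act λ _ v → stay , stayPut v , just s

  forward backward : Cell → Cell × Direction
  forward a  = a , right
  backward a = a , left

  goHome inc reset : Fin R → Cmd
  goHome x = whileAt x notHome (on x backward)
  inc x    = on x forward ⨾ whileAt x isOne (on x λ _ → bit false , right)
             ⨾ on x (λ _ → bit true , right) ⨾ goHome x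
  reset x  = on x forward ⨾ whileAt x notBlank (on x λ _ → blank , right) ⨾ goHome x

  advance compare : Fin R → Fin R → Cmd
  advance x y = on x forward ⨾ on y forward
  compare x y = advance x y ⨾ while (λ _ v → agree (lookup v x) (lookup v y)) (advance x y)

  -- The heads on x and y are kept at the first difference of the two
  -- numbers while the loop condition is tested, and sent home afterwards.
  for : Fin R → Fin R → Cmd → Cmd
  for x y c = reset x ⨾ compare x y
    ⨾ while (λ _ v → differ (lookup v x) (lookup v y))
        (goHome x ⨾ goHome y ⨾ c ⨾ inc x ⨾ compare x y)
    ⨾ goHome x ⨾ goHome y

  module Executions (w : List Unit) (L : ℕ) where

    -- L bits, the `home` cell and the blank that ends the number.
    S : ℕ
    S = 2 + L

    open Semantics w S public

    private variable
      x y : Fin R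
      τ τ′ τ″ σ σ′ : Tape Cell
      c d : Cmd

    Fits-update : ∀ {τs x τ} → Fits τs → visited τ ≤ S → Fits (τs [ x ]≔ τ)
    Fits-update {τs} {x} {τ} fits h z with x Fin.≟ z
    ... | yes refl = subst (λ t → visited t ≤ S) (sym (lookup∘updateAt x τs)) h
    ... | no x≢z   = subst (λ t → visited t ≤ S) (sym (lookup∘updateAt′ z x (x≢z ∘ sym) τs)) (fits z)

    scan-lookup : ∀ {n} (τs : Vec (Tape Cell) n) x → lookup (Vec.map Tape.scanned τs) x ≡ Tape.scanned (lookup τs x)
    scan-lookup τs x = lookup-map x Tape.scanned τs

    scan-update : ∀ (τs : Tapes) x τ → lookup (scan (τs [ x ]≔ τ)) x ≡ Tape.scanned τ
    scan-update τs x τ = trans (scan-lookup (τs [ x ]≔ τ) x) (cong Tape.scanned (lookup∘updateAt x τs))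

    applyAll-on : ∀ {n} (τs : Vec (Tape Cell) n) x τ g →
      Vec.zipWith (writeMove blank) (Vec.map (_, stay) (Vec.map Tape.scanned (τs [ x ]≔ τ)) [ x ]≔ g) (τs [ x ]≔ τ)
      ≡ τs [ x ]≔ writeMove blank g τ
    applyAll-on (_ ∷ τs)              zero    τ g = cong (_ ∷_) (applyAll-stayPut τs)
    applyAll-on (tape _ _ _ ∷ τs) (suc x) τ g = cong (_ ∷_) (applyAll-on τs x τ g)

    -- A frame rule is built in: the other tapes are arbitrary, and tape `x` is given by
    -- overwriting, so that no equation about its content is needed.
    Step : Fin R → Cmd → Tape Cell → Tape Cell → Set
    Step x c τ τ′ = ∀ τs p → Fits τs → Exec c p (τs [ x ]≔ τ) [] p (τs [ x ]≔ τ′)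

    on-step : ∀ {g} → visited τ ≤ S → Step x (on x g) τ (writeMove blank (g (Tape.scanned τ)) τ)
    on-step {τ} {x} {g} h τs p fits = act (Fits-update {τs} {x} fits h) refl
      (trans (cong (λ a → applyAll (stayPut (scan (τs [ x ]≔ τ)) [ x ]≔ g a) (τs [ x ]≔ τ)) (scan-update τs x τ))
             (applyAll-on τs x τ (g (Tape.scanned τ)))) refl

    seq-step : Step x c τ τ′ → Step x d τ′ τ″ → Step x (c ⨾ d) τ τ″
    seq-step s s′ τs p fits = seq (s τs p fits) (s′ τs p fits)

    stop-step : ∀ {t} → visited τ ≤ S → t (Tape.scanned τ) ≡ false → Step x (whileAt x t c) τ τ
    stop-step {τ} {x} {t = t} h eq τs p fits =
      stop (Fits-update {τs} {x} fits h) (trans (cong t (scan-update τs x τ)) eq)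

    go-step : ∀ {t} → visited τ ≤ S → t (Tape.scanned τ) ≡ true →
              Step x c τ τ′ → Step x (whileAt x t c) τ′ τ″ → Step x (whileAt x t c) τ τ″
    go-step {τ} {x} {t = t} h eq s s′ τs p fits =
      go (Fits-update {τs} {x} fits h) (trans (cong t (scan-update τs x τ)) eq) (s τs p fits) (s′ τs p fits)

    NotHome : Cell → Set
    NotHome a = notHome a ≡ true

    goHome-step : ∀ ls {a rs} → All NotHome (a ∷ ls) → visited (tape (ls ++ home ∷ []) a rs) ≤ S →
                  Step x (goHome x) (tape (ls ++ home ∷ []) a rs) (tape [] home (ls ʳ++ a ∷ rs))
    goHome-step []       (a ∷ []) h =
      go-step {t = notHome} h a (on-step h) (stop-step {t = notHome} h refl)
    goHome-step (l ∷ ls) {a} {rs} (na ∷ nls) h =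
      go-step {t = notHome} h na (on-step h)
        (goHome-step ls nls (subst (_≤ S) (sym (+-suc (length (ls ++ home ∷ [])) (suc (length rs)))) h))

    Room : List Cell → List Bool → ℕ → Set
    Room ls u j = length ls + (length u + j) ≤ L

    room : ∀ ls u j → Room ls u j → visited (cursor (ls ++ home ∷ []) u j) ≤ S
    room ls u j h = subst (_≤ S) (sym (trans (visited-cursor (ls ++ home ∷ []) u j) eq)) (s≤s (s≤s h))
      where
      eq : length (ls ++ home ∷ []) + suc (length u + j) ≡ 2 + (length ls + (length u + j))
      eq rewrite length-++ ls {home ∷ []} | +-comm (length ls) 1 | +-suc (length ls) (length u + j) = refl

    room-next : ∀ {a b} ls u j → Room ls (b ∷ u) j → Room (a ∷ ls) u j
    room-next ls u j h = subst (_≤ L) (+-suc (length ls) (length u + j)) h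

    forward-step : ∀ {b g a} ls u j → g (bit b) ≡ (a , right) → Room ls (b ∷ u) j →
      Step x (on x g) (cursor (ls ++ home ∷ []) (b ∷ u) j) (cursor (a ∷ ls ++ home ∷ []) u j)
    forward-step {x} {b} {g} {a} ls u j eq h = subst (Step x (on x g) _)
      (trans (cong (λ m → writeMove blank m (cursor (ls ++ home ∷ []) (b ∷ u) j)) eq)
             (right-cursor (ls ++ home ∷ []) a u j))
      (on-step {g = g} (room ls (b ∷ u) j h))

    cursor-home : ∀ ls u j → All NotHome ls → Room ls u j →
                  Step x (goHome x) (cursor (ls ++ home ∷ []) u j) (tape [] home (ls ʳ++ cells u j))
    cursor-home ls []      j nh h = goHome-step ls (refl ∷ nh) (room ls [] j h)
    cursor-home ls (b ∷ u) j nh h = goHome-step ls (refl ∷ nh) (room ls (b ∷ u) j h)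

    leave-step : ∀ u j → length u + j ≤ L →
      Step x (on x forward) (tape [] home (cells u j)) (cursor (home ∷ []) u j)
    leave-step {x} u j h = subst (Step x _ _) (right-cursor [] home u j) (on-step {g = forward} (s≤s (subst (_≤ suc L) (sym (length-cells u j)) (s≤s h))))

    -- A carry beyond the top bit uses up one visited blank, or visits a new cell if none is left.
    spare : List Bool → ℕ → ℕ
    spare []          j = pred j
    spare (false ∷ u) j = j
    spare (true ∷ u)  j = spare u j

    spare-fits : ∀ u j {l} → length u + j ≤ l → length (increment u) ≤ l → length (increment u) + spare u j ≤ l
    spare-fits []          zero    _ h = h
    spare-fits []          (suc j) h _ = h
    spare-fits (false ∷ u) j       h _ = h
    spare-fits (true ∷ u)  j       (s≤s h) (s≤s h′) = s≤s (spare-fits u j h h′)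

    -- The tape in the middle is the one on which the carry stops. Where that is depends on `u`,
    -- hence the existential shared by both phases.
    inc-loop : ∀ ls u j → All NotHome ls → Room ls u j → length ls + length (increment u) ≤ L →
      ∃[ τ ] (Step x (whileAt x isOne (on x λ _ → bit false , right)) (cursor (ls ++ home ∷ []) u j) τ
            × Step x (on x (λ _ → bit true , right) ⨾ goHome x) τ (tape [] home (ls ʳ++ cells (increment u) (spare u j))))
    inc-loop ls [] zero nh h h′ = _ , stop-step {t = isOne} (room ls [] 0 h) refl ,
      seq-step (on-step (room ls [] 0 h))
               (cursor-home (bit true ∷ ls) [] 0 (refl ∷ nh) (subst (_≤ L) (+-suc (length ls) 0) h′))
    inc-loop ls [] (suc j) nh h h′ = _ , stop-step {t = isOne} (room ls [] (suc j) h) refl ,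
      seq-step (on-step (room ls [] (suc j) h))
               (cursor-home (bit true ∷ ls) [] j (refl ∷ nh) (subst (_≤ L) (+-suc (length ls) j) h))
    inc-loop ls (false ∷ u) j nh h h′ = _ , stop-step {t = isOne} (room ls (false ∷ u) j h) refl ,
      seq-step (forward-step ls u j refl h)
               (cursor-home (bit true ∷ ls) u j (refl ∷ nh) (room-next {a = bit true} {b = true} ls u j h))
    inc-loop ls (true ∷ u) j nh h h′
      with inc-loop (bit false ∷ ls) u j (refl ∷ nh) (room-next {a = bit true} {b = true} ls u j h)
                    (subst (_≤ L) (+-suc (length ls) (length (increment u))) h′)
    ... | _ , s , s′ = _ , go-step {t = isOne} (room ls (true ∷ u) j h) refl (forward-step ls u j refl h) s , s′

    reset-loop : ∀ ls u j → All NotHome ls → Room ls u j →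
      ∃[ τ ] (Step x (whileAt x notBlank (on x λ _ → blank , right)) (cursor (ls ++ home ∷ []) u j) τ
            × Step x (goHome x) τ (tape [] home (ls ʳ++ cells [] (length u + j))))
    reset-loop ls []      j nh h = _ , stop-step {t = notBlank} (room ls [] j h) refl , cursor-home ls [] j nh h
    reset-loop ls (b ∷ u) j nh h
      with reset-loop (blank ∷ ls) u j (refl ∷ nh) (room-next {a = blank} {b = true} ls u j h)
    ... | _ , s , s′ = _ , go-step {t = notBlank} (room ls (b ∷ u) j h) refl (forward-step ls u j refl h) s , s′

    Counter : ℕ → Tape Cell → Set
    Counter n τ = n < 2 ^ L × ∃[ j ] (length (bits n) + j ≤ L × τ ≡ tape [] home (cells (bits n) j))

    counter-visited : ∀ {n} → Counter n τ → visited τ ≤ S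
    counter-visited {n = n} (_ , j , h , refl) = s≤s (subst (_≤ suc L) (sym (length-cells (bits n) j)) (s≤s h))

    inc-step : ∀ {n} → suc n < 2 ^ L → Counter n τ → ∃[ τ′ ] (Step x (inc x) τ τ′ × Counter (suc n) τ′)
    inc-step {n = n} h (_ , j , r , refl)
      with inc-loop [] (bits n) j [] r (bits-length (suc n) L h)
    ... | _ , s , s′ = _ , seq-step (leave-step (bits n) j r) (seq-step s s′) ,
      h , _ , spare-fits (bits n) j r (bits-length (suc n) L h) , refl

    reset-step : ∀ {n} → Counter n τ → ∃[ τ′ ] (Step x (reset x) τ τ′ × Counter 0 τ′)
    reset-step {n = n} (_ , j , r , refl) with reset-loop [] (bits n) j [] r
    ... | _ , s , s′ = _ , seq-step (leave-step (bits n) j r) (seq-step s s′) ,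
      m^n>0 2 L , _ , r , refl

    Step₂ : Fin R → Fin R → Cmd → Tape Cell → Tape Cell → Tape Cell → Tape Cell → Set
    Step₂ x y c τ σ τ′ σ′ = ∀ τs p → Fits τs →
      Exec c p ((τs [ x ]≔ τ) [ y ]≔ σ) [] p ((τs [ x ]≔ τ′) [ y ]≔ σ′)

    onˡ : x ≢ y → visited σ ≤ S → Step x c τ τ′ → Step₂ x y c τ σ τ′ σ
    onˡ {x} {y} {σ} {c} {τ} {τ′} x≢y h s τs p fits
      rewrite []≔-commutes {x = τ} {y = σ} τs x y x≢y | []≔-commutes {x = τ′} {y = σ} τs x y x≢y =
      s (τs [ y ]≔ σ) p (Fits-update {τs} {y} fits h)

    onʳ : visited τ ≤ S → Step y c σ σ′ → Step₂ x y c τ σ τ σ′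
    onʳ {x = x} h s τs p fits = s (τs [ x ]≔ _) p (Fits-update {τs} {x} fits h)

    seq-step₂ : Step₂ x y c τ σ τ′ σ′ → ∀ {τ″ σ″} → Step₂ x y d τ′ σ′ τ″ σ″ → Step₂ x y (c ⨾ d) τ σ τ″ σ″
    seq-step₂ s s′ τs p fits = seq (s τs p fits) (s′ τs p fits)

    scan-updateˡ : x ≢ y → ∀ (τs : Tapes) → lookup (scan ((τs [ x ]≔ τ) [ y ]≔ σ)) x ≡ Tape.scanned τ
    scan-updateˡ {x} {y} {τ} {σ} x≢y τs = trans (scan-lookup ((τs [ x ]≔ τ) [ y ]≔ σ) x)
      (cong Tape.scanned (trans (lookup∘updateAt′ x y x≢y (τs [ x ]≔ τ)) (lookup∘updateAt x τs)))

    cond₂ : ∀ {A : Set} (f : Cell → Cell → A) → x ≢ y → ∀ (τs : Tapes) → 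
      f (lookup (scan ((τs [ x ]≔ τ) [ y ]≔ σ)) x) (lookup (scan ((τs [ x ]≔ τ) [ y ]≔ σ)) y)
      ≡ f (Tape.scanned τ) (Tape.scanned σ)
    cond₂ {x} {y} {τ} {σ} f x≢y τs = cong₂ f (scan-updateˡ x≢y τs) (scan-update (τs [ x ]≔ τ) y σ)

    fits₂ : ∀ {τs} → Fits τs → visited τ ≤ S → visited σ ≤ S → Fits ((τs [ x ]≔ τ) [ y ]≔ σ)
    fits₂ {x = x} {y} {τs} fits h h′ = Fits-update {τs [ x ]≔ _} {y} (Fits-update {τs} {x} fits h) h′

    advance-step : ∀ ls ls′ {a b} u v j j′ → x ≢ y → Room ls (a ∷ u) j → Room ls′ (b ∷ v) j′ →
      Step₂ x y (advance x y) (cursor (ls ++ home ∷ []) (a ∷ u) j) (cursor (ls′ ++ home ∷ []) (b ∷ v) j′)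
                              (cursor (bit a ∷ ls ++ home ∷ []) u j) (cursor (bit b ∷ ls′ ++ home ∷ []) v j′)
    advance-step ls ls′ {a} {b} u v j j′ x≢y h h′ = seq-step₂
      (onˡ x≢y (room ls′ (b ∷ v) j′ h′) (forward-step {g = forward} ls u j refl h))
      (onʳ (room (bit a ∷ ls) u j (room-next {a = bit a} {b = a} ls u j h)) (forward-step {g = forward} ls′ v j′ refl h′))

    -- A comparison leaves both heads displaced, so its result includes the way back home to `τ₀`
    -- and `σ₀`. `e` is what the loop test sees in between.
    Compared : Bool → Fin R → Fin R → Cmd → (τ σ τ₀ σ₀ : Tape Cell) → Set
    Compared e x y c τ σ τ₀ σ₀ = Σ[ τ′ ∈ Tape Cell ] Σ[ σ′ ∈ Tape Cell ]
      (Step₂ x y c τ σ τ′ σ′ × differ (Tape.scanned τ′) (Tape.scanned σ′) ≡ e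
       × visited τ′ ≤ S × visited σ′ ≤ S
       × Step x (goHome x) τ′ τ₀ × Step y (goHome y) σ′ σ₀)

    distinct : List Bool → List Bool → Bool
    distinct []          []          = false
    distinct []          (_ ∷ _)     = true
    distinct (_ ∷ _)     []          = true
    distinct (true ∷ u)  (false ∷ v) = true
    distinct (false ∷ u) (true ∷ v)  = true
    distinct (true ∷ u)  (true ∷ v)  = distinct u v
    distinct (false ∷ u) (false ∷ v) = distinct u v

    distinct-refl : ∀ u → distinct u u ≡ false
    distinct-refl []          = refl
    distinct-refl (true ∷ u)  = distinct-refl u
    distinct-refl (false ∷ u) = distinct-refl u

    distinct-≢ : ∀ u v → u ≢ v → distinct u v ≡ true
    distinct-≢ []          []          ne = ⊥-elim (ne refl)
    distinct-≢ []          (_ ∷ _)     ne = refl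
    distinct-≢ (_ ∷ _)     []          ne = refl
    distinct-≢ (true ∷ u)  (false ∷ v) ne = refl
    distinct-≢ (false ∷ u) (true ∷ v)  ne = refl
    distinct-≢ (true ∷ u)  (true ∷ v)  ne = distinct-≢ u v (ne ∘ cong (true ∷_))
    distinct-≢ (false ∷ u) (false ∷ v) ne = distinct-≢ u v (ne ∘ cong (false ∷_))

    module _ {x y : Fin R} (x≢y : x ≢ y) where

      compare-loop : ∀ ls ls′ u v j j′ → All NotHome ls → All NotHome ls′ → Room ls u j → Room ls′ v j′ →
        Compared (distinct u v) x y (while (λ _ v → agree (lookup v x) (lookup v y)) (advance x y))
          (cursor (ls ++ home ∷ []) u j) (cursor (ls′ ++ home ∷ []) v j′)
          (tape [] home (ls ʳ++ cells u j)) (tape [] home (ls′ ʳ++ cells v j′))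
      compare-loop ls ls′ u v j j′ nh nh′ h h′ = by u v h h′
        where
        Goal : List Bool → List Bool → Set
        Goal u v = Compared (distinct u v) x y (while (λ _ v → agree (lookup v x) (lookup v y)) (advance x y))
          (cursor (ls ++ home ∷ []) u j) (cursor (ls′ ++ home ∷ []) v j′)
          (tape [] home (ls ʳ++ cells u j)) (tape [] home (ls′ ʳ++ cells v j′))
        halt-at : ∀ u v → Room ls u j → Room ls′ v j′ →
          agree (Tape.scanned (cursor (ls ++ home ∷ []) u j)) (Tape.scanned (cursor (ls′ ++ home ∷ []) v j′)) ≡ false →
          differ (Tape.scanned (cursor (ls ++ home ∷ []) u j)) (Tape.scanned (cursor (ls′ ++ home ∷ []) v j′))
            ≡ distinct u v →
          Goal u v
        halt-at u v h h′ eq eq′ = _ , _ ,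
          (λ τs p fits → stop (fits₂ {τs = τs} fits (room ls u j h) (room ls′ v j′ h′)) (trans (cond₂ agree x≢y τs) eq)) ,
          eq′ , room ls u j h , room ls′ v j′ h′ , cursor-home ls u j nh h , cursor-home ls′ v j′ nh′ h′
        continue : ∀ b u v → Room ls (b ∷ u) j → Room ls′ (b ∷ v) j′ → agree (bit b) (bit b) ≡ true →
          distinct u v ≡ distinct (b ∷ u) (b ∷ v) → Goal (b ∷ u) (b ∷ v)
        continue b u v h h′ eq eq′
          with compare-loop (bit b ∷ ls) (bit b ∷ ls′) u v j j′ (refl ∷ nh) (refl ∷ nh′)
                 (room-next {a = bit b} {b = b} ls u j h) (room-next {a = bit b} {b = b} ls′ v j′ h′)
        ... | _ , _ , s , e , rest = _ , _ ,
          (λ τs p fits → go (fits₂ {τs = τs} fits (room ls (b ∷ u) j h) (room ls′ (b ∷ v) j′ h′))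
                            (trans (cond₂ agree x≢y τs) eq)
                            (advance-step ls ls′ u v j j′ x≢y h h′ τs p fits) (s τs p fits)) ,
          trans e eq′ , rest
        by : ∀ u v → Room ls u j → Room ls′ v j′ → Goal u v
        by []          []          h h′ = halt-at [] [] h h′ refl refl
        by []          (_ ∷ v)     h h′ = halt-at [] (_ ∷ v) h h′ refl refl
        by (true ∷ u)  []          h h′ = halt-at (true ∷ u) [] h h′ refl refl
        by (false ∷ u) []          h h′ = halt-at (false ∷ u) [] h h′ refl refl
        by (true ∷ u)  (false ∷ v) h h′ = halt-at (true ∷ u) (false ∷ v) h h′ refl refl
        by (false ∷ u) (true ∷ v)  h h′ = halt-at (false ∷ u) (true ∷ v) h h′ refl refl
        by (true ∷ u)  (true ∷ v)  h h′ = continue true u v h h′ refl refl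
        by (false ∷ u) (false ∷ v) h h′ = continue false u v h h′ refl refl

      compare-step : ∀ {m n} → Counter m τ → Counter n σ →
                     Compared (distinct (bits m) (bits n)) x y (compare x y) τ σ τ σ
      compare-step {m = m} {n} C@(_ , j , r , refl) D@(_ , j′ , r′ , refl)
        with compare-loop [] [] (bits m) (bits n) j j′ [] [] r r′
      ... | _ , _ , s , rest = _ , _ ,
        seq-step₂ (seq-step₂ (onˡ x≢y (counter-visited D) (leave-step (bits m) j r))
                             (onʳ (room [] (bits m) j r) (leave-step (bits n) j′ r′))) s ,
        rest

-- A stack of counters and the evaluation of arithmetic terms

private variable
  A : Set

appendUpTo : (ℕ → List A) → ℕ → List A
appendUpTo f zero    = []
appendUpTo f (suc n) = appendUpTo f n ++ f n

-- A running loop produces its output front first, whereas the recursions over circuits split off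
-- the last index as `appendUpTo` does.
appendFrom : (ℕ → List A) → ℕ → ℕ → List A
appendFrom f i zero    = []
appendFrom f i (suc k) = f i ++ appendFrom f (suc i) k

appendFrom-snoc : ∀ (f : ℕ → List A) i k → appendFrom f i (suc k) ≡ appendFrom f i k ++ f (i + k)
appendFrom-snoc f i zero    rewrite +-identityʳ i = ++-identityʳ (f i)
appendFrom-snoc f i (suc k) rewrite +-suc i k =
  trans (cong (f i ++_) (appendFrom-snoc f (suc i) k)) (sym (++-assoc (f i) _ _))

appendFrom-upTo : ∀ (f : ℕ → List A) n → appendFrom f 0 n ≡ appendUpTo f n
appendFrom-upTo f zero    = refl
appendFrom-upTo f (suc n) = trans (appendFrom-snoc f 0 n) (cong (_++ f n) (appendFrom-upTo f n))

appendUpTo-[] : ∀ n → appendUpTo {A = A} (λ _ → []) n ≡ []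
appendUpTo-[] zero    = refl
appendUpTo-[] (suc n) = trans (++-identityʳ _) (appendUpTo-[] n)

-- Variable 0 is the input length N. The values of the others are listed
-- last variable first, so that the head of s is variable number length s.
look : ℕ → List ℕ → ℕ → ℕ
look N []      x = N
look N (v ∷ s) x = if x ≡ᵇ suc (length s) then v else look N s x

-- The modulus suc m is subtracted once if x + x reaches it: the factor 1 ∸ (suc m ∸ (x + x)) is the
-- indicator of suc m ≤ x + x. Only operations available on counters occur.
double : ℕ → ℕ → ℕ
double m x = (x + x) ∸ suc m * (1 ∸ (suc m ∸ (x + x)))

-- Congruent to 2 ^ e modulo suc m, but not always the least such number.
power : ℕ → ℕ → ℕ
power zero    m = 1
power (suc e) m = double m (power e m)

double≤ : ∀ m x → x ≤ suc m → double m x ≤ suc m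
double≤ m x h with ≤-total (suc m) (x + x)
... | inj₂ y≤m = ≤-trans (m∸n≤m (x + x) (suc m * (1 ∸ (suc m ∸ (x + x))))) y≤m
... | inj₁ m<y rewrite m≤n⇒m∸n≡0 m<y | *-identityʳ (suc m) =
  m≤n+o⇒m∸n≤o (x + x) (suc m) (+-mono-≤ h h)

power≤ : ∀ e m → power e m ≤ suc m
power≤ zero    m = s≤s z≤n
power≤ (suc e) m = double≤ m (power e m) (power≤ e m)

data Op : Set where
  add mul sub pow : Op

apply : Op → ℕ → ℕ → ℕ
apply add = _+_
apply mul = _*_
apply sub = _∸_
apply pow = power

data Exp : Set where
  var lit : ℕ → Exp
  op      : Op → Exp → Exp → Exp

eval : ℕ → List ℕ → Exp → ℕ
eval N s (var x)    = look N s x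
eval N s (lit c)    = c
eval N s (op o a b) = apply o (eval N s a) (eval N s b)

-- Room needed above the stack. The 24 is a generous allowance for the scratch registers of one
-- operation, of which `doubleC` uses the most.
expWidth : Exp → ℕ
expWidth (op _ a b) = 24 + (expWidth a + expWidth b)
expWidth _          = 2

module Stack (R : ℕ) where

  open Counters (suc R) public

  -- Truncated at the last register to be total; all triples keep to x ≤ R, where it is injective.
  register : ∀ {r} → ℕ → Fin (suc r)
  register {r}     zero    = zero
  register {zero}  (suc x) = zero
  register {suc r} (suc x) = suc (register x)

  register-injective : ∀ {r x y} → x ≤ r → y ≤ r → register {r} x ≡ register y → x ≡ y
  register-injective z≤n     z≤n     eq = refl
  register-injective (s≤s h) (s≤s i) eq = cong suc (register-injective h i (Finₚ.suc-injective eq))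

  new : ℕ → Cmd
  new d = reset (register (suc d))

  incr : ℕ → Cmd
  incr x = inc (register x)

  loop : ℕ → ℕ → Cmd → Cmd
  loop d y = for (register (suc d)) (register y)

  -- Values are copied by counting up to them, because resetting, incrementing and comparing are the
  -- only primitives.
  store : ℕ → ℕ → ℕ → Cmd
  store d x y = reset (register x) ⨾ loop d y (incr x)

  push : ℕ → ℕ → Cmd
  push d y = new d ⨾ loop (1 + d) y (incr (1 + d))

  literal : ℕ → ℕ → Cmd
  literal d zero    = new d
  literal d (suc c) = literal d c ⨾ incr (suc d)

  -- d is the number of values below the operands.
  addC mulC predC subC doubleC powC : ℕ → Cmd
  addC d = loop (2 + d) (2 + d) (incr (1 + d))
  mulC d = new (2 + d) ⨾ loop (3 + d) (1 + d) (loop (4 + d) (2 + d) (incr (3 + d)))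
           ⨾ store (3 + d) (1 + d) (3 + d)
  predC d = new (3 + d) ⨾ new (4 + d)
            ⨾ loop (5 + d) (1 + d) (store (6 + d) (4 + d) (5 + d) ⨾ incr (5 + d))
            ⨾ store (5 + d) (1 + d) (4 + d)
  subC d = loop (2 + d) (2 + d) (predC d)
  doubleC d = push (4 + d) (3 + d) ⨾ push (5 + d) (3 + d) ⨾ addC (4 + d)
              ⨾ push (5 + d) (2 + d) ⨾ incr (6 + d)
              ⨾ literal (6 + d) 1
              ⨾ push (7 + d) (2 + d) ⨾ incr (8 + d)
              ⨾ push (8 + d) (5 + d) ⨾ subC (7 + d) ⨾ subC (6 + d) ⨾ mulC (5 + d) ⨾ subC (4 + d)
              ⨾ store (5 + d) (3 + d) (5 + d)
  powC d = literal (2 + d) 1 ⨾ loop (3 + d) (1 + d) (doubleC d) ⨾ store (3 + d) (1 + d) (3 + d)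

  opC : Op → ℕ → Cmd
  opC add = addC
  opC mul = mulC
  opC sub = subC
  opC pow = powC

  -- A variable out of scope is sent to register 0, which holds N, in accordance with `look`.
  source : ℕ → ℕ → ℕ
  source zero    x = 0
  source (suc n) x = if x ≡ᵇ suc n then suc n else source n x

  -- n variables are in scope and the first free register is suc d.
  compile : ℕ → ℕ → Exp → Cmd
  compile n d (var x)    = push d (source n x)
  compile n d (lit c)    = literal d c
  compile n d (op o a b) = compile n d a ⨾ compile n (suc d) b ⨾ opC o d

  module Triples (N : ℕ) (w : List Unit) (L : ℕ) where

    open Executions w L public

    Agree : Tapes → List ℕ → Set
    Agree τs []      = Counter N (lookup τs (register 0))
    Agree τs (v ∷ s) = Counter v (lookup τs (register (suc (length s)))) × Agree τs s

    -- Registers above the stack also hold counters, of unknown value; this is what allows `new` to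
    -- reset them.
    Holds : Tapes → List ℕ → Set
    Holds τs s = (∀ z → ∃[ n ] Counter n (lookup τs z)) × Agree τs s

    -- A Hoare triple over stacks, with the output in addition. The position of the input head is
    -- arbitrary and kept, as the input is no longer read once N is known.
    record Triple (s : List ℕ) (c : Cmd) (o : List Symbol) (s′ : List ℕ) : Set where
      constructor triple
      field
        run : ∀ τs p → Holds τs s → ∃[ τs′ ] (Exec c p τs o p τs′ × Holds τs′ s′)

    open Triple public

    fits-counters : ∀ τs → (∀ z → ∃[ n ] Counter n (lookup τs z)) → Fits τs
    fits-counters _ valid z = counter-visited (proj₂ (valid z))

    private variable
      s s′ s″ : List ℕ
      c c′ : Cmd
      o o′ : List Symbol
      n v Y : ℕ

    output : ∀ {p τs τs′} → o ≡ o′ → Exec c p τs o p τs′ → Exec c p τs o′ p τs′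
    output refl e = e

    infixr 4 _▸_
    _▸_ : Triple s c o s′ → Triple s′ c′ o′ s″ → Triple s (c ⨾ c′) (o ++ o′) s″
    run (t ▸ t′) τs p h with run t τs p h
    ... | τs′ , e , h′ with run t′ τs′ p h′
    ... | τs″ , e′ , h″ = τs″ , seq e e′ , h″

    -- Popping takes no command: the register remains a counter and is merely forgotten.
    drop : Triple s c o (v ∷ s′) → Triple s c o s′
    run (drop t) τs p h with run t τs p h
    ... | τs′ , e , valid , _ , a = τs′ , e , valid , a

    cast : o ≡ o′ → s′ ≡ s″ → Triple s c o s′ → Triple s c o′ s″
    cast refl refl t = t

    valid-update : ∀ {τs : Tapes} {τ x} → (∀ z → ∃[ n ] Counter n (lookup τs z)) → Counter n τ →
                   ∀ z → ∃[ n ] Counter n (lookup (τs [ x ]≔ τ) z)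
    valid-update {n} {τs} {τ} {x} valid C z with x Fin.≟ z
    ... | yes refl = n , subst (Counter n) (sym (lookup∘updateAt x τs)) C
    ... | no x≢z   = proj₁ (valid z) ,
      subst (Counter _) (sym (lookup∘updateAt′ z x (x≢z ∘ sym) τs)) (proj₂ (valid z))

    counter-other : ∀ {τs τ x y} → x ≤ R → y < x →
      Counter n (lookup τs (register y)) → Counter n (lookup (τs [ register x ]≔ τ) (register y))
    counter-other {τs = τs} {x = x} {y} h lt C = subst (Counter _)
      (sym (lookup∘updateAt′ (register y) (register x)
        (λ eq → <⇒≢ lt (register-injective (≤-trans (<⇒≤ lt) h) h eq)) τs)) C

    agree-other : ∀ {τs τ x} s → x ≤ R → length s < x → Agree τs s → Agree (τs [ register x ]≔ τ) s
    agree-other {τs} {x = x} []      h lt C       = counter-other {τs = τs} {x = x} h lt C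
    agree-other {τs} {x = x} (v ∷ s) h lt (C , a) = counter-other {τs = τs} {x = x} h lt C , agree-other {τs} s h (<-trans ≤-refl lt) a

    agree-update : ∀ {τs τ} ts v′ s → length (ts ++ v ∷ s) ≤ R → Counter v′ τ →
      Agree τs (ts ++ v ∷ s) → Agree (τs [ register (suc (length s)) ]≔ τ) (ts ++ v′ ∷ s)
    agree-update {τs = τs} [] v′ s h C (_ , a) =
      subst (Counter v′) (sym (lookup∘updateAt (register (suc (length s))) τs)) C , agree-other {τs} s h ≤-refl a
    agree-update {v} {τs = τs} {τ} (t ∷ ts) v′ s h C (C′ , a) =
      subst (λ l → Counter t (lookup (τs [ register (suc (length s)) ]≔ τ) (register (suc l)))) (same-length ts)
        (subst (Counter t) (sym (lookup∘updateAt′ (register (suc (length (ts ++ v ∷ s)))) (register (suc (length s)))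
          (λ eq → <⇒≢ (s≤s (longer ts)) (sym (register-injective h (≤-trans (longer ts) (<⇒≤ h)) eq))) τs)) C′) ,
      agree-update {τs = τs} ts v′ s (<⇒≤ h) C a
      where
      same-length : ∀ ts → length (ts ++ v ∷ s) ≡ length (ts ++ v′ ∷ s)
      same-length []       = refl
      same-length (_ ∷ ts) = cong suc (same-length ts)
      longer : ∀ ts → suc (length s) ≤ length (ts ++ v ∷ s)
      longer []       = ≤-refl
      longer (_ ∷ ts) = m≤n⇒m≤1+n (longer ts)

    counter-at : ∀ {τs} ts {s} → Agree τs (ts ++ v ∷ s) → Counter v (lookup τs (register (suc (length s))))
    counter-at []       (C , _) = C
    counter-at (_ ∷ ts) (_ , a) = counter-at ts a

    run-step : ∀ {x τ τs p} → Fits τs → Step x c (lookup τs x) τ → Exec c p τs [] p (τs [ x ]≔ τ)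
    run-step {c} {x} {τ} {τs} {p} fits st =
      subst (λ σs → Exec c p σs [] p (τs [ x ]≔ τ)) ([]≔-lookup τs x) (st τs p fits)

    inc-triple : ∀ ts → length (ts ++ v ∷ s) ≤ R → suc v < 2 ^ L →
                 Triple (ts ++ v ∷ s) (incr (suc (length s))) [] (ts ++ suc v ∷ s)
    run (inc-triple {s = s} ts h b) τs p (valid , a) with inc-step b (counter-at ts a)
    ... | τ , st , C = _ , run-step (fits-counters τs valid) st ,
      valid-update {τs = τs} {x = register (suc (length s))} valid C , agree-update {τs = τs} ts _ s h C a

    reset-triple : ∀ ts → length (ts ++ v ∷ s) ≤ R →
                   Triple (ts ++ v ∷ s) (reset (register (suc (length s)))) [] (ts ++ 0 ∷ s)
    run (reset-triple {s = s} ts h) τs p (valid , a) with reset-step (counter-at ts a)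
    ... | τ , st , C = _ , run-step (fits-counters τs valid) st ,
      valid-update {τs = τs} {x = register (suc (length s))} valid C , agree-update {τs = τs} ts _ s h C a

    new-triple : suc (length s) ≤ R → Triple s (new (length s)) [] (0 ∷ s)
    run (new-triple {s = s} h) τs p (valid , a) =
      run (reset-triple {s = s} [] h) τs p (valid , proj₂ (valid (register (suc (length s)))) , a)

    data At : ℕ → ℕ → List ℕ → Set where
      base  : At 0 N []
      here  : ∀ {v s} → At (suc (length s)) v (v ∷ s)
      there : ∀ {x n v s} → At x n s → At x n (v ∷ s)

    at-counter : ∀ {τs x} → At x n s → Agree τs s → Counter n (lookup τs (register x))
    at-counter base        C       = C
    at-counter here        (C , _) = C
    at-counter (there q)   (_ , a) = at-counter q a

    at-≤ : ∀ {x} → At x n s → x ≤ length s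
    at-≤ base      = z≤n
    at-≤ here      = ≤-refl
    at-≤ (there q) = m≤n⇒m≤1+n (at-≤ q)

    at-++ : ∀ {x} ts → At x n s → At x n (ts ++ s)
    at-++ []       q = q
    at-++ (_ ∷ ts) q = there (at-++ ts q)

    module _ (s : ℕ → List ℕ) (o : ℕ → List Symbol) (ℓ : ℕ) (len : ∀ i → length (s i) ≡ ℓ) (h : suc ℓ ≤ R)
             {n Y : ℕ} {c : Cmd} (at : ∀ i → At Y n (s i))
             (body : ∀ i → i < n → n < 2 ^ L → Triple (i ∷ s i) c (o i) (i ∷ s (suc i))) where

      private
        x y : Fin (suc R)
        x = register (suc ℓ)
        y = register Y

        x≢y : x ≢ y
        x≢y eq = <⇒≢ Y<x (sym (register-injective h (≤-trans (<⇒≤ Y<x) h) eq))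
          where
          Y<x : Y < suc ℓ
          Y<x = s≤s (subst (Y ≤_) (len 0) (at-≤ (at 0)))

        ComparedOn : ℕ → Tapes → Set
        ComparedOn i τs =
          Compared (distinct (bits i) (bits n)) x y (compare x y) (lookup τs x) (lookup τs y) (lookup τs x) (lookup τs y)

        limit : ∀ {i τs} → Holds τs (i ∷ s i) → n < 2 ^ L
        limit {i} (_ , _ , a) = proj₁ (at-counter (at i) a)

        compared : ∀ i {τs} → Holds τs (i ∷ s i) → ComparedOn i τs
        compared i {τs} (_ , C , a) = compare-step x≢y
          (subst (λ l → Counter i (lookup τs (register (suc l)))) (len i) C) (at-counter (at i) a)

        -- The registers at the moment of the loop test, with the heads on `x` and `y` displaced by
        -- the comparison.
        virtual : Tapes → Tape Cell → Tape Cell → Tapes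
        virtual τs τ σ = (τs [ x ]≔ τ) [ y ]≔ σ

        original : ∀ τs → virtual τs (lookup τs x) (lookup τs y) ≡ τs
        original τs = trans (cong (_[ y ]≔ lookup τs y) ([]≔-lookup τs x)) ([]≔-lookup τs y)

        comparing : ∀ {i τs} p → Holds τs (i ∷ s i) → (cmp : ComparedOn i τs) →
                    Exec (compare x y) p τs [] p (virtual τs (proj₁ cmp) (proj₁ (proj₂ cmp)))
        comparing {τs = τs} p (valid , _) (τ , σ , st , _) =
          subst (λ σs → Exec (compare x y) p σs [] p (virtual τs τ σ)) (original τs) (st τs p (fits-counters τs valid))

        homing : ∀ {i τs} p → Holds τs (i ∷ s i) → (cmp : ComparedOn i τs) →
                 Exec (goHome x ⨾ goHome y) p (virtual τs (proj₁ cmp) (proj₁ (proj₂ cmp))) [] p τs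
        homing {i} {τs} p (valid , _) (τ , σ , _ , _ , vτ , vσ , hx , hy) =
          subst (λ σs → Exec (goHome x ⨾ goHome y) p (virtual τs τ σ) [] p σs) (original τs)
            (seq-step₂ (onˡ x≢y vσ hx) (onʳ (counter-visited (proj₂ (valid x))) hy) τs p (fits-counters τs valid))

        homing-and : ∀ {i τs p d o τs′} → Holds τs (i ∷ s i) → (cmp : ComparedOn i τs) → Exec d p τs o p τs′ →
                 Exec (goHome x ⨾ goHome y ⨾ d) p (virtual τs (proj₁ cmp) (proj₁ (proj₂ cmp))) o p τs′
        homing-and {i} {τs} {p} (valid , _) (_ , _ , _ , _ , vτ , vσ , hx , hy) e =
          seq (onˡ x≢y vσ hx τs p (fits-counters τs valid))
            (seq (subst (λ σs → Exec (goHome y) p (virtual τs (lookup τs x) _) [] p σs) (original τs)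
                   (onʳ {y = y} (counter-visited (proj₂ (valid x))) hy τs p (fits-counters τs valid))) e)

        iterate : ∀ k i → i + k ≡ n → ∀ τs p → Holds τs (i ∷ s i) → (cmp : ComparedOn i τs) →
          ∃[ σs ] ∃[ τs′ ]
            (Exec (while (λ _ v → differ (lookup v x) (lookup v y)) (goHome x ⨾ goHome y ⨾ c ⨾ incr (suc ℓ) ⨾ compare x y))
               p (virtual τs (proj₁ cmp) (proj₁ (proj₂ cmp))) (appendFrom o i k) p σs
             × Exec (goHome x ⨾ goHome y) p σs [] p τs′
             × Holds τs′ (s n))
        iterate zero i eq τs p holds@(valid , C , a) cmp@(_ , _ , _ , df , vτ , vσ , _) =
          _ , τs , stop (fits₂ {τs = τs} (fits-counters τs valid) vτ vσ) (trans (cond₂ differ x≢y τs)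
                     (trans df (trans (cong (λ m → distinct (bits m) (bits n)) i≡n) (distinct-refl (bits n))))) ,
          homing p holds cmp , subst (λ m → Holds τs (s m)) i≡n (valid , a)
          where
          i≡n : i ≡ n
          i≡n = trans (sym (+-identityʳ i)) eq
        iterate (suc k) i eq τs p holds@(valid , _) cmp@(_ , _ , _ , df , vτ , vσ , _) =
          let i<n = subst (suc i ≤_) eq (subst (_≤ i + suc k) (+-comm i 1) (+-monoʳ-≤ i (s≤s z≤n)))
              b = limit {i} {τs} holds
              τs₁ , e₁ , holds₁ = run (body i i<n b) τs p holds
              τs₂ , e₂ , holds₂ = run (subst (λ l → Triple (i ∷ s (suc i)) (incr (suc l)) [] (suc i ∷ s (suc i))) (len (suc i))
                (inc-triple {s = s (suc i)} [] (subst (λ l → suc l ≤ R) (sym (len (suc i))) h)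
                  (<-≤-trans (s≤s i<n) b))) τs₁ p holds₁
              cmp₂ = compared (suc i) holds₂
              σs , τs′ , e₃ , e₄ , holds₃ = iterate k (suc i) (trans (sym (+-suc i k)) eq) τs₂ p holds₂ cmp₂
          in σs , τs′ ,
             go (fits₂ {τs = τs} (fits-counters τs valid) vτ vσ)
                (trans (cond₂ differ x≢y τs) (trans df (distinct-≢ (bits i) (bits n) (λ q → <⇒≢ i<n (bits-injective q)))))
                (output (++-identityʳ (o i))
                  (homing-and holds cmp (seq e₁ (seq e₂ (comparing p holds₂ cmp₂)))))
                e₃ ,
             e₄ , holds₃

      -- `s i` is the invariant after i rounds, and the body sees the loop counter on top of it. The
      -- limit is itself in a register, which gives n < 2 ^ L, so the loop counter cannot overflow.
      loop-triple : Triple (s 0) (loop ℓ Y c) (appendUpTo o n) (s n)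
      run loop-triple τs p holds =
        let τs₁ , e₁ , holds₁ = run (subst (λ l → Triple (s 0) (new l) [] (0 ∷ s 0)) (len 0)
              (new-triple {s = s 0} (subst (λ l → suc l ≤ R) (sym (len 0)) h))) τs p holds
            cmp = compared 0 holds₁
            σs , τs′ , e₂ , e₃ , holds₂ = iterate n 0 refl τs₁ p holds₁ cmp
        in τs′ ,
           seq e₁ (seq (comparing p holds₁ cmp)
             (output (trans (++-identityʳ _) (appendFrom-upTo o n)) (seq e₂ e₃))) ,
           holds₂

    silent : Triple s c (appendUpTo (λ _ → []) n) s′ → Triple s c [] s′
    silent {n = n} = cast (appendUpTo-[] n) refl

    free : ∀ c {k ℓ} → k + ℓ ≤ R → {T (c ≤ᵇ k)} → c + ℓ ≤ R
    free c {ℓ = ℓ} h {q} = ≤-trans (+-monoˡ-≤ ℓ (≤ᵇ⇒≤ c _ q)) h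

    store-triple : ∀ ts → (∀ i → At Y n (ts ++ i ∷ s)) → ∀ {ℓ} → (∀ v → length (ts ++ v ∷ s) ≡ ℓ) → suc ℓ ≤ R →
      Triple (ts ++ v ∷ s) (store ℓ (suc (length s)) Y) [] (ts ++ n ∷ s)
    store-triple {n = n} {s} {v} ts at {ℓ} len h =
      reset-triple ts (≤-trans (≤-reflexive (len v)) (<⇒≤ h)) ▸
      silent {n = n} (loop-triple (λ i → ts ++ i ∷ s) (λ _ → []) ℓ len h at
        λ i i<n b → inc-triple (i ∷ ts) (≤-trans (≤-reflexive (cong suc (len i))) h) (≤-<-trans i<n b))

    push-triple : 2 + length s ≤ R → At Y n s → Triple s (push (length s) Y) [] (n ∷ s)
    push-triple {s} {n = n} h at =
      new-triple (<⇒≤ h) ▸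
      silent {n = n} (loop-triple (_∷ s) (λ _ → []) (suc (length s)) (λ _ → refl) h (λ _ → there at)
        λ i i<n b → inc-triple (i ∷ []) h (≤-<-trans i<n b))

    literal-triple : ∀ c → suc (length s) ≤ R → c < 2 ^ L → Triple s (literal (length s) c) [] (c ∷ s)
    literal-triple zero    h b = new-triple h
    literal-triple (suc c) h b = literal-triple c h (<-trans (n<1+n c) b) ▸ inc-triple [] h b

    add-triple : ∀ {a b} → 16 + length s ≤ R → a + b < 2 ^ L →
                 Triple (b ∷ a ∷ s) (addC (length s)) [] (a + b ∷ s)
    add-triple {s} {a} {b} h lt = drop (cast refl (cong (λ v → b ∷ v ∷ s) (+-comm b a))
      (silent {n = b} (loop-triple (λ i → b ∷ i + a ∷ s) (λ _ → []) (2 + length s) (λ _ → refl) (free 3 h) (λ _ → here)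
        λ i i<b _ → inc-triple (i ∷ b ∷ []) (free 3 h) (≤-<-trans (+-monoˡ-≤ a i<b) (subst (_< 2 ^ L) (+-comm a b) lt)))))

    mul-triple : ∀ {a b} → 16 + length s ≤ R → a * b < 2 ^ L →
                 Triple (b ∷ a ∷ s) (mulC (length s)) [] (a * b ∷ s)
    mul-triple {s} {a} {b} h lt = drop (drop (
      new-triple (free 3 h) ▸
      silent {n = a} (loop-triple (λ i → i * b ∷ b ∷ a ∷ s) (λ _ → []) (3 + length s) (λ _ → refl) (free 4 h)
        (λ _ → there (there here))
        λ i i<a _ → silent {n = b} (loop-triple (λ j → i ∷ j + i * b ∷ b ∷ a ∷ s) (λ _ → []) (4 + length s) (λ _ → refl)
          (free 5 h) (λ _ → there (there here))
          λ j j<b _ → inc-triple (j ∷ i ∷ []) (free 5 h)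
            (≤-<-trans (≤-trans (+-monoˡ-≤ (i * b) j<b) (*-monoˡ-≤ b i<a)) lt))) ▸
      store-triple (a * b ∷ b ∷ []) (λ _ → here) (λ _ → refl) (free 4 h)))

    -- Counters only count upwards, so one register is counted up to a and another one lags a step
    -- behind it.
    pred-triple : ∀ {a b i} → 16 + length s ≤ R →
                  Triple (i ∷ b ∷ a ∷ s) (predC (length s)) [] (i ∷ b ∷ pred a ∷ s)
    pred-triple {s} {a} {b} {i} h = drop (drop (
      new-triple (free 4 h) ▸ new-triple (free 5 h) ▸
      silent {n = a} (loop-triple (λ t → t ∷ pred t ∷ i ∷ b ∷ a ∷ s) (λ _ → []) (5 + length s) (λ _ → refl) (free 6 h)
        (λ _ → there (there (there (there here))))
        λ t t<a lt → store-triple (t ∷ t ∷ []) (λ _ → there here) (λ _ → refl) (free 7 h) ▸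
                     inc-triple (t ∷ []) (free 6 h) (≤-<-trans t<a lt)) ▸
      store-triple (a ∷ pred a ∷ i ∷ b ∷ []) (λ _ → there here) (λ _ → refl) (free 6 h)))

    sub-triple : ∀ {a b} → 16 + length s ≤ R → Triple (b ∷ a ∷ s) (subC (length s)) [] (a ∸ b ∷ s)
    sub-triple {s} {a} {b} h = drop
      (silent {n = b} (loop-triple (λ i → b ∷ a ∸ i ∷ s) (λ _ → []) (2 + length s) (λ _ → refl) (free 3 h) (λ _ → here)
        λ i i<b _ → cast refl (cong (λ v → i ∷ b ∷ v ∷ s) (pred[m∸n]≡m∸[1+n] a i)) (pred-triple h)))

    double-triple : ∀ {i x m e} → 24 + length s ≤ R → x ≤ suc m → suc m + suc m < 2 ^ L →
      Triple (i ∷ x ∷ m ∷ e ∷ s) (doubleC (length s)) [] (i ∷ double m x ∷ m ∷ e ∷ s)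
    double-triple {s} {i} {x} {m} {e} h x≤ lt = drop (
      push-triple (free 6 h) (there here) ▸ push-triple (free 7 h) (there (there here)) ▸
      add-triple (free 20 h) (≤-<-trans (+-mono-≤ x≤ x≤) lt) ▸
      push-triple (free 7 h) (there (there (there here))) ▸ inc-triple [] (free 6 h) sm< ▸
      literal-triple 1 (free 7 h) (≤-<-trans (s≤s z≤n) sm<) ▸
      push-triple (free 9 h) (there (there (there (there (there here))))) ▸ inc-triple [] (free 8 h) sm< ▸
      push-triple (free 10 h) (there (there (there here))) ▸
      sub-triple h′ ▸ sub-triple (≤-trans (n≤1+n _) h′) ▸
      mul-triple (≤-trans (m≤n+m _ 2) h′) (≤-<-trans product sm<) ▸
      sub-triple (≤-trans (m≤n+m _ 3) h′) ▸
      store-triple (double m x ∷ i ∷ []) (λ _ → here) (λ _ → refl) (free 6 h))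
      where
      sm< : suc m < 2 ^ L
      sm< = ≤-<-trans (m≤m+n (suc m) (suc m)) lt
      h′ : 23 + length s ≤ R
      h′ = free 23 h
      product : suc m * (1 ∸ (suc m ∸ (x + x))) ≤ suc m
      product = ≤-trans (*-monoʳ-≤ (suc m) (m∸n≤m 1 (suc m ∸ (x + x)))) (≤-reflexive (*-identityʳ (suc m)))

    pow-triple : ∀ {m e} → 24 + length s ≤ R → suc m + suc m < 2 ^ L →
                 Triple (m ∷ e ∷ s) (powC (length s)) [] (power e m ∷ s)
    pow-triple {s} {m} {e} h lt = drop (drop (
      literal-triple 1 (free 3 h) (≤-<-trans (s≤s z≤n) (≤-<-trans (m≤m+n (suc m) (suc m)) lt)) ▸
      silent {n = e} (loop-triple (λ i → power i m ∷ m ∷ e ∷ s) (λ _ → []) (3 + length s) (λ _ → refl) (free 4 h)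
        (λ _ → there (there here))
        λ i _ _ → double-triple h (power≤ i m) lt) ▸
      store-triple (power e m ∷ m ∷ []) (λ _ → here) (λ _ → refl) (free 4 h)))

    OpFits : Op → ℕ → ℕ → Set
    OpFits add a b = a + b < 2 ^ L
    OpFits mul a b = a * b < 2 ^ L
    OpFits sub a b = Unit
    OpFits pow a b = suc b + suc b < 2 ^ L

    op-triple : ∀ o {a b} → 24 + length s ≤ R → OpFits o a b → Triple (b ∷ a ∷ s) (opC o (length s)) [] (apply o a b ∷ s)
    op-triple add h f = add-triple (free 16 h) f
    op-triple mul h f = mul-triple (free 16 h) f
    op-triple sub h f = sub-triple (free 16 h)
    op-triple pow h f = pow-triple h f

    ExpFits : List ℕ → Exp → Set
    ExpFits s (var x)    = Unit
    ExpFits s (lit c)    = c < 2 ^ L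
    ExpFits s (op o a b) = ExpFits s a × ExpFits s b × OpFits o (eval N s a) (eval N s b)

    at-source : ∀ s x → At (source (length s) x) (look N s x) s
    at-source []      x = base
    at-source (v ∷ s) x with x ≡ᵇ suc (length s)
    ... | true  = here
    ... | false = there (at-source s x)

    -- `ts` are intermediate results above the variables `s`. Variables are numbered from the bottom
    -- of the stack, so intermediate results do not displace them.
    compile-triple : ∀ e ts s → ExpFits s e → expWidth e + length (ts ++ s) ≤ R →
      Triple (ts ++ s) (compile (length s) (length (ts ++ s)) e) [] (eval N s e ∷ ts ++ s)
    compile-triple (var x)    ts s f h = push-triple h (at-++ ts (at-source s x))
    compile-triple (lit c)    ts s f h = literal-triple c (<⇒≤ h) f
    compile-triple (op o a b) ts s (fa , fb , f) h =
      compile-triple a ts s fa (≤-trans (+-monoˡ-≤ d (≤-trans (m≤m+n (expWidth a) (expWidth b)) (m≤n+m _ 24))) h) ▸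
      compile-triple b (eval N s a ∷ ts) s fb (≤-trans (≤-reflexive (+-suc (expWidth b) d))
        (≤-trans (+-monoˡ-≤ d (s≤s (≤-trans (m≤n+m (expWidth b) (expWidth a)) (m≤n+m _ 23)))) h)) ▸
      op-triple o (≤-trans (+-monoˡ-≤ d (m≤m+n 24 (expWidth a + expWidth b))) h) f
      where d = length (ts ++ s)

-- Raw circuits

nth : A → List A → ℕ → A
nth z []       _       = z
nth z (a ∷ as) zero    = a
nth z (a ∷ as) (suc i) = nth z as i

nth-++ˡ : ∀ {z : A} as {bs i} → i < length as → nth z (as ++ bs) i ≡ nth z as i
nth-++ˡ (a ∷ as) {i = zero}  h       = refl
nth-++ˡ (a ∷ as) {i = suc i} (s≤s h) = nth-++ˡ as h

nth-++ʳ : ∀ {z : A} as {bs} i → nth z (as ++ bs) (length as + i) ≡ nth z bs i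
nth-++ʳ []       i = refl
nth-++ʳ (a ∷ as) i = nth-++ʳ as i

nth-toList : ∀ {z : A} {n} (v : Vec A n) i → nth z (toList v) (toℕ i) ≡ lookup v i
nth-toList (a ∷ v) zero    = refl
nth-toList (a ∷ v) (suc i) = nth-toList v i

-- Addresses without a range let circuits be assembled by plain concatenation with relative offsets;
-- the ranges are established afterwards by `WF`.
data RawWire : Set where
  input gate : ℕ → RawWire

data RawGate : Set where
  NOT      : RawWire → RawGate
  MAJORITY : List RawWire → RawGate

rawWires : RawGate → List RawWire
rawWires (NOT w)       = [ w ]
rawWires (MAJORITY ws) = ws

-- A circuit is listed last gate first, so that `gate 0` is the head of what follows.
module Fold {A : Set} (inputs : ℕ → A) (default : A) (notᴬ : A → A) (majorityᴬ : List A → A) where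

  wireFold : List A → RawWire → A
  wireFold vs (input i) = inputs i
  wireFold vs (gate j)  = nth default vs j

  gateFold : List A → RawGate → A
  gateFold vs (NOT w)       = notᴬ (wireFold vs w)
  gateFold vs (MAJORITY ws) = majorityᴬ (map (wireFold vs) ws)

  fold : List RawGate → List A
  fold []      = []
  fold (γ ∷ G) = gateFold (fold G) γ ∷ fold G

  length-fold : ∀ G → length (fold G) ≡ length G
  length-fold []      = refl
  length-fold (γ ∷ G) = cong suc (length-fold G)

module WellFormed (N : ℕ) where

  InRange : ℕ → RawWire → Set
  InRange g (input i) = i < N
  InRange g (gate j)  = j < g

  WF : List RawGate → Set
  WF []      = Unit
  WF (γ ∷ G) = All (InRange (length G)) (rawWires γ) × WF G

  in-range-mono : ∀ {g h w} → g ≤ h → InRange g w → InRange h w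
  in-range-mono {w = input _} _ q = q
  in-range-mono {w = gate _}  l q = <-≤-trans q l

  wf-++ : ∀ G {H} → WF G → WF H → WF (G ++ H)
  wf-++ []      _       h = h
  wf-++ (γ ∷ G) {H} (a , g) h =
    All.map (λ {w} → in-range-mono {w = w} (≤-trans (m≤m+n _ _) (≤-reflexive (sym (length-++ G {H}))))) a , wf-++ G g h

  module _ {A : Set} (inputs : ℕ → A) (default : A) (notᴬ : A → A) (majorityᴬ : List A → A) where
    open Fold inputs default notᴬ majorityᴬ

    wireFold-++ : ∀ vs us w → InRange (length vs) w → wireFold (vs ++ us) w ≡ wireFold vs w
    wireFold-++ vs us (input i) _ = refl
    wireFold-++ vs us (gate j)  q = nth-++ˡ vs q

    wiresFold-++ : ∀ vs us ws → All (InRange (length vs)) ws → map (wireFold (vs ++ us)) ws ≡ map (wireFold vs) ws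
    wiresFold-++ vs us []       []       = refl
    wiresFold-++ vs us (w ∷ ws) (q ∷ qs) = cong₂ _∷_ (wireFold-++ vs us w q) (wiresFold-++ vs us ws qs)

    gateFold-++ : ∀ vs us γ → All (InRange (length vs)) (rawWires γ) → gateFold (vs ++ us) γ ≡ gateFold vs γ
    gateFold-++ vs us (NOT w)       (q ∷ []) = cong notᴬ (wireFold-++ vs us w q)
    gateFold-++ vs us (MAJORITY ws) qs       = cong majorityᴬ (wiresFold-++ vs us ws qs)

    -- A well-formed block reads inputs and its own gates only, so what it computes does not depend
    -- on the gates beneath it.
    fold-++ : ∀ G H → WF G → fold (G ++ H) ≡ fold G ++ fold H
    fold-++ []      H _       = refl
    fold-++ (γ ∷ G) H (a , g) rewrite fold-++ G H g =
      cong (_∷ fold G ++ fold H) (gateFold-++ (fold G) (fold H) γ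
        (subst (λ l → All (InRange l) (rawWires γ)) (sym (length-fold G)) a))

  wire : ∀ {g} w → InRange g w → Wire N g
  wire (input i) q = input (fromℕ< q)
  wire (gate j)  q = gate (fromℕ< q)

  wires : ∀ {g} ws → All (InRange g) ws → List (Wire N g)
  wires []       []       = []
  wires (w ∷ ws) (q ∷ qs) = wire w q ∷ wires ws qs

  typed : ∀ {g} γ → All (InRange g) (rawWires γ) → Gate N g
  typed (NOT w)       (q ∷ []) = NOT (wire w q)
  typed (MAJORITY ws) qs       = MAJORITY (wires ws qs)

  build : ∀ G → WF G → Gates N (length G)
  build []      _       = []
  build (γ ∷ G) (a , g) = build G g ▷ typed γ a

  describeRawWire : RawWire → List Symbol
  describeRawWire (input i) = input-wire ∷ replicate i tick
  describeRawWire (gate j)  = gate-wire ∷ replicate j tick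

  describeRawGate : RawGate → List Symbol
  describeRawGate (NOT w)       = not-gate ∷ describeRawWire w
  describeRawGate (MAJORITY ws) = majority-gate ∷ concatMap describeRawWire ws

  describeRaw : List RawGate → List Symbol
  describeRaw []      = []
  describeRaw (γ ∷ G) = describeRaw G ++ describeRawGate γ

  describe-build : ∀ G wf → describeGates (build G wf) ≡ describeRaw G
  describe-build []      _       = refl
  describe-build (γ ∷ G) (a , g) = cong₂ _++_ (describe-build G g) (of-gate γ a)
    where
    of-wire : ∀ {g} w (q : InRange g w) → describeWire (wire w q) ≡ describeRawWire w
    of-wire (input i) q = cong (λ n → input-wire ∷ replicate n tick) (toℕ-fromℕ< q)
    of-wire (gate j)  q = cong (λ n → gate-wire ∷ replicate n tick) (toℕ-fromℕ< q)
    of-wires : ∀ {g} ws (qs : All (InRange g) ws) → concatMap describeWire (wires ws qs) ≡ concatMap describeRawWire ws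
    of-wires []       []       = refl
    of-wires (w ∷ ws) (q ∷ qs) = cong₂ _++_ (of-wire w q) (of-wires ws qs)
    of-gate : ∀ {g} γ (a : All (InRange g) (rawWires γ)) → describeGate (typed γ a) ≡ describeRawGate γ
    of-gate (NOT w)       (q ∷ []) = cong (not-gate ∷_) (of-wire w q)
    of-gate (MAJORITY ws) qs       = cong (majority-gate ∷_) (of-wires ws qs)

  rawSize : List RawGate → ℕ
  rawSize []      = 0
  rawSize (γ ∷ G) = rawSize G + suc (length (rawWires γ))

  size-build : ∀ G wf → gatesSize (build G wf) ≡ rawSize G
  size-build []      _       = refl
  size-build (γ ∷ G) (a , g) = cong₂ (λ m n → m + suc n) (size-build G g) (of-gate γ a)
    where
    of-wires : ∀ {g} ws (qs : All (InRange g) ws) → length (wires ws qs) ≡ length ws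
    of-wires []       []       = refl
    of-wires (w ∷ ws) (q ∷ qs) = cong suc (of-wires ws qs)
    of-gate : ∀ {g} γ (a : All (InRange g) (rawWires γ)) → length (gateWires (typed γ a)) ≡ length (rawWires γ)
    of-gate (NOT w)       (q ∷ []) = refl
    of-gate (MAJORITY ws) qs       = of-wires ws qs

  -- The maximum with 0 is what `foldr max 0` yields on the single wire of a NOT gate.
  open Fold {ℕ} (λ _ → 0) 0 (λ d → suc (max d 0)) (λ ds → suc (foldr max 0 ds)) public using ()
    renaming (fold to depths; wireFold to wireDepthRaw; gateFold to gateDepthRaw)

  depths-build : ∀ G wf → toList (gateDepths (build G wf)) ≡ depths G
  depths-build []      _       = refl
  depths-build (γ ∷ G) (a , g) = cong₂ _∷_ (of-gate γ a) (depths-build G g)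
    where
    ds = gateDepths (build G g)
    of-wire : ∀ w (q : InRange (length G) w) → wireDepth ds (wire w q) ≡ wireDepthRaw (depths G) w
    of-wire (input i) q = refl
    of-wire (gate j)  q = trans (sym (nth-toList ds (fromℕ< q))) (cong₂ (nth 0) (depths-build G g) (toℕ-fromℕ< q))
    of-wires : ∀ ws (qs : All (InRange (length G)) ws) →
      map (wireDepth ds) (wires ws qs) ≡ map (wireDepthRaw (depths G)) ws
    of-wires []       []       = refl
    of-wires (w ∷ ws) (q ∷ qs) = cong₂ _∷_ (of-wire w q) (of-wires ws qs)
    of-gate : ∀ γ (a : All (InRange (length G)) (rawWires γ)) →
      suc (foldr max 0 (map (wireDepth ds) (gateWires (typed γ a)))) ≡ gateDepthRaw (depths G) γ
    of-gate (NOT w)       (q ∷ []) = cong (λ n → suc (max n 0)) (of-wire w q)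
    of-gate (MAJORITY ws) qs       = cong (suc ∘ foldr max 0) (of-wires ws qs)

  depth-build : ∀ G wf {b} → All (_≤ b) (depths G) → Vec.foldr′ max 0 (gateDepths (build G wf)) ≤ b
  depth-build G wf h = bound (gateDepths (build G wf)) (subst (All _) (sym (depths-build G wf)) h)
    where
    bound : ∀ {n b} (ds : Vec ℕ n) → All (_≤ b) (toList ds) → Vec.foldr′ max 0 ds ≤ b
    bound []       []      = z≤n
    bound (d ∷ ds) (h ∷ hs) = ⊔-lub h (bound ds hs)

  count : List Bool → ℕ
  count []           = 0
  count (true ∷ bs)  = suc (count bs)
  count (false ∷ bs) = count bs

  majority : List Bool → Bool
  majority bs = length bs <ᵇ 2 * count bs

  module Values (x : List Bool) where

    open Fold {Bool} (nth false x) false not majority public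
      renaming (fold to values; wireFold to wireValueRaw; gateFold to gateValueRaw; length-fold to length-values)

    values-build : (v : Vec Bool N) → toList v ≡ x → ∀ G wf → toList (gateValues v (build G wf)) ≡ values G
    values-build v v≡x []      _       = refl
    values-build v v≡x (γ ∷ G) (a , g) = cong₂ _∷_ (of-gate γ a) (values-build v v≡x G g)
      where
      vs = gateValues v (build G g)
      of-wire : ∀ w (q : InRange (length G) w) → wireValue v vs (wire w q) ≡ wireValueRaw (values G) w
      of-wire (input i) q = trans (sym (nth-toList v (fromℕ< q))) (cong₂ (nth false) v≡x (toℕ-fromℕ< q))
      of-wire (gate j)  q = trans (sym (nth-toList vs (fromℕ< q))) (cong₂ (nth false) (values-build v v≡x G g) (toℕ-fromℕ< q))
      of-length : ∀ ws (qs : All (InRange (length G)) ws) → length (wires ws qs) ≡ length (map (wireValueRaw (values G)) ws)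
      of-length []       []       = refl
      of-length (w ∷ ws) (q ∷ qs) = cong suc (of-length ws qs)
      of-count : ∀ ws (qs : All (InRange (length G)) ws) →
        length (filter (λ w → wireValue v vs w ≟ᵇ true) (wires ws qs)) ≡ count (map (wireValueRaw (values G)) ws)
      of-count []       []       = refl
      of-count (w ∷ ws) (q ∷ qs) rewrite sym (of-wire w q) with wireValue v vs (wire w q)
      ... | true  = cong suc (of-count ws qs)
      ... | false = of-count ws qs
      of-gate : ∀ γ (a : All (InRange (length G)) (rawWires γ)) → gateValue v vs (typed γ a) ≡ gateValueRaw (values G) γ
      of-gate (NOT w)       (q ∷ []) = cong not (of-wire w q)
      of-gate (MAJORITY ws) qs       = cong₂ (λ m n → m <ᵇ 2 * n) (of-length ws qs) (of-count ws qs)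

-- Formulas and their circuits

-- `most w t φ` says that the sum, over all values below N of a new
-- variable i satisfying φ, of the weights w exceeds t.
data Form : Set where
  bitAt : Exp → Form
  less  : Exp → Exp → Form
  neg   : Form → Form
  _and_ : Form → Form → Form
  most  : Exp → Exp → Form → Form

infixr 6 _and_

size# : Exp
size# = var 0

infixl 7 _⊕_ _⊖_
infixl 8 _⊗_
_⊕_ _⊗_ _⊖_ : Exp → Exp → Exp
_⊕_ = op add
_⊗_ = op mul
_⊖_ = op sub

-- The indicator of a < b by truncated subtraction: (1 + a) ∸ b vanishes just if a < b.
isLess : Exp → Exp → Exp
isLess a b = lit 1 ⊖ (lit 1 ⊕ a ⊖ b)

weightedSum : ℕ → (ℕ → ℕ) → (ℕ → Bool) → ℕ
weightedSum zero    w b = 0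
weightedSum (suc n) w b = weightedSum n w b + (if b n then w n else 0)

gateCount : Form → Exp
gateCount (bitAt e)    = lit 1
gateCount (less a b)   = lit 3
gateCount (neg φ)      = lit 1 ⊕ gateCount φ
gateCount (φ and ψ)    = lit 1 ⊕ (gateCount ψ ⊕ gateCount φ)
gateCount (most w t φ) = lit 3 ⊕ size# ⊗ gateCount φ

-- The offsets of the i-th copy of φ, of a true and of a false gate below
-- the gate for `most w t φ`, where n is the number of variables in scope.
copyOffset : ℕ → Form → Exp
copyOffset n φ = (size# ⊖ (lit 1 ⊕ var (suc n))) ⊗ gateCount φ

trueOffset falseOffset : Form → Exp
trueOffset  φ = size# ⊗ gateCount φ
falseOffset φ = lit 1 ⊕ trueOffset φ

formDepth : Form → ℕ
formDepth (bitAt e)    = 1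
formDepth (less a b)   = 3
formDepth (neg φ)      = suc (formDepth φ)
formDepth (φ and ψ)    = suc (max (formDepth φ) (formDepth ψ))
formDepth (most w t φ) = suc (max 2 (formDepth φ))

look-size : ∀ N s → look N s 0 ≡ N
look-size N []      = refl
look-size N (_ ∷ s) = look-size N s

≡ᵇ-refl : ∀ n → (n ≡ᵇ n) ≡ true
≡ᵇ-refl zero    = refl
≡ᵇ-refl (suc n) = ≡ᵇ-refl n

look-last : ∀ N i s → look N (i ∷ s) (suc (length s)) ≡ i
look-last N i s rewrite ≡ᵇ-refl (length s) = refl

module Circuits (N : ℕ) where

  open WellFormed N public

  ⟦_⟧ : Exp → List ℕ → ℕ
  ⟦ e ⟧ s = eval N s e

  root  : List ℕ → Form → RawGate
  lower : List ℕ → Form → List RawGate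

  gates : List ℕ → Form → List RawGate
  gates s φ = root s φ ∷ lower s φ

  copies : List ℕ → Form → ℕ → List RawGate
  copies s φ zero    = []
  copies s φ (suc n) = root (n ∷ s) φ ∷ lower (n ∷ s) φ ++ copies s φ n

  -- The majority of no wires is false; its negation, at address 0, is true.
  constants : List RawGate
  constants = NOT (gate 0) ∷ MAJORITY [] ∷ []

  copyWires : List ℕ → Exp → Form → ℕ → List RawWire
  copyWires s w φ i = appendUpTo
    (λ _ → gate (⟦ copyOffset (length s) φ ⟧ (i ∷ s)) ∷ gate (⟦ trueOffset φ ⟧ (i ∷ s)) ∷ []) (⟦ w ⟧ (i ∷ s))

  -- The majority of one wire is that wire and the majority of none is false. An indicator as
  -- multiplicity thus acts as a guard: here for the range of the index, below for the comparison,
  -- where the wire is constantly true.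
  root s (bitAt e)    = MAJORITY (appendUpTo (λ _ → [ input (⟦ e ⟧ s) ]) (⟦ isLess e size# ⟧ s))
  root s (less a b)   = MAJORITY (appendUpTo (λ _ → [ gate 0 ]) (⟦ isLess a b ⟧ s))
  root s (neg φ)      = NOT (gate 0)
  root s (φ and ψ)    = MAJORITY (gate 0 ∷ gate (⟦ gateCount ψ ⟧ s) ∷ [])
  -- Let V be the total weight and S that of the true copies. Each unit of weight gives a copy wire
  -- and a true wire, and 2 t false wires are added: of 2 V + 2 t wires S + V are on, which is more
  -- than half just if t < S.
  root s (most w t φ) = MAJORITY (appendUpTo (copyWires s w φ) N ++
                                  appendUpTo (λ _ → [ gate (⟦ falseOffset φ ⟧ s) ]) (⟦ lit 2 ⊗ t ⟧ s))

  lower s (bitAt e)    = []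
  lower s (less a b)   = constants
  lower s (neg φ)      = gates s φ
  lower s (φ and ψ)    = gates s ψ ++ gates s φ
  lower s (most w t φ) = copies s φ N ++ constants

  #gates : Form → ℕ
  #gates (bitAt e)    = 1
  #gates (less a b)   = 3
  #gates (neg φ)      = suc (#gates φ)
  #gates (φ and ψ)    = suc (#gates ψ + #gates φ)
  #gates (most w t φ) = 3 + N * #gates φ

  eval-gateCount : ∀ φ s → ⟦ gateCount φ ⟧ s ≡ #gates φ
  eval-gateCount (bitAt e)    s = refl
  eval-gateCount (less a b)   s = refl
  eval-gateCount (neg φ)      s = cong suc (eval-gateCount φ s)
  eval-gateCount (φ and ψ)    s = cong suc (cong₂ _+_ (eval-gateCount ψ s) (eval-gateCount φ s))
  eval-gateCount (most w t φ) s = cong (3 +_) (cong₂ _*_ (look-size N s) (eval-gateCount φ s))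

  length-copies : ∀ s φ n → (∀ i → length (gates (i ∷ s) φ) ≡ #gates φ) → length (copies s φ n) ≡ n * #gates φ
  length-copies s φ zero    h = refl
  length-copies s φ (suc n) h = trans (length-++ (gates (n ∷ s) φ)) (cong₂ _+_ (h n) (length-copies s φ n h))

  length-gates : ∀ φ s → length (gates s φ) ≡ #gates φ
  length-gates (bitAt e)    s = refl
  length-gates (less a b)   s = refl
  length-gates (neg φ)      s = cong suc (length-gates φ s)
  length-gates (φ and ψ)    s = cong suc (trans (length-++ (gates s ψ)) (cong₂ _+_ (length-gates ψ s) (length-gates φ s)))
  length-gates (most w t φ) s = cong suc (trans (length-++ (copies s φ N))
    (trans (+-comm _ 2) (cong (2 +_) (length-copies s φ N (λ i → length-gates φ (i ∷ s))))))

  eval-copyOffset : ∀ s φ i → ⟦ copyOffset (length s) φ ⟧ (i ∷ s) ≡ (N ∸ suc i) * #gates φ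
  eval-copyOffset s φ i = cong₂ _*_
    (cong₂ (λ m n → m ∸ suc n) (look-size N (i ∷ s)) (look-last N i s)) (eval-gateCount φ (i ∷ s))

  eval-trueOffset : ∀ s φ → ⟦ trueOffset φ ⟧ s ≡ N * #gates φ
  eval-trueOffset s φ = cong₂ _*_ (look-size N s) (eval-gateCount φ s)

  all-appendUpTo : ∀ {A : Set} {P : A → Set} (f : ℕ → List A) n → (∀ i → i < n → All P (f i)) → All P (appendUpTo f n)
  all-appendUpTo f zero    h = []
  all-appendUpTo f (suc n) h = Allₚ.++⁺ (all-appendUpTo f n (λ i l → h i (m≤n⇒m≤1+n l))) (h n ≤-refl)

  -- Well-formedness and depth of the circuits of formulas

  isLess-< : ∀ {a b i} → i < 1 ∸ (suc a ∸ b) → a < b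
  isLess-< {a} {b} h with suc a ∸ b in eq
  ... | zero = m∸n≡0⇒m≤n eq
  isLess-< {a} {b} () | suc zero
  isLess-< {a} {b} () | suc (suc _)

  wf-constants : WF constants
  wf-constants = s≤s z≤n ∷ [] , [] , tt

  wf-gates : ∀ φ s → WF (gates s φ)
  wf-copies : ∀ φ s n → WF (copies s φ n)

  wf-gates (bitAt e) s = all-appendUpTo _ _ (λ i l → subst (⟦ e ⟧ s <_) (look-size N s) (isLess-< {⟦ e ⟧ s} l) ∷ []) , tt
  wf-gates (less a b) s = all-appendUpTo _ (⟦ isLess a b ⟧ s) (λ i l → s≤s z≤n ∷ []) , wf-constants
  wf-gates (neg φ) s = s≤s z≤n ∷ [] , wf-gates φ s
  wf-gates (φ and ψ) s =
    s≤s z≤n ∷ subst₂ _<_ (trans (length-gates ψ s) (sym (eval-gateCount ψ s))) (sym (length-++ (gates s ψ)))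
      (m<m+n (length (gates s ψ)) {length (gates s φ)} (s≤s z≤n)) ∷ [] , wf-++ (gates s ψ) (wf-gates ψ s) (wf-gates φ s)
  wf-gates (most w t φ) s = Allₚ.++⁺
      (all-appendUpTo (copyWires s w φ) N λ i i<N → all-appendUpTo _ (⟦ w ⟧ (i ∷ s)) λ _ _ →
        ≤-<-trans (≤-trans (≤-reflexive (eval-copyOffset s φ i)) (*-monoˡ-≤ (#gates φ) (m∸n≤m N (suc i)))) range₀ ∷
        ≤-<-trans (≤-reflexive (eval-trueOffset (i ∷ s) φ)) range₀ ∷ [])
      (all-appendUpTo _ (⟦ lit 2 ⊗ t ⟧ s) λ _ _ →
        ≤-<-trans (≤-reflexive (trans (cong suc (eval-trueOffset s φ)) (+-comm 1 _))) (range 1 (s≤s (s≤s z≤n))) ∷ []) ,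
    wf-++ (copies s φ N) (wf-copies φ s N) wf-constants
    where
    range : ∀ c → c < 2 → N * #gates φ + c < length (copies s φ N ++ constants)
    range c h = subst (N * #gates φ + c <_)
      (sym (trans (length-++ (copies s φ N)) (cong (_+ 2) (length-copies s φ N (λ i → length-gates φ (i ∷ s))))))
      (+-monoʳ-< (N * #gates φ) h)
    range₀ : N * #gates φ < length (copies s φ N ++ constants)
    range₀ = subst (_< length (copies s φ N ++ constants)) (+-identityʳ _) (range 0 (s≤s z≤n))

  wf-copies φ s zero    = tt
  wf-copies φ s (suc n) = wf-++ (gates (n ∷ s) φ) (wf-gates φ (n ∷ s)) (wf-copies φ s n)

  depths-++ : ∀ G H {d} → WF G → All (_≤ d) (depths G) → All (_≤ d) (depths H) → All (_≤ d) (depths (G ++ H))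
  depths-++ G H g dG dH = subst (All _) (sym (fold-++ _ _ _ _ G H g)) (Allₚ.++⁺ dG dH)

  -- Valid for any gate, as an address out of range has depth 0 by default.
  depths-∷ : ∀ γ G {d} → All (_≤ d) (depths G) → All (_≤ suc d) (depths (γ ∷ G))
  depths-∷ γ G {d} h = of-gate γ ∷ All.map m≤n⇒m≤1+n h
    where
    nth-≤ : ∀ ds → All (_≤ d) ds → ∀ j → nth 0 ds j ≤ d
    nth-≤ []       []       j       = z≤n
    nth-≤ (_ ∷ ds) (h ∷ hs) zero    = h
    nth-≤ (_ ∷ ds) (h ∷ hs) (suc j) = nth-≤ ds hs j
    of-wire : ∀ w → wireDepthRaw (depths G) w ≤ d
    of-wire (input i) = z≤n
    of-wire (gate j)  = nth-≤ (depths G) h j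
    of-wires : ∀ ws → foldr max 0 (map (wireDepthRaw (depths G)) ws) ≤ d
    of-wires []       = z≤n
    of-wires (w ∷ ws) = ⊔-lub (of-wire w) (of-wires ws)
    of-gate : ∀ γ → gateDepthRaw (depths G) γ ≤ suc d
    of-gate (NOT w)       = s≤s (⊔-lub (of-wire w) z≤n)
    of-gate (MAJORITY ws) = s≤s (of-wires ws)

  depths-constants : All (_≤ 2) (depths constants)
  depths-constants = ≤-refl ∷ s≤s z≤n ∷ []

  depths-gates : ∀ φ s → All (_≤ formDepth φ) (depths (gates s φ))
  depths-copies : ∀ φ s n → All (_≤ formDepth φ) (depths (copies s φ n))

  depths-gates (bitAt e)    s = depths-∷ (root s (bitAt e)) [] []
  depths-gates (less a b)   s = depths-∷ (root s (less a b)) constants depths-constants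
  depths-gates (neg φ)      s = depths-∷ (NOT (gate 0)) (gates s φ) (depths-gates φ s)
  depths-gates (φ and ψ)    s = depths-∷ (root s (φ and ψ)) (lower s (φ and ψ))
    (depths-++ (gates s ψ) (gates s φ) (wf-gates ψ s)
      (All.map (λ h → ≤-trans h (m≤n⊔m (formDepth φ) (formDepth ψ))) (depths-gates ψ s))
      (All.map (λ h → ≤-trans h (m≤m⊔n (formDepth φ) (formDepth ψ))) (depths-gates φ s)))
  depths-gates (most w t φ) s = depths-∷ (root s (most w t φ)) (lower s (most w t φ))
    (depths-++ (copies s φ N) constants (wf-copies φ s N)
      (All.map (λ h → ≤-trans h (m≤n⊔m 2 (formDepth φ))) (depths-copies φ s N))
      (All.map (λ h → ≤-trans h (m≤m⊔n 2 (formDepth φ))) depths-constants))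

  depths-copies φ s zero    = []
  depths-copies φ s (suc n) = depths-++ (gates (n ∷ s) φ) (copies s φ n) (wf-gates φ (n ∷ s))
    (depths-gates φ (n ∷ s)) (depths-copies φ s n)

  -- Semantics of formulas and correctness of their circuits

  module Truth (x : List Bool) (length-x : length x ≡ N) where

    open Values x public

    truth : List ℕ → Form → Bool
    truth s (bitAt e)    = nth false x (⟦ e ⟧ s)
    truth s (less a b)   = ⟦ a ⟧ s <ᵇ ⟦ b ⟧ s
    truth s (neg φ)      = not (truth s φ)
    truth s (φ and ψ)    = truth s φ ∧ truth s ψ
    truth s (most w t φ) = ⟦ t ⟧ s <ᵇ weightedSum N (λ i → ⟦ w ⟧ (i ∷ s)) (λ i → truth (i ∷ s) φ)

    count-++ : ∀ bs cs → count (bs ++ cs) ≡ count bs + count cs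
    count-++ []           cs = refl
    count-++ (true ∷ bs)  cs = cong suc (count-++ bs cs)
    count-++ (false ∷ bs) cs = count-++ bs cs

    on# : List Bool → List RawWire → ℕ
    on# vs ws = count (map (wireValueRaw vs) ws)

    on#-++ : ∀ vs ws us → on# vs (ws ++ us) ≡ on# vs ws + on# vs us
    on#-++ vs ws us = trans (cong count (map-++ _ ws us)) (count-++ (map (wireValueRaw vs) ws) _)

    majority-wires : ∀ vs ws → gateValueRaw vs (MAJORITY ws) ≡ (length ws <ᵇ 2 * on# vs ws)
    majority-wires vs ws = cong (_<ᵇ 2 * on# vs ws) (length-map _ ws)

    length-repeat : ∀ {A : Set} (us : List A) n → length (appendUpTo (λ _ → us) n) ≡ n * length us
    length-repeat us zero    = refl
    length-repeat us (suc n) = trans (length-++ (appendUpTo (λ _ → us) n))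
      (trans (cong (_+ length us) (length-repeat us n)) (+-comm _ (length us)))

    on#-repeat : ∀ vs us n → on# vs (appendUpTo (λ _ → us) n) ≡ n * on# vs us
    on#-repeat vs us zero    = refl
    on#-repeat vs us (suc n) = trans (on#-++ vs (appendUpTo (λ _ → us) n) us)
      (trans (cong (_+ on# vs us) (on#-repeat vs us n)) (+-comm _ (on# vs us)))

    <ᵇ-true : ∀ {m n} → m < n → (m <ᵇ n) ≡ true
    <ᵇ-true {zero}  {suc n} _       = refl
    <ᵇ-true {suc m} {suc n} (s≤s h) = <ᵇ-true h

    <ᵇ-false : ∀ {m n} → n ≤ m → (m <ᵇ n) ≡ false
    <ᵇ-false {m}     {zero}  _       = refl
    <ᵇ-false {suc m} {suc n} (s≤s h) = <ᵇ-false h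

    flagged : ∀ vs w a b → gateValueRaw vs (MAJORITY (appendUpTo (λ _ → [ w ]) (1 ∸ (suc a ∸ b))))
                           ≡ (wireValueRaw vs w ∧ (a <ᵇ b))
    flagged vs w a b with <-≤-connex a b
    ... | inj₁ a<b rewrite m≤n⇒m∸n≡0 a<b | <ᵇ-true a<b with wireValueRaw vs w
    ...   | true  = refl
    ...   | false = refl
    flagged vs w a b | inj₂ b≤a rewrite <ᵇ-false b≤a | +-∸-assoc 1 b≤a | 0∸n≡0 (a ∸ b) with wireValueRaw vs w
    ...   | true  = refl
    ...   | false = refl

    nth-outside : ∀ {A : Set} {z : A} as {i} → length as ≤ i → nth z as i ≡ z
    nth-outside []       _       = refl
    nth-outside (a ∷ as) (s≤s h) = nth-outside as h

    cancel-padding : ∀ m t X → ((m * 2 + t) <ᵇ 2 * (X + m + 0)) ≡ (t <ᵇ 2 * X)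
    cancel-padding m t X = trans (cong₂ _<ᵇ_ (cong (_+ t) (*-comm m 2)) eq) (cancel (2 * m))
      where
      eq : 2 * (X + m + 0) ≡ 2 * m + 2 * X
      eq = trans (cong (2 *_) (trans (+-identityʳ _) (+-comm X m))) (*-distribˡ-+ 2 m X)
      cancel : ∀ k {a b} → ((k + a) <ᵇ (k + b)) ≡ (a <ᵇ b)
      cancel zero    = refl
      cancel (suc k) = cancel k

    double-<ᵇ : ∀ t X → (2 * t <ᵇ 2 * X) ≡ (t <ᵇ X)
    double-<ᵇ t X with <-≤-connex t X
    ... | inj₁ h = trans (<ᵇ-true (*-monoʳ-< 2 h)) (sym (<ᵇ-true h))
    ... | inj₂ h = trans (<ᵇ-false (*-monoʳ-≤ 2 h)) (sym (<ᵇ-false h))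

    total : ℕ → (ℕ → ℕ) → ℕ
    total zero    w = 0
    total (suc n) w = total n w + w n

    copies-wires : ∀ vs s w φ n → (∀ i → i < n → nth false vs ((N ∸ suc i) * #gates φ) ≡ truth (i ∷ s) φ) →
      nth false vs (N * #gates φ) ≡ true →
      length (appendUpTo (copyWires s w φ) n) ≡ total n (λ i → ⟦ w ⟧ (i ∷ s)) * 2
      × on# vs (appendUpTo (copyWires s w φ) n)
        ≡ weightedSum n (λ i → ⟦ w ⟧ (i ∷ s)) (λ i → truth (i ∷ s) φ) + total n (λ i → ⟦ w ⟧ (i ∷ s))
    copies-wires vs s w φ zero    h ht = refl , refl
    copies-wires vs s w φ (suc n) h ht with copies-wires vs s w φ n (λ i l → h i (m≤n⇒m≤1+n l)) ht
    ... | ℓ , o =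
      trans (length-++ (appendUpTo (copyWires s w φ) n))
        (trans (cong₂ _+_ ℓ (length-repeat _ wn)) (sym (*-distribʳ-+ 2 (total n _) wn))) ,
      trans (on#-++ vs (appendUpTo (copyWires s w φ) n) _)
        (trans (cong₂ _+_ o (trans (on#-repeat vs pair wn) on-pair)) (interchange (weightedSum n _ _) (total n _) (if truth (n ∷ s) φ then wn else 0) wn))
      where
      wn = ⟦ w ⟧ (n ∷ s)
      pair = gate (⟦ copyOffset (length s) φ ⟧ (n ∷ s)) ∷ gate (⟦ trueOffset φ ⟧ (n ∷ s)) ∷ []
      interchange : ∀ a b c d → a + b + (c + d) ≡ a + c + (b + d)
      interchange = solve-∀
      on-pair : wn * on# vs pair ≡ (if truth (n ∷ s) φ then wn else 0) + wn
      on-pair rewrite eval-copyOffset s φ n | eval-trueOffset (n ∷ s) φ | h n ≤-refl | ht with truth (n ∷ s) φ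
      ... | true  = trans (*-comm wn 2) (cong (wn +_) (+-identityʳ wn))
      ... | false = *-identityʳ wn

    values-gates : ∀ φ s → nth false (values (gates s φ)) 0 ≡ truth s φ
    -- `H` is whatever lies beneath. It is arbitrary because the induction on n meets every copy
    -- with further copies under it.
    values-copies : ∀ φ s n H i → i < n → nth false (values (copies s φ n ++ H)) ((n ∸ suc i) * #gates φ) ≡ truth (i ∷ s) φ

    values-++ : ∀ G H → WF G → values (G ++ H) ≡ values G ++ values H
    values-++ G H g = fold-++ _ _ _ _ G H g

    nth-values : ∀ G H k → WF G → nth false (values (G ++ H)) (length G + k) ≡ nth false (values H) k
    nth-values G H k g rewrite values-++ G H g | sym (length-values G) = nth-++ʳ (values G) k

    values-gates (bitAt e) s with <-≤-connex (⟦ e ⟧ s) (look N s 0)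
    ... | inj₁ h = trans (flagged [] (input (⟦ e ⟧ s)) (⟦ e ⟧ s) (look N s 0))
                     (trans (cong (nth false x (⟦ e ⟧ s) ∧_) (<ᵇ-true h)) (∧-trueʳ _))
      where
      ∧-trueʳ : ∀ b → (b ∧ true) ≡ b
      ∧-trueʳ true  = refl
      ∧-trueʳ false = refl
    -- Out of range the gate has no wires, which fits the default value false of `nth`.
    ... | inj₂ h = trans (flagged [] (input (⟦ e ⟧ s)) (⟦ e ⟧ s) (look N s 0))
                     (trans (cong (_∧ (⟦ e ⟧ s <ᵇ look N s 0)) out) (sym out))
      where
      out : nth false x (⟦ e ⟧ s) ≡ false
      out = nth-outside x (subst (_≤ ⟦ e ⟧ s) (trans (look-size N s) (sym length-x)) h)
    values-gates (less a b) s = flagged (true ∷ false ∷ []) (gate 0) (⟦ a ⟧ s) (⟦ b ⟧ s)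
    values-gates (neg φ)    s = cong not (values-gates φ s)
    values-gates (φ and ψ)  s = trans (majority-wires vs (gate 0 ∷ gate (⟦ gateCount ψ ⟧ s) ∷ []))
      (trans (cong₂ (λ b c → 2 <ᵇ 2 * count (b ∷ c ∷ [])) at-ψ at-φ) (both (truth s ψ) (truth s φ)))
      where
      vs = values (gates s ψ ++ gates s φ)
      at-ψ : nth false vs 0 ≡ truth s ψ
      at-ψ = trans (cong (λ v → nth false v 0) (values-++ (gates s ψ) (gates s φ) (wf-gates ψ s))) (values-gates ψ s)
      at-φ : nth false vs (⟦ gateCount ψ ⟧ s) ≡ truth s φ
      at-φ = trans (cong (nth false vs) (trans (eval-gateCount ψ s) (trans (sym (length-gates ψ s)) (sym (+-identityʳ _)))))
        (trans (nth-values (gates s ψ) (gates s φ) 0 (wf-gates ψ s)) (values-gates φ s))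
      both : ∀ b c → (2 <ᵇ 2 * count (b ∷ c ∷ [])) ≡ (c ∧ b)
      both true  true  = refl
      both true  false = refl
      both false true  = refl
      both false false = refl
    values-gates (most w t φ) s = trans (majority-wires vs (ws ++ us))
      (trans (cong₂ (λ m n → m <ᵇ 2 * n) lengths ons) (trans (cancel-padding tot (2 * ⟦ t ⟧ s) sum) (double-<ᵇ (⟦ t ⟧ s) sum)))
      where
      vs = values (copies s φ N ++ constants)
      sum = weightedSum N (λ i → ⟦ w ⟧ (i ∷ s)) (λ i → truth (i ∷ s) φ)
      tot = total N (λ i → ⟦ w ⟧ (i ∷ s))
      ws = appendUpTo (copyWires s w φ) N
      us = appendUpTo (λ _ → [ gate (⟦ falseOffset φ ⟧ s) ]) (⟦ lit 2 ⊗ t ⟧ s)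
      at-constant : ∀ k → nth false vs (N * #gates φ + k) ≡ nth false (true ∷ false ∷ []) k
      at-constant k = trans (cong (λ l → nth false vs (l + k)) (sym (length-copies s φ N (λ i → length-gates φ (i ∷ s)))))
        (nth-values (copies s φ N) constants k (wf-copies φ s N))
      both = copies-wires vs s w φ N (λ i → values-copies φ s N constants i)
               (trans (cong (nth false vs) (sym (+-identityʳ _))) (at-constant 0))
      lengths : length (ws ++ us) ≡ tot * 2 + 2 * ⟦ t ⟧ s
      lengths = trans (length-++ ws) (cong₂ _+_ (proj₁ both) (trans (length-repeat _ (2 * ⟦ t ⟧ s)) (*-identityʳ _)))
      ons : on# vs (ws ++ us) ≡ sum + tot + 0
      ons = trans (on#-++ vs ws us) (cong₂ _+_ (proj₂ both) (trans (on#-repeat vs _ (2 * ⟦ t ⟧ s))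
        (trans (cong (λ b → (2 * ⟦ t ⟧ s) * count (b ∷ []))
          (trans (cong (nth false vs) (trans (cong suc (eval-trueOffset s φ)) (+-comm 1 _))) (at-constant 1)))
          (*-zeroʳ (2 * ⟦ t ⟧ s)))))

    values-copies φ s (suc n) H i (s≤s i≤n) with m≤n⇒m<n∨m≡n i≤n
    ... | inj₂ refl = trans (cong (λ k → nth false (values (copies s φ (suc n) ++ H)) (k * #gates φ)) (n∸n≡0 n))
      (trans (cong (λ G → nth false (values G) 0) (++-assoc (gates (n ∷ s) φ) (copies s φ n) H))
        (trans (cong (λ v → nth false v 0) (values-++ (gates (n ∷ s) φ) (copies s φ n ++ H) (wf-gates φ (n ∷ s))))
          (values-gates φ (n ∷ s))))
    ... | inj₁ i<n  = trans (cong (λ G → nth false (values G) ((n ∸ i) * #gates φ)) (++-assoc (gates (n ∷ s) φ) (copies s φ n) H))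
      (trans (cong (nth false (values (gates (n ∷ s) φ ++ copies s φ n ++ H))) index)
        (trans (nth-values (gates (n ∷ s) φ) (copies s φ n ++ H) _ (wf-gates φ (n ∷ s)))
          (values-copies φ s n H i i<n)))
      where
      index : (n ∸ i) * #gates φ ≡ length (gates (n ∷ s) φ) + (n ∸ suc i) * #gates φ
      index = trans (cong (_* #gates φ) (trans (cong (_∸ i) (sym (m+[n∸m]≡n i<n))) (shift i (n ∸ suc i))))
                (cong (_+ (n ∸ suc i) * #gates φ) (sym (length-gates φ (n ∷ s))))
        where
        shift : ∀ i k → suc i + k ∸ i ≡ suc k
        shift i k = trans (cong (_∸ i) (sym (+-suc i k))) (m+n∸m≡n i (suc k))

-- Polynomial bounds

-- The exponent of a bound (2 + N) ^ degree on the value. An operation adds 2: one factor for a sum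
-- of two bounded values, the other because `pow` computes with twice its modulus.
degree : Exp → ℕ
degree (var x)    = 1
degree (lit c)    = c
degree (op _ a b) = 2 + (degree a + degree b)

sizeDegree : Form → ℕ
sizeDegree (bitAt e)    = 1
sizeDegree (less a b)   = 3
sizeDegree (neg φ)      = 2 + sizeDegree φ
sizeDegree (φ and ψ)    = 3 + (sizeDegree ψ + sizeDegree φ)
sizeDegree (most w t φ) = 4 + (sizeDegree φ + (degree w + degree t))

-- Bounds the degrees of all terms that the generator evaluates, with sums in place of maxima.
-- `copyOffset 0` represents every `copyOffset n`, since the degree of a variable does not depend on
-- its number.
formDegree : Form → ℕ
formDegree (bitAt e)    = degree (isLess e size#) + degree e
formDegree (less a b)   = degree (isLess a b)
formDegree (neg φ)      = formDegree φ
formDegree (φ and ψ)    = degree (gateCount ψ) + (formDegree φ + formDegree ψ)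
formDegree (most w t φ) = degree w + (degree (lit 2 ⊗ t) + (degree (copyOffset 0 φ) + (degree (falseOffset φ) + formDegree φ)))

m<2^m : ∀ m → m < 2 ^ m
m<2^m zero    = s≤s z≤n
m<2^m (suc m) = ≤-trans (+-mono-≤ {1} (m^n>0 2 m) (m<2^m m)) (≤-reflexive (cong (2 ^ m +_) (sym (+-identityʳ _))))

module Growth (N : ℕ) where

  -- At least 2 even for N = 0, so that one factor `M` pays for a doubling and `M ^ c` exceeds the
  -- constant c.
  M : ℕ
  M = 2 + N

  M^≥1 : ∀ k → 1 ≤ M ^ k
  M^≥1 k = m^n>0 M k

  M^-mono : ∀ {j k} → j ≤ k → M ^ j ≤ M ^ k
  M^-mono = ^-monoʳ-≤ M

  lit≤ : ∀ c → c ≤ M ^ c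
  lit≤ c = ≤-trans (<⇒≤ (m<2^m c)) (^-monoˡ-≤ c (s≤s (s≤s z≤n)))

  double≤M* : ∀ {a} p → a ≤ p + p → a ≤ M * p
  double≤M* p h = ≤-trans h (≤-trans (≤-reflexive (cong (p +_) (sym (+-identityʳ p)))) (*-monoˡ-≤ p {2} {M} (s≤s (s≤s z≤n))))

  look≤ : ∀ s → All (_≤ M) s → ∀ x → look N s x ≤ M
  look≤ []      []       x = m≤n+m N 2
  look≤ (v ∷ s) (h ∷ hs) x with x ≡ᵇ suc (length s)
  ... | true  = h
  ... | false = look≤ s hs x

  module _ {a b x y} (ha : a ≤ M ^ x) (hb : b ≤ M ^ y) where

    private
      P = M ^ (x + y)
      A≤P : M ^ x ≤ P
      A≤P = M^-mono (m≤m+n x y)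
      B≤P : M ^ y ≤ P
      B≤P = M^-mono (m≤n+m y x)

    twice-fits : ∀ {c} → c ≤ P + P → c + c ≤ M ^ (2 + (x + y))
    twice-fits h = double≤M* (M * P) (+-mono-≤ (double≤M* P h) (double≤M* P h))

    once-fits : ∀ {c} → c ≤ P + P → c ≤ M ^ (2 + (x + y))
    once-fits {c} h = ≤-trans (m≤m+n c c) (twice-fits h)

    suc-fits : suc b ≤ P + P
    suc-fits = +-mono-≤ (M^≥1 (x + y)) (≤-trans hb B≤P)

    sum-fits : a + b ≤ P + P
    sum-fits = +-mono-≤ (≤-trans ha A≤P) (≤-trans hb B≤P)

    product-fits : a * b ≤ P + P
    product-fits = ≤-trans (*-mono-≤ ha hb) (≤-trans (≤-reflexive (sym (^-distribˡ-+-* M x y))) (m≤m+n P P))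

    apply-≤ : ∀ o → apply o a b ≤ M ^ (2 + (x + y))
    apply-≤ add = once-fits sum-fits
    apply-≤ mul = once-fits product-fits
    apply-≤ sub = once-fits (≤-trans (m∸n≤m a b) (≤-trans ha (≤-trans A≤P (m≤m+n P P))))
    apply-≤ pow = once-fits (≤-trans (power≤ a b) suc-fits)

  eval-≤ : ∀ e s → All (_≤ M) s → eval N s e ≤ M ^ degree e
  eval-≤ (var x)    s h = ≤-trans (look≤ s h x) (≤-reflexive (sym (*-identityʳ M)))
  eval-≤ (lit c)    s h = lit≤ c
  eval-≤ (op o a b) s h = apply-≤ {x = degree a} {y = degree b} (eval-≤ a s h) (eval-≤ b s h) o

  open Circuits N

  rawSize-++ : ∀ G H → rawSize (G ++ H) ≡ rawSize G + rawSize H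
  rawSize-++ []      H = refl
  rawSize-++ (γ ∷ G) H = trans (cong (_+ _) (rawSize-++ G H)) (swap (rawSize G) (rawSize H) _)
    where
    swap : ∀ a b c → a + b + c ≡ a + c + b
    swap = solve-∀

  length-appendUpTo : ∀ {A : Set} (f : ℕ → List A) n b → (∀ i → i < n → length (f i) ≤ b) → length (appendUpTo f n) ≤ n * b
  length-appendUpTo f zero    b h = z≤n
  length-appendUpTo f (suc n) b h = ≤-trans (≤-reflexive (length-++ (appendUpTo f n)))
    (≤-trans (+-mono-≤ (length-appendUpTo f n b (λ i l → h i (m≤n⇒m≤1+n l))) (h n ≤-refl)) (≤-reflexive (+-comm (n * b) b)))

  size-gates : ∀ φ s → All (_≤ M) s → rawSize (gates s φ) ≤ M ^ sizeDegree φ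
  size-copies : ∀ φ s n → n ≤ M → All (_≤ M) s → rawSize (copies s φ n) ≤ n * M ^ sizeDegree φ

  flag-wires : ∀ {A : Set} {w : A} a b → length (appendUpTo (λ _ → [ w ]) (1 ∸ (suc a ∸ b))) ≤ 1
  flag-wires a b = ≤-trans (length-appendUpTo _ (1 ∸ (suc a ∸ b)) 1 (λ _ _ → ≤-refl))
    (≤-trans (≤-reflexive (*-identityʳ _)) (m∸n≤m 1 (suc a ∸ b)))

  size-gates (bitAt e)    s h = ≤-trans (s≤s (flag-wires (eval N s e) (look N s 0))) (≤-trans (s≤s (s≤s z≤n)) (≤-reflexive (sym (*-identityʳ M))))
  size-gates (less a b)   s h = ≤-trans (+-monoʳ-≤ 4 (flag-wires (eval N s a) (eval N s b)))
    (≤-trans (m≤n+m 5 3) (^-monoˡ-≤ 3 {2} {M} (s≤s (s≤s z≤n))))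
  size-gates (neg φ)      s h = double≤M* (M * P) (≤-trans (+-mono-≤ (size-gates φ s h) ≤-refl)
      (+-mono-≤ (m≤n*m P M) (*-mono-≤ {2} {M} {1} {P} (s≤s (s≤s z≤n)) (M^≥1 (sizeDegree φ)))))
    where P = M ^ sizeDegree φ
  size-gates (φ and ψ)    s h = double≤M* (M * Q) (+-mono-≤
      (≤-trans (≤-reflexive (rawSize-++ (gates s ψ) (gates s φ)))
        (double≤M* Q (≤-trans (+-mono-≤ (≤-trans (size-gates ψ s h) (M^-mono (m≤m+n x y))) (≤-trans (size-gates φ s h) (M^-mono (m≤n+m y x))))
          (+-mono-≤ (m≤n*m P M) (m≤n*m P M)))))
      (≤-trans (n≤1+n 3) (*-mono-≤ {2} {M} {2} {Q} (s≤s (s≤s z≤n)) (*-mono-≤ {2} {M} {1} {P} (s≤s (s≤s z≤n)) (M^≥1 (x + y))))))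
    where
    x = sizeDegree ψ
    y = sizeDegree φ
    P = M ^ (x + y)
    Q = M * P
  size-gates (most w t φ) s h = ≤-trans (+-mono-≤ below reads) (double≤M* (M * (M * Q)) (≤-trans (≤-reflexive (regroup Q))
      (+-mono-≤ (double≤M* (M * Q) (+-mono-≤ 2Q 2Q)) (double≤M* (M * Q) (+-mono-≤ 2Q 2Q)))))
    where
    x = sizeDegree φ
    y = degree w
    z = degree t
    P = M ^ (x + (y + z))
    Q = M * P
    2≤M : 2 ≤ M
    2≤M = s≤s (s≤s z≤n)
    2Q : Q + Q ≤ M * Q
    2Q = double≤M* Q ≤-refl
    N≤M : N ≤ M
    N≤M = m≤n+m N 2
    2≤Q : 2 ≤ Q
    2≤Q = *-mono-≤ {2} {M} {1} {P} 2≤M (M^≥1 (x + (y + z)))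
    A≤ : M ^ x ≤ P
    A≤ = M^-mono (m≤m+n x _)
    B≤ : M ^ y ≤ P
    B≤ = M^-mono (≤-trans (m≤m+n y z) (m≤n+m _ x))
    T≤ : M ^ z ≤ P
    T≤ = M^-mono (≤-trans (m≤n+m z y) (m≤n+m _ x))
    -- Three and five times `Q` make eight, paid for by three factors `M`. With the one inside `Q`
    -- these are the 4 in `sizeDegree`.
    regroup : ∀ q → (q + (q + q)) + (q + ((q + q) + q) + q) ≡ ((q + q) + (q + q)) + ((q + q) + (q + q))
    regroup = solve-∀
    below : rawSize (copies s φ N ++ constants) ≤ Q + (Q + Q)
    below = ≤-trans (≤-reflexive (rawSize-++ (copies s φ N) constants))
      (+-mono-≤ (≤-trans (size-copies φ s N N≤M h) (*-mono-≤ N≤M A≤)) (≤-trans (n≤1+n 3) (+-mono-≤ 2≤Q 2≤Q)))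
    reads : length (rawWires (root s (most w t φ))) < Q + ((Q + Q) + Q) + Q
    reads = ≤-trans (s≤s (≤-trans (≤-reflexive (length-++ (appendUpTo (copyWires s w φ) N)))
      (+-mono-≤
        (≤-trans (length-appendUpTo (copyWires s w φ) N (M ^ y * 2) (λ i i<N →
            ≤-trans (length-appendUpTo _ (eval N (i ∷ s) w) 2 (λ _ _ → ≤-refl))
            (*-monoˡ-≤ 2 (eval-≤ w (i ∷ s) (≤-trans (<⇒≤ i<N) N≤M ∷ h)))))
          (≤-trans (*-mono-≤ N≤M (*-monoˡ-≤ 2 B≤)) (≤-reflexive (two M P))))
        (≤-trans (length-appendUpTo _ (2 * eval N s t) 1 (λ _ _ → ≤-refl))
          (≤-trans (≤-reflexive (*-identityʳ _)) (*-mono-≤ 2≤M (≤-trans (eval-≤ t s h) T≤)))))))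
      (≤-trans (+-mono-≤ {1} (<⇒≤ 2≤Q) ≤-refl) (m≤m+n _ Q))
      where
      two : ∀ m p → m * (p * 2) ≡ m * p + m * p
      two = solve-∀

  size-copies φ s zero    n≤M h = z≤n
  size-copies φ s (suc n) n≤M h = ≤-trans (≤-reflexive (rawSize-++ (gates (n ∷ s) φ) (copies s φ n)))
    (+-mono-≤ (size-gates φ (n ∷ s) (<⇒≤ n≤M ∷ h)) (size-copies φ s n (<⇒≤ n≤M) h))

-- Logspace generation of the circuits of a formula

formWidth : Form → ℕ
formWidth (bitAt e)    = 8 + (expWidth (isLess e size#) + expWidth e)
formWidth (less a b)   = 8 + expWidth (isLess a b)
formWidth (neg φ)      = formWidth φ
formWidth (φ and ψ)    = 8 + (expWidth (gateCount ψ) + (formWidth φ + formWidth ψ))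
formWidth (most w t φ) = 12 + (expWidth w + (expWidth (lit 2 ⊗ t) + (expWidth (copyOffset 0 φ) + (expWidth (falseOffset φ) + formWidth φ))))

module Generator (R : ℕ) where

  open Stack R public

  -- During `c` the number of rounds and the loop counter lie on the stack, which shifts the free
  -- registers of the body by 2.
  repeatC : ℕ → ℕ → Exp → Cmd → Cmd
  repeatC n d e c = compile n d e ⨾ loop (suc d) (suc d) c

  gateWireC : ℕ → ℕ → Exp → Cmd
  gateWireC n d e = emit gate-wire ⨾ repeatC n d e (emit tick)

  -- Descriptions start with the lowest gate, so blocks are printed in the reverse of their order in
  -- `gates`. The counter of a loop over the copies itself serves as the variable bound by `most`.
  generate : ℕ → Form → Cmd
  generate n (bitAt e)  = emit majority-gate
    ⨾ repeatC n n (isLess e size#) (emit input-wire ⨾ repeatC n (2 + n) e (emit tick))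
  -- The first three symbols describe `constants`. Address 0 takes no ticks.
  generate n (less a b) = emit majority-gate ⨾ emit not-gate ⨾ emit gate-wire
    ⨾ emit majority-gate ⨾ repeatC n n (isLess a b) (emit gate-wire)
  generate n (neg φ)    = generate n φ ⨾ emit not-gate ⨾ emit gate-wire
  generate n (φ and ψ)  = generate n φ ⨾ generate n ψ
    ⨾ emit majority-gate ⨾ emit gate-wire ⨾ gateWireC n n (gateCount ψ)
  generate n (most w t φ) = emit majority-gate ⨾ emit not-gate ⨾ emit gate-wire
    ⨾ loop n 0 (generate (suc n) φ)
    ⨾ emit majority-gate
    ⨾ loop n 0 (repeatC (suc n) (suc n) w
        (gateWireC (suc n) (3 + n) (copyOffset n φ) ⨾ gateWireC (suc n) (3 + n) (trueOffset φ)))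
    ⨾ repeatC n n (lit 2 ⊗ t) (gateWireC n (2 + n) (falseOffset φ))

  advanceInput : Cmd
  advanceInput = act λ _ v → right , stayPut v , nothing

  notAtEnd : InputCell Unit → Bool
  notAtEnd ⊣ = false
  notAtEnd _ = true

  -- Visits one cell to the right of `home` so that every tape represents 0 in the form required of
  -- counters, and moves the input head off the left marker.
  prepare : Cmd
  prepare = act (λ _ v → right , Vec.replicate (suc R) (home , right) , nothing)
          ⨾ act (λ _ v → stay , Vec.replicate (suc R) (blank , left) , nothing)

  readLength : Cmd
  readLength = while (λ i _ → notAtEnd i) (incr 0 ⨾ advanceInput)

  program : Form → Cmd
  program φ = prepare ⨾ readLength ⨾ generate 0 φ

  module Generation (N K L : ℕ) (enough : (2 + N) ^ K < 2 ^ L) where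

    inputWord : List Unit
    inputWord = replicate N tt

    open Triples N inputWord L
    open Growth N
    open Circuits N

    private variable
      s : List ℕ
      c : Cmd
      o : List Symbol

    emit-triple : ∀ {σ} → Triple s (emit σ) [ σ ] s
    Triple.run (emit-triple) τs p h@(valid , _) = τs , act (fits-counters τs valid) refl (applyAll-stayPut τs) refl , h

    exp-fits : ∀ e s → All (_≤ M) s → degree e ≤ K → ExpFits s e
    exp-fits (var x)    s h k = tt
    exp-fits (lit c)    s h k = ≤-<-trans (≤-trans (lit≤ c) (M^-mono k)) enough
    exp-fits (op o a b) s h k =
      exp-fits a s h (≤-trans (≤-trans (m≤m+n (degree a) (degree b)) (m≤n+m _ 2)) k) ,
      exp-fits b s h (≤-trans (≤-trans (m≤n+m (degree b) (degree a)) (m≤n+m _ 2)) k) ,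
      fits o
      where
      ha = eval-≤ a s h
      hb = eval-≤ b s h
      small : ∀ {n} → n ≤ M ^ (2 + (degree a + degree b)) → n < 2 ^ L
      small l = ≤-<-trans (≤-trans l (M^-mono k)) enough
      fits : ∀ o → OpFits o (eval N s a) (eval N s b)
      fits add = small (apply-≤ {x = degree a} {degree b} ha hb add)
      fits mul = small (apply-≤ {x = degree a} {degree b} ha hb mul)
      fits sub = tt
      fits pow = small (twice-fits {x = degree a} {degree b} ha hb (suc-fits {x = degree a} {degree b} ha hb))

    repeat-triple : ∀ e ts s → ExpFits s e → 2 + expWidth e + length (ts ++ s) ≤ R →
      (∀ i v → Triple (i ∷ v ∷ ts ++ s) c o (i ∷ v ∷ ts ++ s)) →
      Triple (ts ++ s) (repeatC (length s) (length (ts ++ s)) e c) (appendUpTo (λ _ → o) (eval N s e)) (ts ++ s)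
    repeat-triple {o = o} e ts s f h body = drop (
      compile-triple e ts s f (≤-trans (m≤n+m _ 2) h) ▸
      loop-triple (λ _ → eval N s e ∷ ts ++ s) (λ _ → o) (suc (length (ts ++ s))) (λ _ → refl)
        (≤-trans (s≤s (s≤s (m≤n+m _ (expWidth e)))) h) (λ _ → here) (λ i _ _ → body i (eval N s e)))

    appendUpTo-single : ∀ {A : Set} (a : A) n → appendUpTo (λ _ → [ a ]) n ≡ replicate n a
    appendUpTo-single a zero    = refl
    appendUpTo-single a (suc n) = trans (cong (_++ [ a ]) (appendUpTo-single a n)) (snoc n)
      where
      snoc : ∀ n → replicate n a ++ [ a ] ≡ a ∷ replicate n a
      snoc zero    = refl
      snoc (suc n) = cong (a ∷_) (snoc n)

    ticks-triple : ∀ e ts s → ExpFits s e → 2 + expWidth e + length (ts ++ s) ≤ R →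
      Triple (ts ++ s) (repeatC (length s) (length (ts ++ s)) e (emit tick)) (replicate (eval N s e) tick) (ts ++ s)
    ticks-triple e ts s f h = cast (appendUpTo-single tick (eval N s e)) refl (repeat-triple e ts s f h (λ _ _ → emit-triple))

    gateWire-triple : ∀ e ts s → ExpFits s e → 2 + expWidth e + length (ts ++ s) ≤ R →
      Triple (ts ++ s) (gateWireC (length s) (length (ts ++ s)) e) (describeRawWire (gate (eval N s e))) (ts ++ s)
    gateWire-triple e ts s f h = emit-triple ▸ ticks-triple e ts s f h

    at-size : ∀ s → At 0 N s
    at-size []      = base
    at-size (_ ∷ s) = there (at-size s)

    over-triple : ∀ (o : ℕ → List Symbol) s → suc (length s) ≤ R → (∀ i → i < N → Triple (i ∷ s) c (o i) (i ∷ s)) →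
                  Triple s (loop (length s) 0 c) (appendUpTo o N) s
    over-triple o s h body = loop-triple (λ _ → s) o (length s) (λ _ → refl) h (λ _ → at-size s) (λ i i<N _ → body i i<N)

    describe-++ : ∀ G H → describeRaw (G ++ H) ≡ describeRaw H ++ describeRaw G
    describe-++ []      H = sym (++-identityʳ _)
    describe-++ (γ ∷ G) H = trans (cong (_++ describeRawGate γ) (describe-++ G H)) (++-assoc (describeRaw H) _ _)

    describe-copies : ∀ s φ n → describeRaw (copies s φ n) ≡ appendUpTo (λ i → describeRaw (gates (i ∷ s) φ)) n
    describe-copies s φ zero    = refl
    describe-copies s φ (suc n) = trans (describe-++ (gates (n ∷ s) φ) (copies s φ n))
      (cong (_++ describeRaw (gates (n ∷ s) φ)) (describe-copies s φ n))

    describe-wires : ∀ (f : ℕ → List RawWire) n →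
      concatMap describeRawWire (appendUpTo f n) ≡ appendUpTo (concatMap describeRawWire ∘ f) n
    describe-wires f zero    = refl
    describe-wires f (suc n) = trans (concatMap-++ describeRawWire (appendUpTo f n) (f n))
      (cong (_++ concatMap describeRawWire (f n)) (describe-wires f n))

    appendUpTo-cong : ∀ {A : Set} {f g : ℕ → List A} n → (∀ i → f i ≡ g i) → appendUpTo f n ≡ appendUpTo g n
    appendUpTo-cong zero    h = refl
    appendUpTo-cong (suc n) h = cong₂ _++_ (appendUpTo-cong n h) (h n)

    describe-repeat : ∀ {o} ws n → concatMap describeRawWire ws ≡ o →
      concatMap describeRawWire (appendUpTo (λ _ → ws) n) ≡ appendUpTo (λ _ → o) n
    describe-repeat ws n eq = trans (describe-wires (λ _ → ws) n) (appendUpTo-cong n (λ _ → eq))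

    shift : ∀ k {a ℓ} → k + a + ℓ ≤ R → a + (k + ℓ) ≤ R
    shift k {a} {ℓ} h = ≤-trans (≤-reflexive (trans (sym (+-assoc a k ℓ)) (cong (_+ ℓ) (+-comm a k)))) h

    weaken : ∀ {a b ℓ} → a ≤ b → b + ℓ ≤ R → a + ℓ ≤ R
    weaken {ℓ = ℓ} l h = ≤-trans (+-monoˡ-≤ ℓ l) h

    generate-triple : ∀ φ s → All (_≤ M) s → formDegree φ ≤ K → formWidth φ + length s ≤ R →
      Triple s (generate (length s) φ) (describeRaw (gates s φ)) s
    generate-triple (bitAt e) s b k h = cast
      (cong (majority-gate ∷_) (sym (describe-repeat [ input (eval N s e) ] (eval N s (isLess e size#)) (++-identityʳ _)))) refl
      (emit-triple ▸ repeat-triple (isLess e size#) [] s (exp-fits (isLess e size#) s b (≤-trans (m≤m+n (degree (isLess e size#)) (degree e)) k))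
        (weaken {2 + expWidth (isLess e size#)} (+-mono-≤ {2} {8} (s≤s (s≤s z≤n)) (m≤m+n (expWidth (isLess e size#)) (expWidth e))) h)
        λ i v → emit-triple ▸ ticks-triple e (i ∷ v ∷ []) s (exp-fits e s b (≤-trans (m≤n+m (degree e) _) k))
          (shift 2 {2 + expWidth e} (weaken (+-mono-≤ {4} {8} (s≤s (s≤s (s≤s (s≤s z≤n)))) (m≤n+m (expWidth e) (expWidth (isLess e size#)))) h)))
    generate-triple (less p q) s b k h = cast
      (cong (λ o → majority-gate ∷ not-gate ∷ gate-wire ∷ majority-gate ∷ o)
        (sym (describe-repeat [ gate 0 ] (eval N s (isLess p q)) refl))) refl
      (emit-triple ▸ emit-triple ▸ emit-triple ▸ emit-triple ▸
       repeat-triple (isLess p q) [] s (exp-fits (isLess p q) s b k)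
         (weaken {2 + expWidth (isLess p q)} (+-mono-≤ {2} {8} (s≤s (s≤s z≤n)) ≤-refl) h) (λ _ _ → emit-triple))
    generate-triple (neg φ) s b k h = generate-triple φ s b k h ▸ emit-triple ▸ emit-triple
    generate-triple (φ and ψ) s b k h = cast
      (trans (sym (++-assoc (describeRaw (gates s φ)) (describeRaw (gates s ψ)) _))
        (cong₂ _++_ (sym (describe-++ (gates s ψ) (gates s φ)))
          (cong (λ o → majority-gate ∷ gate-wire ∷ o) (sym (++-identityʳ (describeRawWire (gate (eval N s (gateCount ψ))))))))) refl
      (generate-triple φ s b
         (≤-trans (≤-trans (m≤m+n (formDegree φ) _) (m≤n+m _ (degree (gateCount ψ)))) k)
         (weaken (≤-trans (m≤m+n (formWidth φ) _) (≤-trans (m≤n+m _ (expWidth (gateCount ψ))) (m≤n+m _ 8))) h) ▸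
       generate-triple ψ s b
         (≤-trans (≤-trans (m≤n+m (formDegree ψ) (formDegree φ)) (m≤n+m _ (degree (gateCount ψ)))) k)
         (weaken (≤-trans (m≤n+m (formWidth ψ) (formWidth φ)) (≤-trans (m≤n+m _ (expWidth (gateCount ψ))) (m≤n+m _ 8))) h) ▸
       emit-triple ▸ emit-triple ▸
       gateWire-triple (gateCount ψ) [] s (exp-fits (gateCount ψ) s b (≤-trans (m≤m+n (degree (gateCount ψ)) _) k))
         (weaken (+-mono-≤ {2} {8} (s≤s (s≤s z≤n)) (m≤m+n (expWidth (gateCount ψ)) _)) h))
    generate-triple (most w t φ) s b k h = cast
      (begin
        majority-gate ∷ not-gate ∷ gate-wire ∷ copiesText ++ majority-gate ∷ wiresText ++ falseText
          ≡⟨ cong₂ (λ o o′ → majority-gate ∷ not-gate ∷ gate-wire ∷ o ++ o′)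
               (sym (describe-copies s φ N)) (sym describe-root) ⟩
        majority-gate ∷ not-gate ∷ gate-wire ∷ describeRaw (copies s φ N) ++ describeRawGate (root s (most w t φ))
          ≡⟨ cong (_++ describeRawGate (root s (most w t φ))) (sym (describe-++ (copies s φ N) constants)) ⟩
        describeRaw (gates s (most w t φ)) ∎) refl
      (emit-triple ▸ emit-triple ▸ emit-triple ▸
       over-triple _ s (weaken {1} (s≤s z≤n) h) (λ i i<N → generate-triple φ (i ∷ s) (bound i i<N)
         (≤-trans (skip (degree w) (skip (degree (lit 2 ⊗ t)) (skip (degree (copyOffset 0 φ)) (m≤n+m (formDegree φ) (degree (falseOffset φ)))))) k)
         (shift 1 {formWidth φ} (weaken (+-mono-≤ {1} {12} (s≤s z≤n)
           (skip (expWidth w) (skip (expWidth (lit 2 ⊗ t)) (skip (expWidth (copyOffset 0 φ)) (m≤n+m (formWidth φ) (expWidth (falseOffset φ))))))) h))) ▸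
       emit-triple ▸
       over-triple (λ i → appendUpTo (λ _ → copyText i) (eval N (i ∷ s) w)) s (weaken {1} (s≤s z≤n) h) (λ i i<N →
         repeat-triple w [] (i ∷ s) (exp-fits w (i ∷ s) (bound i i<N) (≤-trans (m≤m+n (degree w) _) k))
           (shift 1 {2 + expWidth w} (weaken (+-mono-≤ {3} {12} (s≤s (s≤s (s≤s z≤n))) (m≤m+n (expWidth w) _)) h))
           (λ j v →
             gateWire-triple (copyOffset (length s) φ) (j ∷ v ∷ []) (i ∷ s) (exp-fits (copyOffset (length s) φ) (i ∷ s) (bound i i<N)
                 (≤-trans (skip (degree w) (skip (degree (lit 2 ⊗ t)) (m≤m+n (degree (copyOffset 0 φ)) _))) k))
               (shift 3 {2 + expWidth (copyOffset (length s) φ)} (weaken (+-mono-≤ {5} {12} (s≤s (s≤s (s≤s (s≤s (s≤s z≤n)))))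
                 (skip (expWidth w) (skip (expWidth (lit 2 ⊗ t)) (m≤m+n (expWidth (copyOffset 0 φ)) _)))) h)) ▸
             gateWire-triple (trueOffset φ) (j ∷ v ∷ []) (i ∷ s) (exp-fits (trueOffset φ) (i ∷ s) (bound i i<N)
                 (≤-trans (skip (degree w) (skip (degree (lit 2 ⊗ t)) (skip (degree (copyOffset 0 φ)) (≤-trans (m≤n+m (degree (trueOffset φ)) 3) (m≤m+n _ (formDegree φ)))))) k))
               (shift 3 {2 + expWidth (trueOffset φ)} (weaken (+-mono-≤ {5} {12} (s≤s (s≤s (s≤s (s≤s (s≤s z≤n)))))
                 (skip (expWidth w) (skip (expWidth (lit 2 ⊗ t)) (skip (expWidth (copyOffset 0 φ)) (≤-trans (m≤n+m (expWidth (trueOffset φ)) 26) (m≤m+n _ (formWidth φ))))))) h)))) ▸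
       repeat-triple (lit 2 ⊗ t) [] s (exp-fits (lit 2 ⊗ t) s b (≤-trans (skip (degree w) (m≤m+n (degree (lit 2 ⊗ t)) _)) k))
         (weaken (+-mono-≤ {2} {12} (s≤s (s≤s z≤n)) (skip (expWidth w) (m≤m+n (expWidth (lit 2 ⊗ t)) _))) h)
         (λ j v → gateWire-triple (falseOffset φ) (j ∷ v ∷ []) s (exp-fits (falseOffset φ) s b
             (≤-trans (skip (degree w) (skip (degree (lit 2 ⊗ t)) (skip (degree (copyOffset 0 φ)) (m≤m+n (degree (falseOffset φ)) (formDegree φ))))) k))
           (shift 2 {2 + expWidth (falseOffset φ)} (weaken (+-mono-≤ {4} {12} (s≤s (s≤s (s≤s (s≤s z≤n))))
             (skip (expWidth w) (skip (expWidth (lit 2 ⊗ t)) (skip (expWidth (copyOffset 0 φ)) (m≤m+n (expWidth (falseOffset φ)) (formWidth φ)))))) h))))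
      where
      open Relation.Binary.PropositionalEquality.≡-Reasoning
      skip : ∀ a {x y} → x ≤ y → x ≤ a + y
      skip a l = ≤-trans l (m≤n+m _ a)
      bound : ∀ i → i < N → All (_≤ M) (i ∷ s)
      bound i i<N = ≤-trans (<⇒≤ i<N) (m≤n+m N 2) ∷ b
      copyText : ℕ → List Symbol
      copyText i = describeRawWire (gate (eval N (i ∷ s) (copyOffset (length s) φ)))
                   ++ describeRawWire (gate (eval N (i ∷ s) (trueOffset φ)))
      copiesText = appendUpTo (λ i → describeRaw (gates (i ∷ s) φ)) N
      wiresText = appendUpTo (λ i → appendUpTo (λ _ → copyText i) (eval N (i ∷ s) w)) N
      falseText = appendUpTo (λ _ → describeRawWire (gate (eval N s (falseOffset φ)))) (eval N s (lit 2 ⊗ t))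
      describe-root : describeRawGate (root s (most w t φ)) ≡ majority-gate ∷ wiresText ++ falseText
      describe-root = cong (majority-gate ∷_) (trans (concatMap-++ describeRawWire (appendUpTo (copyWires s w φ) N) _)
        (cong₂ _++_
          (trans (describe-wires (copyWires s w φ) N)
            (appendUpTo-cong N (λ i → describe-repeat _ (eval N (i ∷ s) w)
              (cong (describeRawWire (gate (eval N (i ∷ s) (copyOffset (length s) φ))) ++_) (++-identityʳ _)))))
          (describe-repeat _ (eval N s (lit 2 ⊗ t)) (++-identityʳ _))))

    replicate-fits : ∀ τ → visited τ ≤ S → Fits (Vec.replicate (suc R) τ)
    replicate-fits τ h z = subst (λ t → visited t ≤ S) (sym (lookup-replicate z τ)) h

    prepared : Tapes
    prepared = Vec.replicate (suc R) (tape [] home (cells [] 0))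

    prepare-exec : Exec prepare 0 (Vec.replicate (suc R) (tape [] blank [])) [] 1 prepared
    prepare-exec = seq
      (act (replicate-fits _ (s≤s z≤n)) refl (zipWith-replicate {n = suc R} (writeMove blank) (home , right) (tape [] blank [])) refl)
      (act (replicate-fits _ (s≤s (s≤s z≤n))) refl (zipWith-replicate {n = suc R} (writeMove blank) (blank , left) (tape (home ∷ []) blank [])) refl)

    prepared-counters : ∀ z → Counter 0 (lookup prepared z)
    prepared-counters z = subst (Counter 0) (sym (lookup-replicate z (tape [] home (cells [] 0)))) (m^n>0 2 L , 0 , z≤n , refl)

    read-tick : ∀ n i → i < n → read (replicate n tt) (suc i) ≡ symbol tt
    read-tick (suc n) zero    h       = refl
    read-tick (suc n) (suc i) (s≤s h) = read-tick n i h

    read-end : ∀ n → read (replicate n tt) (suc n) ≡ ⊣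
    read-end zero    = refl
    read-end (suc n) = read-end n

    moveHead-inside : ∀ i → i < N → moveHead right (suc i) ≡ suc (suc i)
    moveHead-inside i h = m≤n⇒m⊓n≡m (s≤s (subst (suc i ≤_) (sym (length-replicate N)) h))

    readLength-exec : N < 2 ^ L → ∀ k i τs → i + k ≡ N → (∀ z → ∃[ n ] Counter n (lookup τs z)) →
      Counter i (lookup τs (register 0)) → ∃[ τs′ ] (Exec readLength (suc i) τs [] (suc N) τs′ × Holds τs′ [])
    readLength-exec b zero i τs eq valid C with trans (sym (+-identityʳ i)) eq
    ... | refl = τs , stop (fits-counters τs valid) (cong notAtEnd (read-end N)) , valid , C
    readLength-exec b (suc k) i τs eq valid C =
      let i<N = subst (suc i ≤_) eq (≤-trans (s≤s (m≤m+n i k)) (≤-reflexive (sym (+-suc i k))))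
          τ , st , C′ = inc-step (≤-<-trans i<N b) C
          valid′ = valid-update {τs = τs} {x = register 0} valid C′
          τs₁ = Vec.updateAt τs (register 0) (λ _ → τ)
          τs′ , e , h = readLength-exec b k (suc i) τs₁ (trans (sym (+-suc i k)) eq) valid′
            (subst (Counter (suc i)) (sym (lookup∘updateAt (register 0) τs)) C′)
      in τs′ ,
         go (fits-counters τs valid) (cong notAtEnd (read-tick N i i<N))
           (seq (run-step (fits-counters τs valid) st)
                (act (fits-counters τs₁ valid′) (moveHead-inside i i<N) (applyAll-stayPut τs₁) refl)) e ,
         h

    program-computes : ∀ φ → 1 ≤ K → formDegree φ ≤ K → formWidth φ ≤ R →
      ComputesInSpace (machine (program φ)) (suc R * S) inputWord (describeRaw (gates [] φ))
    program-computes φ 1≤K k h =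
      let τs₁ , e₁ , holds₁ = readLength-exec N< N 0 prepared refl (λ z → 0 , prepared-counters z) (prepared-counters (register 0))
          τs₂ , e₂ , valid , _ = Triple.run (generate-triple φ [] [] k (subst (_≤ R) (sym (+-identityʳ _)) h)) τs₁ (suc N) holds₁
      in subst (ComputesInSpace _ _ inputWord) (++-identityʳ _)
           (Simulation.computes (program φ) (seq prepare-exec (seq e₁ e₂)) (fits-counters τs₂ valid))
      where
      N< : N < 2 ^ L
      N< = ≤-<-trans (≤-trans (m≤n+m N 2) (≤-trans (≤-reflexive (sym (*-identityʳ M))) (M^-mono 1≤K))) enough

-- From sentences to TC⁰

n<2^[1+log₂n] : ∀ n → n < 2 ^ suc ⌊log₂ n ⌋
n<2^[1+log₂n] n with <-≤-connex n (2 ^ suc ⌊log₂ n ⌋)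
... | inj₁ h = h
... | inj₂ h with () ← n≮n ⌊log₂ n ⌋ (subst (_≤ ⌊log₂ n ⌋) (⌊log₂[2^n]⌋≡n (suc ⌊log₂ n ⌋)) (⌊log₂⌋-mono-≤ h))

2+n≤2^[2+log₂n] : ∀ n → 2 + n ≤ 2 ^ (2 + ⌊log₂ n ⌋)
2+n≤2^[2+log₂n] n = ≤-trans (+-mono-≤ (*-monoʳ-≤ 2 (m^n>0 2 ⌊log₂ n ⌋)) (<⇒≤ (n<2^[1+log₂n] n)))
  (≤-reflexive (cong (2 ^ suc ⌊log₂ n ⌋ +_) (sym (+-identityʳ _))))

-- For N ≥ 2 the square of N is at least 2 + N, whence the exponent 2 d; for N ≤ 1 the additive term
-- takes over with 3 ^ d.
shifted-power-bound : ∀ d → PolynomiallyBounded (λ N → (2 + N) ^ d)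
shifted-power-bound d = 2 * d + 3 ^ d , bound
  where
  bound : ∀ N → (2 + N) ^ d ≤ N ^ (2 * d + 3 ^ d) + (2 * d + 3 ^ d)
  bound zero = ≤-trans (^-monoˡ-≤ d {2} {3} (n≤1+n 2)) (≤-trans (m≤n+m _ (2 * d)) (m≤n+m _ (0 ^ (2 * d + 3 ^ d))))
  bound (suc zero) = ≤-trans (m≤n+m _ (2 * d)) (m≤n+m _ (1 ^ (2 * d + 3 ^ d)))
  bound N@(suc (suc n)) = ≤-trans (^-monoˡ-≤ d square)
    (≤-trans (≤-reflexive (^-*-assoc N 2 d)) (≤-trans (^-monoʳ-≤ N (m≤m+n (2 * d) (3 ^ d))) (m≤m+n _ _)))
    where
    square : 2 + N ≤ N ^ 2
    square = ≤-trans (+-mono-≤ {2} {N} (s≤s (s≤s z≤n)) (≤-reflexive (sym (+-identityʳ N))))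
      (≤-trans (*-monoˡ-≤ N {2} {N} (s≤s (s≤s z≤n))) (≤-reflexive (cong (N *_) (sym (*-identityʳ N)))))

module _ (φ : Form) where

  private module C N = Circuits N

  formCircuit : ∀ N → Circuit N
  formCircuit N = _ , C.build N (C.gates N [] φ) (C.wf-gates N φ [])

  formCircuit-uniform : LogspaceUniform formCircuit
  formCircuit-uniform = G.machine (G.program φ) , suc R * (3 + 2 * K) , computes
    where
    R = formWidth φ
    -- The successor makes `K` positive, so that N itself fits into a counter.
    K = suc (formDegree φ)
    module G = Generator R
    computes : ∀ N → ComputesInSpace (G.machine (G.program φ)) (suc R * (3 + 2 * K) * suc ⌊log₂ N ⌋) (replicate N tt) (describe (formCircuit N))
    computes N = subst₂ (λ b o → ComputesInSpace (G.machine (G.program φ)) b (replicate N tt) o)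
      (trans (cong (suc R *_) (scale K lg)) (sym (*-assoc (suc R) (3 + 2 * K) (suc lg))))
      (sym (C.describe-build N (C.gates N [] φ) (C.wf-gates N φ [])))
      (G.Generation.program-computes N K L enough φ (s≤s z≤n) (n≤1+n _) ≤-refl)
      where
      lg = ⌊log₂ N ⌋
      -- Chosen to exceed (2 + lg) K while the tape length 2 + L is exactly (3 + 2 K) (1 + lg), a
      -- multiple of the logarithmic bound.
      L = (1 + 2 * K) * suc lg + 2 * lg
      scale : ∀ K lg → 2 + ((1 + 2 * K) * suc lg + 2 * lg) ≡ (3 + 2 * K) * suc lg
      scale = solve-∀
      room : (2 + lg) * K < L
      room = ≤-trans (s≤s (*-monoˡ-≤ K {2 + lg} {2 * suc lg} (s≤s (subst (suc lg ≤_) (sym (+-suc lg (lg + 0))) (s≤s (m≤m+n lg (lg + 0)))))))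
        (≤-trans (+-monoˡ-≤ (2 * suc lg * K) (s≤s z≤n)) (≤-trans (≤-reflexive (swap K lg)) (m≤m+n _ (2 * lg))))
        where
        swap : ∀ K lg → suc lg + 2 * suc lg * K ≡ (1 + 2 * K) * suc lg
        swap = solve-∀
      enough : (2 + N) ^ K < 2 ^ L
      enough = ≤-<-trans (^-monoˡ-≤ K (2+n≤2^[2+log₂n] N))
        (≤-<-trans (≤-reflexive (^-*-assoc 2 (2 + lg) K)) (^-monoʳ-< 2 (s≤s (s≤s z≤n)) room))

  Holdsᶠ : Word → Bool
  Holdsᶠ w = C.Truth.truth (length w) w refl [] φ

  sentence-TC⁰ : ∀ {ℓ} {L : Language ℓ} → (∀ w → (Holdsᶠ w ≡ true) ⇔ L w) → TC⁰ L
  sentence-TC⁰ {L = L} correct = record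
    { circuit         = formCircuit
    ; polynomialSize  = let e , h = shifted-power-bound (sizeDegree φ) in
        e , λ N → ≤-trans (≤-reflexive (C.size-build N (C.gates N [] φ) (C.wf-gates N φ [])))
                          (≤-trans (Growth.size-gates N φ [] []) (h N))
    ; constantDepth   = formDepth φ , λ N → C.depth-build N (C.gates N [] φ) (C.wf-gates N φ []) (C.depths-gates N φ [])
    ; logspaceUniform = formCircuit-uniform
    ; decides         = λ w → subst (λ b → (b ≡ true) ⇔ L w) (sym (evaluates w)) (correct w)
    }
    where
    head-nth : ∀ {n} (v : Vec Bool (suc n)) → Vec.head v ≡ nth false (Vec.toList v) 0
    head-nth (b ∷ v) = refl
    evaluates : ∀ w → evaluate (formCircuit (length w)) (fromList w) ≡ Holdsᶠ w
    evaluates w = trans (head-nth (gateValues (fromList w) (C.build (length w) (C.gates (length w) [] φ) (C.wf-gates (length w) φ []))))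
      (trans (cong (λ vs → nth false vs 0)
               (C.Values.values-build (length w) w (fromList w) (toList∘fromList w) (C.gates (length w) [] φ) (C.wf-gates (length w) φ [])))
             (C.Truth.values-gates (length w) w refl φ []))

-- Comparison of products by digits of quotients

odd : ℕ → Bool
odd zero    = false
odd (suc n) = not (odd n)

odd-+2* : ∀ n c → odd (n + 2 * c) ≡ odd n
odd-+2* n zero    = cong odd (+-identityʳ n)
odd-+2* n (suc c) = trans (cong odd (shuffle n c)) (trans (not-involutive _) (odd-+2* n c))
  where
  shuffle : ∀ n c → n + 2 * suc c ≡ suc (suc (n + 2 * c))
  shuffle = solve-∀

odd-half : ∀ n → ∃[ s ] n ≡ (if odd n then 1 else 0) + 2 * s
odd-half zero    = 0 , refl
odd-half (suc n) with odd n | odd-half n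
... | false | s , refl = s , refl
... | true  | s , refl = suc s , solve s
  where
  solve : ∀ s → 2 + 2 * s ≡ 2 * suc s
  solve = solve-∀

m<[1+m/n]*n : ∀ m n .{{_ : NonZero n}} → m < suc (m / n) * n
m<[1+m/n]*n m n = ≤-trans (s≤s (≤-reflexive (m≡m%n+[m/n]*n m n))) (+-monoˡ-≤ (m / n * n) (m%n<n m n))

quotient-unique : ∀ {t v q} .{{_ : NonZero v}} → q * v ≤ t → t < suc q * v → t / v ≡ q
quotient-unique {t} {v} {q} l u = ≤-antisym
  (≤-pred (*-cancelʳ-< v (t / v) (suc q) (≤-<-trans (m/n*n≤m t v) u)))
  (≤-pred (*-cancelʳ-< v q (suc (t / v)) (≤-<-trans l (m<[1+m/n]*n t v))))

-- A step of long division: from q v ≤ t < (q + 1) v follows 2 q v ≤ δ + 2 t < (2 q + 2) v, so the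
-- new quotient is 2 q or 2 q + 1, and its parity is the digit appended.
quotient-double : ∀ t δ v .{{_ : NonZero v}} → δ ≤ 1 →
  (δ + 2 * t) / v ≡ (if odd ((δ + 2 * t) / v) then 1 else 0) + 2 * (t / v)
quotient-double t δ v δ≤1 = conclude (≤-antisym-split lower upper)
  where
  q = t / v
  lower : 2 * q * v ≤ δ + 2 * t
  lower = ≤-trans (≤-reflexive (*-assoc 2 q v)) (≤-trans (*-monoʳ-≤ 2 (m/n*n≤m t v)) (m≤n+m _ δ))
  upper : δ + 2 * t < suc (suc (2 * q)) * v
  upper = ≤-trans (s≤s (+-monoˡ-≤ (2 * t) δ≤1)) (≤-trans (≤-reflexive (solve₁ t))
            (≤-trans (*-monoʳ-≤ 2 (m<[1+m/n]*n t v)) (≤-reflexive (solve₂ q v))))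
    where
    solve₁ : ∀ t → 2 + 2 * t ≡ 2 * suc t
    solve₁ = solve-∀
    solve₂ : ∀ q v → 2 * (suc q * v) ≡ suc (suc (2 * q)) * v
    solve₂ = solve-∀
  ≤-antisym-split : 2 * q * v ≤ δ + 2 * t → δ + 2 * t < suc (suc (2 * q)) * v →
    (δ + 2 * t) / v ≡ 2 * q ⊎ (δ + 2 * t) / v ≡ suc (2 * q)
  ≤-antisym-split l u with <-≤-connex (δ + 2 * t) (suc (2 * q) * v)
  ... | inj₁ h = inj₁ (quotient-unique l h)
  ... | inj₂ h = inj₂ (quotient-unique h u)
  conclude : ∀ {n} → n ≡ 2 * q ⊎ n ≡ suc (2 * q) → n ≡ (if odd n then 1 else 0) + 2 * q
  conclude (inj₁ refl) rewrite odd-+2* 0 q = refl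
  conclude (inj₂ refl) rewrite odd-+2* 0 q = refl

-- The cofactor doubles with each step and gains 1 where `double` subtracts the modulus.
power-congruent : ∀ e m → ∃[ c ] 2 ^ e ≡ power e m + suc m * c
power-congruent zero    m = 0 , cong suc (sym (*-zeroʳ m))
power-congruent (suc e) m with power-congruent e m
... | c , eq with <-≤-connex (power e m + power e m) (suc m)
... | inj₁ h rewrite eq | +-∸-assoc 1 (≤-pred h) = 2 * c , trans (solve x (suc m) c) (cong (λ z → x + x ∸ z + suc m * (2 * c))
        (sym (trans (cong (suc m *_) (0∸n≡0 (m ∸ (x + x)))) (*-zeroʳ (suc m)))))
  where
  x = power e m
  solve : ∀ x m c → x + m * c + (x + m * c + 0) ≡ x + x + m * (2 * c)
  solve = solve-∀
... | inj₂ h rewrite eq | m≤n⇒m∸n≡0 h = suc (2 * c) , trans (solve x (suc m) c)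
        (trans (cong (_+ suc m * (2 * c)) (sym (m∸n+n≡m h)))
          (trans (solve′ (x + x ∸ suc m) (suc m) c) (cong (λ z → x + x ∸ z + suc m * suc (2 * c)) (sym (*-identityʳ (suc m))))))
  where
  x = power e m
  solve : ∀ x m c → x + m * c + (x + m * c + 0) ≡ x + x + m * (2 * c)
  solve = solve-∀
  solve′ : ∀ d m c → d + m + m * (2 * c) ≡ d + m * suc (2 * c)
  solve′ = solve-∀

number : ℕ → (ℕ → Bool) → ℕ
number W f = weightedSum W (2 ^_) f

-- The Iverson bracket of a < b.
flag : ℕ → ℕ → ℕ
flag a b = 1 ∸ (suc a ∸ b)

flag-< : ∀ {a b} → a < b → flag a b ≡ 1
flag-< h = cong (1 ∸_) (m≤n⇒m∸n≡0 h)

flag-≥ : ∀ {a b} → b ≤ a → flag a b ≡ 0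
flag-≥ {a} {b} h = trans (cong (1 ∸_) (+-∸-assoc 1 h)) (0∸n≡0 (a ∸ b))

-- The integer part of 2 ^ p * (number W f / 2 ^ W).
leading : ℕ → ℕ → (ℕ → Bool) → ℕ
leading W p f = weightedSum W (λ q → flag W (suc (q + p)) * 2 ^ (q + p ∸ W)) f

-- `leading` with its powers of 2 replaced by representatives of size at most suc m, which
-- multiplicities of wires can afford.
reduced : ℕ → ℕ → ℕ → (ℕ → Bool) → ℕ
reduced m W p f = weightedSum W (λ q → flag W (suc (q + p)) * power (q + p ∸ W) m) f

sum-cong : ∀ {w u} n {f} → (∀ q → q < n → w q ≡ u q) → weightedSum n w f ≡ weightedSum n u f
sum-cong zero        h = refl
sum-cong (suc n) {f} h = cong₂ _+_ (sum-cong n (λ q l → h q (m≤n⇒m≤1+n l))) (cong (λ a → if f n then a else 0) (h n ≤-refl))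

sum-cong-bits : ∀ n {w f g} → (∀ i → i < n → f i ≡ g i) → weightedSum n w f ≡ weightedSum n w g
sum-cong-bits zero        h = refl
sum-cong-bits (suc n) {w} h = cong₂ _+_ (sum-cong-bits n (λ i l → h i (m≤n⇒m≤1+n l))) (cong (λ b → if b then w n else 0) (h n ≤-refl))

sum-linear : ∀ c w u n f → weightedSum n (λ q → u q + c * w q) f ≡ weightedSum n u f + c * weightedSum n w f
sum-linear c w u zero    f = sym (*-zeroʳ c)
sum-linear c w u (suc n) f rewrite sum-linear c w u n f with f n
... | true  = solve c (weightedSum n w f) (weightedSum n u f) (w n) (u n)
  where
  solve : ∀ c a b x y → b + c * a + (y + c * x) ≡ b + y + c * (a + x)
  solve = solve-∀
... | false = solve c (weightedSum n w f) (weightedSum n u f)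
  where
  solve : ∀ c a b → b + c * a + 0 ≡ b + 0 + c * (a + 0)
  solve = solve-∀

sum-≤ : ∀ w n f b → (∀ q → q < n → w q ≤ b) → weightedSum n w f ≤ n * b
sum-≤ w zero    f b h = z≤n
sum-≤ w (suc n) f b h = ≤-trans (+-mono-≤ (sum-≤ w n f b (λ q l → h q (m≤n⇒m≤1+n l))) (at (f n)))
  (≤-reflexive (+-comm (n * b) b))
  where
  at : ∀ c → (if c then w n else 0) ≤ b
  at true  = h n ≤-refl
  at false = z≤n

sum-zero : ∀ w n f → (∀ q → q < n → w q ≡ 0) → weightedSum n w f ≡ 0
sum-zero w n f h = n≤0⇒n≡0 (≤-trans (sum-≤ w n f 0 (λ q l → ≤-reflexive (h q l))) (≤-reflexive (*-zeroʳ n)))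

positive-sum : ∀ w n f → 0 < weightedSum n w f → ∃[ i ] (i < n × f i ≡ true)
positive-sum w (suc n) f h with f n in eq
... | true  = n , ≤-refl , eq
... | false with positive-sum w n f (subst (0 <_) (+-identityʳ _) h)
...   | i , l , t = i , m≤n⇒m≤1+n l , t

sum-positive : ∀ w n f i → i < n → f i ≡ true → 0 < w i → 0 < weightedSum n w f
sum-positive w (suc n) f i (s≤s l) t p with m≤n⇒m<n∨m≡n l
... | inj₁ l′   = ≤-trans (sum-positive w n f i l′ t p) (m≤m+n _ _)
... | inj₂ refl rewrite t = ≤-trans p (m≤n+m _ _)

-- The bit of `f` at W - 1 - p, or 0 if p ≥ W, that becomes visible with the next digit: the
-- difference of brackets is 1 just for q + p + 1 = W. As a weighted sum it can be compared with
-- `leading` term by term.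
carry : ℕ → ℕ → (ℕ → Bool) → ℕ
carry W p f = weightedSum W (λ q → flag W (suc (q + suc p)) ∸ flag W (suc (q + p))) f

carry≤1 : ∀ W p f → carry W p f ≤ 1
carry≤1 W p f = go W ≤-refl
  where
  w : ℕ → ℕ
  w q = flag W (suc (q + suc p)) ∸ flag W (suc (q + p))
  off : ∀ q → suc q + suc p ≤ W → w q ≡ 0
  off q h = trans (cong (_∸ flag W (suc (q + p))) (flag-≥ {W} {suc (q + suc p)} h)) (0∸n≡0 (flag W (suc (q + p))))
  on : ∀ q → W ≤ q + p → w q ≡ 0
  on q h = cong₂ _∸_ (flag-< {W} {suc (q + suc p)} (s≤s (≤-trans h (+-monoʳ-≤ q (n≤1+n p))))) (flag-< {W} {suc (q + p)} (s≤s h))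
  w≤1 : ∀ q → w q ≤ 1
  w≤1 q = ≤-trans (m∸n≤m _ (flag W (suc (q + p)))) (m∸n≤m 1 (suc W ∸ suc (q + suc p)))
  pick : ∀ n c → (if c then w n else 0) ≤ w n
  pick n true  = ≤-refl
  pick n false = z≤n
  go : ∀ n → n ≤ W → weightedSum n w f ≤ 1
  go zero    _ = z≤n
  go (suc n) h with <-≤-connex (n + p) W
  ... | inj₂ W≤ = +-mono-≤ {_} {1} {_} {0} (go n (<⇒≤ h)) (≤-trans (pick n (f n)) (≤-reflexive (on n W≤)))
  ... | inj₁ <W = +-mono-≤ {_} {0} {_} {1}
    (≤-reflexive (sum-zero w n f (λ q q<n → off q (≤-trans (≤-reflexive (cong suc (+-suc q p))) (≤-trans (s≤s (+-monoˡ-≤ p q<n)) <W)))))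
    (≤-trans (pick n (f n)) (w≤1 n))

-- Termwise: a visible bit doubles its weight, the bit with q + p + 1 = W enters with weight 1, and
-- the others stay at 0.
leading-suc : ∀ W p f → leading W (suc p) f ≡ carry W p f + 2 * leading W p f
leading-suc W p f = trans (sum-cong W λ q _ → step q) (sum-linear 2 (λ q → flag W (suc (q + p)) * 2 ^ (q + p ∸ W)) _ W f)
  where
  step : ∀ q → flag W (suc (q + suc p)) * 2 ^ (q + suc p ∸ W)
             ≡ (flag W (suc (q + suc p)) ∸ flag W (suc (q + p))) + 2 * (flag W (suc (q + p)) * 2 ^ (q + p ∸ W))
  step q rewrite +-suc q p with <-≤-connex (q + p) W
  ... | inj₂ W≤ rewrite flag-< {W} (s≤s W≤) | flag-< {W} {suc (suc (q + p))} (s≤s (m≤n⇒m≤1+n W≤)) | +-∸-assoc 1 W≤ =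
    trans (+-identityʳ _) (cong (2 *_) (sym (+-identityʳ (2 ^ (q + p ∸ W)))))
  ... | inj₁ <W with m≤n⇒m<n∨m≡n <W
  ...   | inj₁ l rewrite flag-≥ {W} {suc (suc (q + p))} l | flag-≥ {W} {suc (q + p)} <W = refl
  ...   | inj₂ refl rewrite flag-< {suc (q + p)} ≤-refl | flag-≥ {suc (q + p)} ≤-refl | n∸n≡0 (q + p) = refl

leading-0 : ∀ W f → leading W 0 f ≡ 0
leading-0 W f = sum-zero _ W f λ q q<W →
  cong (_* 2 ^ (q + 0 ∸ W)) (flag-≥ {W} (subst (_< W) (sym (+-identityʳ q)) q<W))

leading-all : ∀ W p f → W ≤ p → leading W p f ≡ number W f * 2 ^ (p ∸ W)
leading-all W p f h = trans (sum-cong W (λ q _ → at q)) (trans (sum-linear E (2 ^_) (λ _ → 0) W f)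
  (trans (cong (_+ E * number W f) (sum-zero (λ _ → 0) W f (λ _ _ → refl))) (*-comm E (number W f))))
  where
  E = 2 ^ (p ∸ W)
  at : ∀ q → flag W (suc (q + p)) * 2 ^ (q + p ∸ W) ≡ E * 2 ^ q
  at q rewrite flag-< {W} {suc (q + p)} (s≤s (≤-trans h (m≤n+m p q))) | +-∸-assoc q h =
    trans (+-identityʳ _) (trans (^-distribˡ-+-* 2 q (p ∸ W)) (*-comm (2 ^ q) E))

sum-congruent : ∀ n w u (f : ℕ → Bool) m → (∀ q → ∃[ c ] u q ≡ w q + m * c) →
  ∃[ c ] weightedSum n u f ≡ weightedSum n w f + m * c
sum-congruent n w u f m h = weightedSum n (proj₁ ∘ h) f , trans (sum-cong n (λ q _ → proj₂ (h q))) (sum-linear m (proj₁ ∘ h) w n f)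

reduced-congruent : ∀ m W p f → ∃[ c ] leading W p f ≡ reduced m W p f + suc m * c
reduced-congruent m W p f = sum-congruent W _ _ f (suc m) at
  where
  at : ∀ q → ∃[ c ] flag W (suc (q + p)) * 2 ^ (q + p ∸ W) ≡ flag W (suc (q + p)) * power (q + p ∸ W) m + suc m * c
  at q with power-congruent (q + p ∸ W) m
  ... | c , eq = flag W (suc (q + p)) * c , trans (cong (flag W (suc (q + p)) *_) eq) (solve (flag W (suc (q + p))) (power (q + p ∸ W) m) (suc m) c)
    where
    solve : ∀ a x m c → a * (x + m * c) ≡ a * x + m * (a * c)
    solve = solve-∀

-- The p-th binary digit after the point (p ≥ 1) of (number W f / 2 ^ W) / suc v.
quotientDigit : ℕ → ℕ → ℕ → (ℕ → Bool) → Bool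
quotientDigit v W p f = odd (leading W p f / suc v)

-- S / suc v equals the odd number 1 + 2 s, expressed without division so that a formula can state
-- it.
Between : ℕ → ℕ → ℕ → Set
Between v S s = (1 + 2 * s) * suc v ≤ S × S < (2 + 2 * s) * suc v

-- Only the sum modulo twice the divisor matters for the parity of a quotient.
quotientDigit-reduced : ∀ v W p f →
  (quotientDigit v W p f ≡ true → ∃[ s ] Between v (reduced (1 + 2 * v) W p f) s)
  × (∀ s → Between v (reduced (1 + 2 * v) W p f) s → quotientDigit v W p f ≡ true)
quotientDigit-reduced v W p f = to , from
  where
  -- The modulus is the successor of 1 + 2 v, that is, twice the divisor suc v.
  S = reduced (1 + 2 * v) W p f
  t = leading W p f
  c = proj₁ (reduced-congruent (1 + 2 * v) W p f)
  t≡ : t ≡ S + 2 * c * suc v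
  t≡ = trans (proj₂ (reduced-congruent (1 + 2 * v) W p f)) (solve S v c)
    where
    solve : ∀ S v c → S + (2 + 2 * v) * c ≡ S + 2 * c * suc v
    solve = solve-∀
  quotient : t / suc v ≡ S / suc v + 2 * c
  quotient = quotient-unique
    (≤-trans (≤-reflexive (*-distribʳ-+ (suc v) (S / suc v) (2 * c)))
      (≤-trans (+-monoˡ-≤ _ (m/n*n≤m S (suc v))) (≤-reflexive (sym t≡))))
    (≤-trans (s≤s (≤-reflexive t≡)) (≤-trans (+-monoˡ-≤ (2 * c * suc v) (m<[1+m/n]*n S (suc v)))
      (≤-reflexive (sym (*-distribʳ-+ (suc v) (suc (S / suc v)) (2 * c))))))
  digit : quotientDigit v W p f ≡ odd (S / suc v)
  digit = trans (cong odd quotient) (odd-+2* (S / suc v) c)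
  to : quotientDigit v W p f ≡ true → ∃[ s ] Between v S s
  to h with odd-half (S / suc v)
  ... | s , eq = s , subst (λ q → q * suc v ≤ S) q≡ (m/n*n≤m S (suc v)) , subst (λ q → S < suc q * suc v) q≡ (m<[1+m/n]*n S (suc v))
    where
    q≡ : S / suc v ≡ 1 + 2 * s
    q≡ = trans eq (cong (λ b → (if b then 1 else 0) + 2 * s) (trans (sym digit) h))
  from : ∀ s → Between v S s → quotientDigit v W p f ≡ true
  from s (l , u) = trans digit (trans (cong odd (quotient-unique {q = 1 + 2 * s} l u)) (odd-+2* 1 s))

module _ (α β : ℕ → ℕ) (x y : ℕ → Bool)
         (α₀ : α 0 ≡ β 0)
         (α-suc : ∀ p → α (suc p) ≡ (if x p then 1 else 0) + 2 * α p)
         (β-suc : ∀ p → β (suc p) ≡ (if y p then 1 else 0) + 2 * β p) where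

  Excess : ℕ → Set
  Excess p = x p ≡ true × y p ≡ false × (∀ q → q < p → x q ≡ y q)

  private
    Deficit : ℕ → Set
    Deficit p = x p ≡ false × y p ≡ true × (∀ q → q < p → x q ≡ y q)

    data Comparison (P : ℕ) : Set where
      equal   : α P ≡ β P → (∀ q → q < P → x q ≡ y q) → Comparison P
      greater : β P < α P → ∀ p → p < P → Excess p → Comparison P
      smaller : α P < β P → ∀ p → p < P → Deficit p → Comparison P

    -- Digits appended later cannot undo a strict inequality: a < b gives 2 a + 1 < 2 b.
    widen : ∀ {a b} i j → a < b → j ≤ 1 → j + 2 * a < i + 2 * b
    widen {a} i j h l = ≤-trans (s≤s (+-monoˡ-≤ (2 * a) l))
      (≤-trans (≤-trans (≤-reflexive (solve a)) (*-monoʳ-≤ 2 h)) (m≤n+m _ i))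
      where
      solve : ∀ a → 2 + 2 * a ≡ 2 * suc a
      solve = solve-∀

    bit≤1 : ∀ b → (if b then 1 else 0) ≤ 1
    bit≤1 true  = ≤-refl
    bit≤1 false = z≤n

    extend : ∀ P → (∀ q → q < P → x q ≡ y q) → x P ≡ y P → ∀ q → q < suc P → x q ≡ y q
    extend P e eq q (s≤s l) with m≤n⇒m<n∨m≡n l
    ... | inj₁ l′   = e q l′
    ... | inj₂ refl = eq

    comparison : ∀ P → Comparison P
    comparison zero    = equal α₀ (λ _ ())
    comparison (suc P) with comparison P
    ... | greater h p l e = greater (subst₂ _<_ (sym (β-suc P)) (sym (α-suc P)) (widen (if x P then 1 else 0) (if y P then 1 else 0) h (bit≤1 (y P)))) p (m≤n⇒m≤1+n l) e
    ... | smaller h p l e = smaller (subst₂ _<_ (sym (α-suc P)) (sym (β-suc P)) (widen (if y P then 1 else 0) (if x P then 1 else 0) h (bit≤1 (x P)))) p (m≤n⇒m≤1+n l) e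
    ... | equal h e with x P in xP | y P in yP | α-suc P | β-suc P
    ...   | true  | false | a | b = greater (subst₂ _<_ (sym b) (sym a) (s≤s (≤-reflexive (cong (2 *_) (sym h))))) P ≤-refl (xP , yP , e)
    ...   | false | true  | a | b = smaller (subst₂ _<_ (sym a) (sym b) (s≤s (≤-reflexive (cong (2 *_) h)))) P ≤-refl (xP , yP , e)
    ...   | true  | true  | a | b = equal (trans a (trans (cong (λ n → 1 + 2 * n) h) (sym b))) (extend P e (trans xP (sym yP)))
    ...   | false | false | a | b = equal (trans a (trans (cong (2 *_) h) (sym b))) (extend P e (trans xP (sym yP)))

  -- By induction on the number of digits, the first difference decides. The order is expressed by
  -- the absence of a first excess, which quantifiers over positions can state.
  lexicographic : ∀ P → (α P ≤ β P → ¬ (∃[ p ] (p < P × Excess p))) × (¬ (∃[ p ] (p < P × Excess p)) → α P ≤ β P)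
  lexicographic P with comparison P
  ... | equal h e = (λ _ (p , l , xt , yf , _) → not-¬ xt (trans (e p l) yf)) , λ _ → ≤-reflexive h
  ... | greater h p l e = (λ h′ _ → <⇒≱ h h′) , λ no → ⊥-elim (no (p , l , e))
  ... | smaller h p l (xf , yt , e) = (λ _ (p′ , l′ , e′) → first p′ e′) , λ _ → <⇒≤ h
    where
    first : ∀ p′ → Excess p′ → ⊥
    first p′ (xt , yf , e′) with <-cmp p p′
    ... | tri< l _ _    = not-¬ yt (trans (sym (e′ p l)) xf)
    ... | tri≈ _ refl _ = not-¬ xt xf
    ... | tri> _ _ l    = not-¬ xt (trans (e p′ l) yf)

-- Two fractions with denominators suc v and suc m differ by at least
-- 1 / (suc v * suc m), so enough binary digits of their quotients tell them apart.
quotients-compare : ∀ a b v m E → suc v * suc m ≤ E →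
  (a * suc m ≤ b * suc v → a * E / suc v ≤ b * E / suc m) × (a * E / suc v ≤ b * E / suc m → a * suc m ≤ b * suc v)
quotients-compare a b v m E large = to , from
  where
  q = a * E / suc v
  r = b * E / suc m
  to : a * suc m ≤ b * suc v → q ≤ r
  to h = ≤-pred (*-cancelʳ-< (suc m) q (suc r) (≤-<-trans qm≤bE (m<[1+m/n]*n (b * E) (suc m))))
    where
    qm≤bE : q * suc m ≤ b * E
    qm≤bE = *-cancelʳ-≤ _ _ (suc v) (≤-trans (≤-reflexive (solve₁ q (suc m) (suc v)))
      (≤-trans (*-monoˡ-≤ (suc m) (m/n*n≤m (a * E) (suc v)))
        (≤-trans (≤-reflexive (solve₁ a E (suc m))) (≤-trans (*-monoˡ-≤ E h) (≤-reflexive (solve₁ b (suc v) E))))))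
      where
      solve₁ : ∀ x y z → x * y * z ≡ x * z * y
      solve₁ = solve-∀
  from : q ≤ r → a * suc m ≤ b * suc v
  from h with <-≤-connex (b * suc v) (a * suc m)
  ... | inj₂ ok  = ok
  ... | inj₁ bad = ⊥-elim (<⇒≱ strict upper)
    where
    -- The failed inequality is one of integers, so it fails by at least 1, hence by `E` after
    -- scaling, and `E` is at least the product of the divisors.
    strict : b * E * suc v + suc v * suc m < suc (a * E * suc m)
    strict = s≤s (≤-trans (+-monoʳ-≤ (b * E * suc v) large)
      (≤-trans (≤-reflexive (solve b E (suc v))) (≤-trans (*-monoˡ-≤ E bad) (≤-reflexive (solve′ a E (suc m))))))
      where
      solve : ∀ b E v → b * E * v + E ≡ suc (b * v) * E
      solve = solve-∀
      solve′ : ∀ a E m → a * m * E ≡ a * E * m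
      solve′ = solve-∀
    upper : suc (a * E * suc m) ≤ b * E * suc v + suc v * suc m
    upper = ≤-trans (*-monoˡ-< (suc m) (m<[1+m/n]*n (a * E) (suc v)))
      (≤-trans (*-monoˡ-≤ (suc m) (*-monoˡ-≤ (suc v) (s≤s h)))
        (≤-trans (≤-reflexive (solve r (suc v) (suc m))) (+-monoˡ-≤ _ (*-monoˡ-≤ (suc v) (m/n*n≤m (b * E) (suc m))))))
      where
      solve : ∀ r v m → suc r * v * m ≡ r * m * v + v * m
      solve = solve-∀

-- The quotients of the leading parts start at 0 and gain a digit with each p. At P ≥ W they are the
-- quotients of the whole numbers scaled by 2 ^ (P ∸ W). Position p is digit p + 1, the first one
-- after the point.
digits-compare : ∀ W P f g v m → W ≤ P → suc v * suc m ≤ 2 ^ (P ∸ W) →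
  let Ex = λ p → quotientDigit v W (suc p) f ≡ true × quotientDigit m W (suc p) g ≡ false
                × (∀ q → q < p → quotientDigit v W (suc q) f ≡ quotientDigit m W (suc q) g)
  in (number W f * suc m ≤ number W g * suc v → ¬ (∃[ p ] (p < P × Ex p)))
     × (¬ (∃[ p ] (p < P × Ex p)) → number W f * suc m ≤ number W g * suc v)
digits-compare W P f g v m W≤P large =
  (λ h → proj₁ lex (subst₂ _≤_ (sym (last f v)) (sym (last g m)) (proj₁ cmp h))) ,
  (λ h → proj₂ cmp (subst₂ _≤_ (last f v) (last g m) (proj₂ lex h)))
  where
  E = 2 ^ (P ∸ W)
  quotient : ℕ → (ℕ → Bool) → ℕ → ℕ
  quotient v f p = leading W p f / suc v
  start : ∀ v f → quotient v f 0 ≡ 0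
  start v f = trans (cong (_/ suc v) (leading-0 W f)) (0/n≡0 (suc v))
  next : ∀ v f p → quotient v f (suc p) ≡ (if quotientDigit v W (suc p) f then 1 else 0) + 2 * quotient v f p
  next v f p = subst (λ t → t / suc v ≡ (if odd (t / suc v) then 1 else 0) + 2 * quotient v f p) (sym (leading-suc W p f))
    (quotient-double (leading W p f) (carry W p f) (suc v) (carry≤1 W p f))
  last : ∀ f v → quotient v f P ≡ number W f * E / suc v
  last f v = cong (_/ suc v) (leading-all W P f W≤P)
  cmp = quotients-compare (number W f) (number W g) v m E large
  lex = lexicographic (quotient v f) (quotient m g) _ _ (trans (start v f) (sym (start m g))) (next v f) (next m g) P

-- Meaning of formulas

ex all : Form → Form
ex φ  = most (lit 1) (lit 0) φ
all φ = neg (ex (neg φ))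

imp iff : Form → Form → Form
imp φ ψ = neg (φ and neg ψ)
iff φ ψ = imp φ ψ and imp ψ φ

-- Quantifiers always range below N; a bracket in the weights cuts them down to W.
sum-restrict : ∀ N W w f → W ≤ N → weightedSum N (λ q → flag q W * w q) f ≡ weightedSum W w f
sum-restrict N W w f W≤N = trans (cong (λ n → weightedSum n (λ q → flag q W * w q) f) (sym (m∸n+n≡m W≤N))) (go (N ∸ W))
  where
  within : ∀ n → n ≤ W → weightedSum n (λ q → flag q W * w q) f ≡ weightedSum n w f
  within n h = sum-cong n (λ q q<n → trans (cong (_* w q) (flag-< {q} {W} (<-≤-trans q<n h))) (+-identityʳ (w q)))
  go : ∀ k → weightedSum (k + W) (λ q → flag q W * w q) f ≡ weightedSum W w f
  go zero    = within W ≤-refl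
  go (suc k) = trans (cong₂ _+_ (go k) (vanish (f (k + W)))) (+-identityʳ _)
    where
    vanish : ∀ b → (if b then flag (k + W) W * w (k + W) else 0) ≡ 0
    vanish true  = cong (_* w (k + W)) (flag-≥ {k + W} {W} (m≤n+m W k))
    vanish false = refl

-- The digit p of the quotient of the W-bit fraction at offset off by suc v,
-- where variable 2 is W and d variables are in scope.
digitSum : ℕ → Exp → Exp → Exp → Exp → Form
digitSum d off v p t = most
  (isLess q (var 2) ⊗ (isLess (var 2) (lit 1 ⊕ (q ⊕ p)) ⊗ op pow ((q ⊕ p) ⊖ var 2) (lit 1 ⊕ lit 2 ⊗ v)))
  t (bitAt (off ⊕ q))
  where q = var (suc d)

-- Guesses the s of `Between`. As `most` is strict, subtracting 1 from the positive bounds turns it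
-- into a test for ≥.
digitForm : ℕ → Exp → Exp → Exp → Form
digitForm d off v p = ex (digitSum (suc d) off v p ((lit 1 ⊕ lit 2 ⊗ s) ⊗ (lit 1 ⊕ v) ⊖ lit 1)
                     and neg (digitSum (suc d) off v p ((lit 2 ⊕ lit 2 ⊗ s) ⊗ (lit 1 ⊕ v) ⊖ lit 1)))
  where s = var (suc d)

-- Expresses a (m + 1) ≤ b (v + 1) as a / (v + 1) ≤ b / (m + 1): no position is the first at which
-- the digits differ with the left one larger. `v` and `m` are predecessors of the divisors, which
-- excludes division by 0.
atMost : ℕ → (a b v m : Exp) → Form
atMost d a b v m = neg (ex (digitForm (1 + d) a v (lit 1 ⊕ p) and (neg (digitForm (1 + d) b m (lit 1 ⊕ p))
    and all (imp (less q p) (iff (digitForm (2 + d) a v (lit 1 ⊕ q)) (digitForm (2 + d) b m (lit 1 ⊕ q)))))))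
  where
  p = var (1 + d)
  q = var (2 + d)

-- Formulas and the propositions that they express

module Reflection (N : ℕ) (x : List Bool) (length-x : length x ≡ N) where

  open Circuits N
  open Truth x length-x

  X : ℕ → Bool
  X = nth false x

  -- Stated for all further variables `ts`, so that the meaning of a term persists under
  -- quantifiers.
  record Means (s : List ℕ) (e : Exp) (k : ℕ) : Set where
    constructor means
    field at : ∀ ts → ⟦ e ⟧ (ts ++ s) ≡ k

  record Ref (s : List ℕ) (φ : Form) (P : Set) : Set where
    constructor ref
    field
      sound    : truth s φ ≡ true → P
      complete : P → truth s φ ≡ true

  open Means public
  open Ref public

  private variable
    s : List ℕ
    φ ψ : Form
    P Q : Set
    e e′ : Exp
    a b k l : ℕ

  ≡ᵇ-> : ∀ {m n} → m < n → (m ≡ᵇ n) ≡ false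
  ≡ᵇ-> {zero}  {suc n} h       = refl
  ≡ᵇ-> {suc m} {suc n} (s≤s h) = ≡ᵇ-> h

  m-var : ∀ {y} → y ≤ length s → look N s y ≡ k → Means s (var y) k
  at (m-var {s} {y = y} h eq) ts = trans (weaken ts) eq
    where
    longer : ∀ ts → length s ≤ length (ts ++ s)
    longer []       = ≤-refl
    longer (_ ∷ ts) = m≤n⇒m≤1+n (longer ts)
    weaken : ∀ ts → look N (ts ++ s) y ≡ look N s y
    weaken []       = refl
    weaken (t ∷ ts) rewrite ≡ᵇ-> {y} {suc (length (ts ++ s))} (s≤s (≤-trans h (longer ts))) = weaken ts

  m-new : ∀ {i} → Means (i ∷ s) (var (suc (length s))) i
  m-new {s} {i} = m-var ≤-refl (look-last N i s)

  m-ext : ∀ {i} → Means s e k → Means (i ∷ s) e k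
  at (m-ext {s} {e} {i = i} h) ts = trans (cong ⟦ e ⟧ (sym (++-assoc ts (i ∷ []) s))) (at h (ts ++ i ∷ []))

  m-lit : ∀ {c} → Means s (lit c) c
  at m-lit ts = refl

  m-op : ∀ {o} → Means s e a → Means s e′ b → Means s (op o e e′) (apply o a b)
  at (m-op {o = o} h h′) ts = cong₂ (apply o) (at h ts) (at h′ ts)

  r-map : (P → Q) → (Q → P) → Ref s φ P → Ref s φ Q
  r-map f g r = ref (f ∘ sound r) (complete r ∘ g)

  r-bit : Means s e k → Ref s (bitAt e) (X k ≡ true)
  r-bit h = ref (trans (cong X (sym (at h [])))) (trans (cong X (at h [])))

  <ᵇ-sound : (a <ᵇ b) ≡ true → a < b
  <ᵇ-sound {zero}  {suc b} h = s≤s z≤n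
  <ᵇ-sound {suc a} {suc b} h = s≤s (<ᵇ-sound h)

  r-less : Means s e a → Means s e′ b → Ref s (less e e′) (a < b)
  r-less h h′ = ref (λ t → subst₂ _<_ (at h []) (at h′ []) (<ᵇ-sound t))
                    (λ l → <ᵇ-true (subst₂ _<_ (sym (at h [])) (sym (at h′ [])) l))

  not-true : ∀ {c} → not c ≡ true → c ≢ true
  not-true {true} ()

  r-neg : Ref s φ P → Ref s (neg φ) (¬ P)
  r-neg {s} {φ} r = ref (λ t p → not-true t (complete r p)) back
    where
    back : _ → not (truth s φ) ≡ true
    back np with truth s φ in eq
    ... | true  = ⊥-elim (np (sound r eq))
    ... | false = refl

  -- The second formula is interpreted under the assumption of the first: formulas about the matrix
  -- or the threshold express what they should only for words of the right shape.
  r-and : Ref s φ P → (P → Ref s ψ Q) → Ref s (φ and ψ) (P × Q)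
  sound (r-and {s} {φ} r r′) t with truth s φ in eq
  ... | true = sound r eq , sound (r′ (sound r eq)) t
  complete (r-and r r′) (p , q) rewrite complete r p = complete (r′ p) q

  r-imp : Ref s φ P → (P → Ref s ψ Q) → Ref s (imp φ ψ) (P → Q)
  sound (r-imp {s} {φ} {ψ = ψ} r r′) t p rewrite complete r p with truth s ψ in eq
  ... | true = sound (r′ p) eq
  complete (r-imp {s} {φ} {ψ = ψ} r r′) f with truth s φ in eq
  ... | false = refl
  ... | true  rewrite complete (r′ (sound r eq)) (f (sound r eq)) = refl

  r-iff : Ref s φ P → Ref s ψ Q → Ref s (iff φ ψ) ((P → Q) × (Q → P))
  r-iff r r′ = r-and (r-imp r (λ _ → r′)) (λ _ → r-imp r′ (λ _ → r))

  r-most : ∀ {w t} (u : ℕ → ℕ) (f : ℕ → Bool) → (∀ i → Means (i ∷ s) w (u i)) → Means s t k →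
           (∀ i → i < N → truth (i ∷ s) φ ≡ f i) → Ref s (most w t φ) (k < weightedSum N u f)
  r-most {s} {k} {φ} {w} {t} u f hw ht hf =
    ref (λ h → subst₂ _<_ (at ht []) eq (<ᵇ-sound h)) (λ h → <ᵇ-true (subst₂ _<_ (sym (at ht [])) (sym eq) h))
    where
    eq : weightedSum N (λ i → ⟦ w ⟧ (i ∷ s)) (λ i → truth (i ∷ s) φ) ≡ weightedSum N u f
    eq = trans (sum-cong N (λ i _ → at (hw i) [])) (sum-cong-bits N hf)

  r-ex : {P : ℕ → Set} → (∀ i → i < N → Ref (i ∷ s) φ (P i)) → Ref s (ex φ) (∃[ i ] (i < N × P i))
  sound (r-ex {s} {φ} r) t =
    let i , l , h = positive-sum (λ _ → 1) N (λ i → truth (i ∷ s) φ) (<ᵇ-sound t) in i , l , sound (r i l) h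
  complete (r-ex {s} {φ} r) (i , l , p) = <ᵇ-true (sum-positive (λ _ → 1) N (λ i → truth (i ∷ s) φ) i l (complete (r i l) p) ≤-refl)

  r-all : {P : ℕ → Set} → (∀ i → i < N → Ref (i ∷ s) φ (P i)) → Ref s (all φ) (∀ i → i < N → P i)
  r-all {s} {φ} {P} r = r-map to from (r-neg (r-ex (λ i l → r-neg (r i l))))
    where
    to : ¬ (∃[ i ] (i < N × ¬ P i)) → ∀ i → i < N → P i
    -- Double negation may be eliminated because the truth value is a boolean.
    to none i l with truth (i ∷ s) φ in eq
    ... | true  = sound (r i l) eq
    ... | false = ⊥-elim (none (i , l , λ p → not-¬ (complete (r i l) p) eq))
    from : (∀ i → i < N → P i) → ¬ (∃[ i ] (i < N × ¬ P i))
    from f (i , l , np) = np (f i l)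

  module _ {W : ℕ} (W≤N : W ≤ N) where

    r-digitSum : ∀ {off v p t o n j} → Means s (var 2) W → Means s off o → Means s v n → Means s p j → Means s t k →
      Ref s (digitSum (length s) off v p t) (k < reduced (1 + 2 * n) W j (λ q → X (o + q)))
    r-digitSum {s} {k} {off = off} {o = o} {n} {j} hW ho hv hp ht =
      r-map (subst (k <_) eq) (subst (k <_) (sym eq))
        (r-most _ _ (λ q → m-op (m-op m-lit (m-op (m-op m-lit m-new) (m-ext hW)))
            (m-op (m-op m-lit (m-op (m-op m-lit (m-ext hW)) (m-op m-lit (m-op m-new (m-ext hp)))))
                  (m-op (m-op (m-op m-new (m-ext hp)) (m-ext hW)) (m-op m-lit (m-op m-lit (m-ext hv))))))
          ht
          (λ q _ → cong X (at (m-op {o = add} (m-ext {e = off} {i = q} ho) m-new) [])))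
      where
      eq = sum-restrict N W (λ q → flag W (suc (q + j)) * power (q + j ∸ W) (1 + 2 * n)) (λ q → X (o + q)) W≤N

    r-digit : ∀ {off v p o n j} → Means s (var 2) W → Means s off o → Means s v n → Means s p j →
      Ref s (digitForm (length s) off v p) (quotientDigit n W j (λ q → X (o + q)) ≡ true)
    r-digit {s} {off} {v} {p} {o} {n} {j} hW ho hv hp = r-map to from
      (r-ex (λ i _ → r-and
        (r-digitSum (m-ext hW) (m-ext ho) (m-ext hv) (m-ext hp)
          (m-op (m-op (m-op m-lit (m-op m-lit m-new)) (m-op m-lit (m-ext hv))) m-lit))
        (λ _ → r-neg (r-digitSum (m-ext hW) (m-ext ho) (m-ext hv) (m-ext hp)
          (m-op (m-op (m-op m-lit (m-op m-lit m-new)) (m-op m-lit (m-ext hv))) m-lit)))))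
      where
      f : ℕ → Bool
      f q = X (o + q)
      S = reduced (1 + 2 * n) W j f
      S≤ : S ≤ W * (2 * suc n)
      S≤ = sum-≤ _ W f (2 * suc n) (λ q _ →
        ≤-trans (*-mono-≤ (m∸n≤m 1 (suc W ∸ suc (q + j))) (power≤ (q + j ∸ W) (1 + 2 * n))) (≤-reflexive (solve n)))
        where
        solve : ∀ n → 1 * suc (1 + 2 * n) ≡ 2 * suc n
        solve = solve-∀
      -- The quantifier of the sentence reaches the required s: the reduced sum is at most 2 W times
      -- the divisor, so an odd quotient 1 + 2 s has s < W ≤ N.
      small : ∀ i → (1 + 2 * i) * suc n ≤ S → i < N
      small i h = <-≤-trans (*-cancelˡ-< 2 i W (*-cancelʳ-< (suc n) (2 * i) (2 * W)
        (≤-trans (*-monoˡ-< (suc n) (n<1+n (2 * i))) (≤-trans h (≤-trans S≤ (≤-reflexive (solve W n))))))) W≤N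
        where
        solve : ∀ W n → W * (2 * suc n) ≡ 2 * W * suc n
        solve = solve-∀
      to : ∃[ i ] (i < N × (1 + 2 * i) * suc n ≤ S × ¬ (2 + 2 * i) * suc n ≤ S) → quotientDigit n W j f ≡ true
      to (i , _ , l , u) = proj₂ (quotientDigit-reduced n W j f) i (l , ≰⇒> u)
      from : quotientDigit n W j f ≡ true → ∃[ i ] (i < N × (1 + 2 * i) * suc n ≤ S × ¬ (2 + 2 * i) * suc n ≤ S)
      from h = let i , l , u = proj₁ (quotientDigit-reduced n W j f) h in i , small i l , l , <⇒≱ u

    r-atMost : ∀ {offa offb ve me oa ob v m} → Means s (var 2) W → Means s offa oa → Means s offb ob →
      Means s ve v → Means s me m → suc v * suc m ≤ 2 ^ (N ∸ W) →
      Ref s (atMost (length s) offa offb ve me)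
            (number W (λ q → X (oa + q)) * suc m ≤ number W (λ q → X (ob + q)) * suc v)
    r-atMost {oa = oa} {ob} {v} {m} hW ha hb hv hm large = r-map (proj₂ cmp) (proj₁ cmp) (r-neg (r-ex λ p p<N →
        r-map (λ (a , b , c) → a , ¬-not b , agreement p p<N c)
              (λ (a , b , c) → a , (λ t → not-¬ t b) , λ q _ l → trans (sym (c q l)) , trans (c q l))
          (r-and (r-digit (m-ext hW) (m-ext ha) (m-ext hv) (m-op m-lit m-new)) λ _ →
           r-and (r-neg (r-digit (m-ext hW) (m-ext hb) (m-ext hm) (m-op m-lit m-new))) λ _ →
           r-all λ q _ → r-imp (r-less m-new (m-ext m-new)) λ _ →
             r-iff (r-digit (m-ext (m-ext hW)) (m-ext (m-ext ha)) (m-ext (m-ext hv)) (m-op m-lit m-new))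
                   (r-digit (m-ext (m-ext hW)) (m-ext (m-ext hb)) (m-ext (m-ext hm)) (m-op m-lit m-new)))))
      where
      f g : ℕ → Bool
      f q = X (oa + q)
      g q = X (ob + q)
      cmp = digits-compare W N f g v m W≤N large
      same : ∀ {c d} → (c ≡ true → d ≡ true) × (d ≡ true → c ≡ true) → c ≡ d
      same {true}  (h , _) = sym (h refl)
      same {false} {true}  (_ , h) = h refl
      same {false} {false} _ = refl
      agreement : ∀ p → p < N → (∀ q → q < N → q < p →
          (quotientDigit v W (suc q) f ≡ true → quotientDigit m W (suc q) g ≡ true)
          × (quotientDigit m W (suc q) g ≡ true → quotientDigit v W (suc q) f ≡ true)) →
        ∀ q → q < p → quotientDigit v W (suc q) f ≡ quotientDigit m W (suc q) g
      agreement p p<N h q l = same (h q (<-trans l p<N) l)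

-- The sentence for the support problem

-- Variables 1, 2 and 3 are the number m of tuples, the width W of a and b
-- and the number n of attributes. They are followed by the chosen columns.
#rows #width #columns : Exp
#rows    = var 1
#width   = var 2
#columns = var 3

-- The 3 counts the zeros that end the three unary numbers.
matrixStart aStart bStart inputEnd : Exp
matrixStart = lit 3 ⊕ #rows ⊕ #columns ⊕ #width
aStart      = matrixStart ⊕ #rows ⊗ #columns
bStart      = aStart ⊕ #width
inputEnd    = bStart ⊕ #width

unaryForm : ℕ → Exp → Exp → Form
unaryForm d off len = all (imp (less v len) (bitAt (off ⊕ v))) and neg (bitAt (off ⊕ len))
  where v = var (suc d)

shapeForm : Form
shapeForm = (neg (less inputEnd size#) and neg (less size# inputEnd))
  and unaryForm 3 (lit 0) #rows
  and unaryForm 3 (lit 1 ⊕ #rows) #columns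
  and unaryForm 3 (lit 2 ⊕ #rows ⊕ #columns) #width
  -- Gives m ≤ m n, so that the word has at least 2 m + W bits and N digits decide the comparison of
  -- quotients.
  and less (lit 0) #columns

cellForm : Exp → Exp → Form
cellForm i j = bitAt (matrixStart ⊕ i ⊗ #columns ⊕ j)

nontrivialForm : ℕ → Form
nontrivialForm x = ex (less (var (suc x)) #rows and neg (cellForm (var (suc x)) (var x)))

rowForm : Exp → ℕ → Form
rowForm i zero    = less (lit 0) (lit 1)
rowForm i (suc l) = cellForm i (var (suc (l + 3))) and rowForm i l

-- Here v + 1 is at most the number of matching rows. Any such v suffices, as b (v + 1) only grows
-- with v. The weight restricts the rows to those below m.
supportForm : ℕ → ℕ → Form
supportForm K d = ex (most (isLess (var (2 + d)) #rows) (var (1 + d)) (rowForm (var (2 + d)) K)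
                      and atMost (1 + d) aStart bStart (var (1 + d)) (#rows ⊖ lit 1))

-- Decreasing order makes the columns distinct. The bound of each is the variable before it; for the
-- first one this is variable 3, the number of columns, which is why that number is quantified last
-- of the three.
chooseForm : ℕ → ℕ → ℕ → Form
chooseForm K zero    d = supportForm K d
chooseForm K (suc r) d = ex (less (var (suc d)) (var d) and nontrivialForm (suc d) and chooseForm K r (suc d))

-- The threshold is positive if a has a bit 1, and at most 1 by the digit comparison with both
-- divisors equal to 1. Together these also make b positive.
sentence : ℕ → Form
sentence K = ex (ex (ex (shapeForm
  and ex (less (var 4) #width and bitAt (aStart ⊕ var 4))
  and atMost 3 aStart bStart (lit 0) (lit 0)
  and chooseForm K K 3)))

module Meaning (N : ℕ) (X : ℕ → Bool) (K : ℕ) where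

  Unary : ℕ → ℕ → Set
  Unary o l = (∀ p → p < N → p < l → X (o + p) ≡ true) × ¬ X (o + l) ≡ true

  module _ (m W n : ℕ) where

    start startᵃ startᵇ wordLength : ℕ
    start  = 3 + m + n + W
    startᵃ = start + m * n
    startᵇ = startᵃ + W
    wordLength = startᵇ + W

    Shape : Set
    Shape = (¬ wordLength < N × ¬ N < wordLength) × Unary 0 m × Unary (1 + m) n × Unary (2 + m + n) W × 0 < n

    cell : ℕ → ℕ → Bool
    cell i j = X (start + i * n + j)

    numberᵃ numberᵇ : ℕ
    numberᵃ = number W (λ q → X (startᵃ + q))
    numberᵇ = number W (λ q → X (startᵇ + q))

    Nontrivial : ℕ → Set
    Nontrivial j = ∃[ i ] (i < N × i < m × ¬ cell i j ≡ true)

    row : List ℕ → ℕ → Bool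
    row []       i = true
    row (j ∷ js) i = cell i j ∧ row js i

    matching : List ℕ → ℕ
    matching js = weightedSum m (λ _ → 1) (row js)

    Supported : List ℕ → Set
    Supported js = ∃[ v ] (v < N × v < matching js × numberᵃ * suc (m ∸ 1) ≤ numberᵇ * suc v)

    last : List ℕ → ℕ
    last []      = n
    last (j ∷ _) = j

    Chosen : ℕ → List ℕ → Set
    Chosen zero    js = Supported js
    Chosen (suc r) js = ∃[ j ] (j < N × j < last js × Nontrivial j × Chosen r (j ∷ js))

    Positive : Set
    Positive = ∃[ q ] (q < N × q < W × X (startᵃ + q) ≡ true)

  Accept : Set
  Accept = ∃[ m ] (m < N × ∃[ W ] (W < N × ∃[ n ] (n < N ×
    Shape m W n × Positive m W n × numberᵃ m W n * 1 ≤ numberᵇ m W n * 1 × Chosen m W n K [])))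

-- The sentence expresses acceptance

module _ (N : ℕ) (x : List Bool) (length-x : length x ≡ N) (K : ℕ) where

  open Circuits N
  open Truth x length-x
  open Reflection N x length-x
  open Meaning N (nth false x) K

  module _ {m W n : ℕ} where

    private
      base₃ : List ℕ
      base₃ = n ∷ W ∷ m ∷ []

    m-rows : ∀ ts → Means (ts ++ base₃) #rows m
    m-rows []       = m-var (s≤s z≤n) refl
    m-rows (_ ∷ ts) = m-ext (m-rows ts)

    m-width : ∀ ts → Means (ts ++ base₃) #width W
    m-width []       = m-var (s≤s (s≤s z≤n)) refl
    m-width (_ ∷ ts) = m-ext (m-width ts)

    m-columns : ∀ ts → Means (ts ++ base₃) #columns n
    m-columns []       = m-var (s≤s (s≤s (s≤s z≤n))) refl
    m-columns (_ ∷ ts) = m-ext (m-columns ts)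

    m-start : ∀ ts → Means (ts ++ base₃) matrixStart (start m W n)
    m-start ts = m-op (m-op (m-op m-lit (m-rows ts)) (m-columns ts)) (m-width ts)

    m-aStart : ∀ ts → Means (ts ++ base₃) aStart (startᵃ m W n)
    m-aStart ts = m-op (m-start ts) (m-op (m-rows ts) (m-columns ts))

    m-bStart : ∀ ts → Means (ts ++ base₃) bStart (startᵇ m W n)
    m-bStart ts = m-op (m-aStart ts) (m-width ts)

    m-end : ∀ ts → Means (ts ++ base₃) inputEnd (wordLength m W n)
    m-end ts = m-op (m-bStart ts) (m-width ts)

    m-size : ∀ {s} → Means s size# N
    m-size {s} = means λ ts → look-size N (ts ++ s)

    r-unary : ∀ {s off len o l} → Means s off o → Means s len l → Ref s (unaryForm (length s) off len) (Unary o l)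
    r-unary ho hl = r-and (r-all λ p _ → r-imp (r-less m-new (m-ext hl)) λ _ → r-bit (m-op (m-ext ho) m-new))
                          λ _ → r-neg (r-bit (m-op ho hl))

    r-shape : Ref base₃ shapeForm (Shape m W n)
    r-shape = r-and (r-and (r-neg (r-less (m-end []) m-size)) λ _ → r-neg (r-less m-size (m-end []))) λ _ →
      r-and (r-unary m-lit (m-rows [])) λ _ →
      r-and (r-unary (m-op m-lit (m-rows [])) (m-columns [])) λ _ →
      r-and (r-unary (m-op (m-op m-lit (m-rows [])) (m-columns [])) (m-width [])) λ _ →
      r-less m-lit (m-columns [])

    m-cell : ∀ {i j ie je} ts → Means (ts ++ base₃) ie i → Means (ts ++ base₃) je j →
             Means (ts ++ base₃) (matrixStart ⊕ ie ⊗ #columns ⊕ je) (start m W n + i * n + j)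
    m-cell ts hi hj = m-op (m-op (m-start ts) (m-op hi (m-columns ts))) hj

    m-last : ∀ js → Means (js ++ base₃) (var (length (js ++ base₃))) (last m W n js)
    m-last []       = m-columns []
    m-last (j ∷ js) = m-new

    r-nontrivial : ∀ js j → Ref (j ∷ js ++ base₃) (nontrivialForm (suc (length (js ++ base₃)))) (Nontrivial m W n j)
    r-nontrivial js j = r-ex λ i _ → r-and (r-less m-new (m-rows (i ∷ j ∷ js))) λ _ →
      r-neg (r-bit (m-cell (i ∷ j ∷ js) m-new (m-ext m-new)))

    truth-row : ∀ {ie i} ts js → Means (ts ++ js ++ base₃) ie i →
      truth (ts ++ js ++ base₃) (rowForm ie (length js)) ≡ row m W n js i
    truth-row ts []       hi = refl
    truth-row {ie} {i} ts (j ∷ js) hi = cong₂ _∧_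
      (cong X (at (subst (λ s → Means s (matrixStart ⊕ ie ⊗ #columns ⊕ var (suc (length js + 3))) (start m W n + i * n + j)) (++-assoc ts (j ∷ js) base₃)
        (m-cell (ts ++ j ∷ js) (subst (λ s → Means s ie i) (sym (++-assoc ts (j ∷ js) base₃)) hi)
          (subst (λ s → Means s (var (suc (length js + 3))) j) (sym (++-assoc ts (j ∷ js) base₃)) (exts ts column)))) []))
      (trans (cong (λ s → truth s (rowForm ie (length js))) (sym (++-assoc ts (j ∷ []) (js ++ base₃))))
        (truth-row (ts ++ j ∷ []) js (subst (λ s → Means s ie i) (sym (++-assoc ts (j ∷ []) (js ++ base₃))) hi)))
      where
      column : Means (j ∷ js ++ base₃) (var (suc (length js + 3))) j
      column = subst (λ l → Means (j ∷ js ++ base₃) (var (suc l)) j) (length-++ js) m-new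
      exts : ∀ {s e k} ts → Means s e k → Means (ts ++ s) e k
      exts []       h = h
      exts (_ ∷ ts) h = m-ext (exts ts h)

    module _ (shape : Shape m W n) where

      private
        total≡N : wordLength m W n ≡ N
        total≡N = ≤-antisym (≮⇒≥ (proj₂ (proj₁ shape))) (≮⇒≥ (proj₁ (proj₁ shape)))

        0<n : 0 < n
        0<n = proj₂ (proj₂ (proj₂ (proj₂ shape)))

        m+m+W≤N : m + m + W ≤ N
        m+m+W≤N = ≤-trans (+-monoˡ-≤ W (+-monoʳ-≤ m (≤-trans (≤-reflexive (sym (*-identityʳ m))) (*-monoʳ-≤ m 0<n))))
          (≤-trans (m≤n+m _ (3 + n + W + W)) (≤-reflexive (trans (solve m n W (m * n)) total≡N)))
          where
          solve : ∀ m n W k → (3 + n + W + W) + (m + k + W) ≡ 3 + m + n + W + k + W + W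
          solve = solve-∀

        W≤N : W ≤ N
        W≤N = ≤-trans (m≤n+m W (m + m)) m+m+W≤N

        m≤N : m ≤ N
        m≤N = ≤-trans (≤-trans (m≤m+n m m) (m≤m+n (m + m) W)) m+m+W≤N

      -- Both factors are at most m < 2 ^ m, and 2 m + W ≤ N.
      enough-digits : ∀ {v} → v < m → suc v * suc (m ∸ 1) ≤ 2 ^ (N ∸ W)
      enough-digits {v} v<m = ≤-trans (*-mono-≤ v<m (≤-reflexive (m+[n∸m]≡n {1} (≤-trans (s≤s z≤n) v<m))))
        (≤-trans (*-mono-≤ (<⇒≤ (m<2^m m)) (<⇒≤ (m<2^m m)))
          (≤-trans (≤-reflexive (sym (^-distribˡ-+-* 2 m m)))
            (^-monoʳ-≤ 2 (≤-trans (≤-reflexive (sym (m+n∸n≡m (m + m) W))) (∸-monoˡ-≤ W m+m+W≤N)))))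

      matching≤m : ∀ js → matching m W n js ≤ m
      matching≤m js = ≤-trans (sum-≤ (λ _ → 1) m (row m W n js) 1 (λ _ _ → ≤-refl)) (≤-reflexive (*-identityʳ m))

      r-support : ∀ js → length js ≡ K → Ref (js ++ base₃) (supportForm K (length (js ++ base₃))) (Supported m W n js)
      r-support js refl = r-ex λ v _ → r-and
        (r-map (subst (v <_) eq) (subst (v <_) (sym eq))
          (r-most (λ i → flag i m) (row m W n js) (λ i → m-op m-lit (m-op (m-op m-lit m-new) (m-rows (i ∷ v ∷ js)))) m-new
            (λ i _ → truth-row (i ∷ v ∷ []) js m-new)))
        -- The first conjunct bounds v by m, without which N digits need not decide the comparison.
        λ v< → r-atMost W≤N (m-width (v ∷ js)) (m-aStart (v ∷ js)) (m-bStart (v ∷ js)) m-new (m-op (m-rows (v ∷ js)) m-lit)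
                 (enough-digits (<-≤-trans v< (matching≤m js)))
        where
        eq : weightedSum N (λ i → flag i m) (row m W n js) ≡ matching m W n js
        eq = trans (sum-cong N (λ i _ → sym (*-identityʳ (flag i m)))) (sum-restrict N m (λ _ → 1) (row m W n js) m≤N)

      r-choose : ∀ r js → length js + r ≡ K → Ref (js ++ base₃) (chooseForm K r (length (js ++ base₃))) (Chosen m W n r js)
      r-choose zero    js eq = r-support js (trans (sym (+-identityʳ _)) eq)
      r-choose (suc r) js eq = r-ex λ j _ → r-and (r-less m-new (m-ext (m-last js))) λ _ →
        r-and (r-nontrivial js j) λ _ → r-choose r (j ∷ js) (trans (sym (+-suc (length js) r)) eq)

      r-conditions : Ref base₃ (ex (less (var 4) #width and bitAt (aStart ⊕ var 4)) and atMost 3 aStart bStart (lit 0) (lit 0) and chooseForm K K 3)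
        (Positive m W n × numberᵃ m W n * 1 ≤ numberᵇ m W n * 1 × Chosen m W n K [])
      r-conditions = r-and (r-ex λ q _ → r-and (r-less m-new (m-width (q ∷ []))) λ _ → r-bit (m-op (m-aStart (q ∷ [])) m-new)) λ _ →
        r-and (r-atMost W≤N (m-width []) (m-aStart []) (m-bStart []) m-lit m-lit (m^n>0 2 (N ∸ W))) λ _ →
        r-choose K [] refl

  r-sentence : Ref [] (sentence K) Accept
  r-sentence = r-ex λ m _ → r-ex λ W _ → r-ex λ n _ → r-and r-shape r-conditions

-- Encoded instances

fraction-≤ : ∀ {a b c d} .{{_ : NonZero b}} .{{_ : NonZero d}} → a * d ≤ c * b → (pos a) /ℚ b ≤ℚ (pos c) /ℚ d
fraction-≤ {a} {suc b} {c} {suc d} h = ℚₚ.toℚᵘ-cancel-≤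
  (ℚᵘₚ.≤-respʳ-≃ (ℚᵘₚ.≃-sym (ℚₚ.toℚᵘ-fromℚᵘ (mkℚᵘ (pos c) d)))
    (ℚᵘₚ.≤-respˡ-≃ (ℚᵘₚ.≃-sym (ℚₚ.toℚᵘ-fromℚᵘ (mkℚᵘ (pos a) b)))
      (*≤* (subst₂ ℤ._≤_ (ℤₚ.pos-* a (suc d)) (ℤₚ.pos-* c (suc b)) (+≤+ h)))))

≤-fraction : ∀ {a b c d} .{{_ : NonZero b}} .{{_ : NonZero d}} → (pos a) /ℚ b ≤ℚ (pos c) /ℚ d → a * d ≤ c * b
≤-fraction {a} {suc b} {c} {suc d} h
  with ℚᵘₚ.≤-respʳ-≃ (ℚₚ.toℚᵘ-fromℚᵘ (mkℚᵘ (pos c) d)) (ℚᵘₚ.≤-respˡ-≃ (ℚₚ.toℚᵘ-fromℚᵘ (mkℚᵘ (pos a) b)) (ℚₚ.toℚᵘ-mono-≤ h))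
... | *≤* l = ℤₚ.drop‿+≤+ (subst₂ ℤ._≤_ (sym (ℤₚ.pos-* a (suc d))) (sym (ℤₚ.pos-* c (suc b))) l)

sum-shift : ∀ n w f → weightedSum (suc n) w f ≡ (if f 0 then w 0 else 0) + weightedSum n (w ∘ suc) (f ∘ suc)
sum-shift zero    w f = sym (+-identityʳ _)
sum-shift (suc n) w f = trans (cong (_+ (if f (suc n) then w (suc n) else 0)) (sum-shift n w f)) (+-assoc (if f 0 then w 0 else 0) _ _)

number-suc : ∀ W f → number (suc W) f ≡ (if f 0 then 1 else 0) + 2 * number W (f ∘ suc)
number-suc W f = trans (sum-shift W (2 ^_) f) (cong (λ z → (if f 0 then 1 else 0) + z)
  (trans (sum-linear 2 (2 ^_) (λ _ → 0) W (f ∘ suc)) (cong (_+ 2 * number W (f ∘ suc)) (sum-zero (λ _ → 0) W (f ∘ suc) (λ _ _ → refl)))))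

number-binary : ∀ {W} (v : Vec Bool W) → number W (nth false (toList v)) ≡ binary v
number-binary []                  = refl
number-binary {suc W} (true ∷ v)  = trans (number-suc W (nth false (toList (true ∷ v)))) (cong (λ n → 1 + 2 * n) (number-binary v))
number-binary {suc W} (false ∷ v) = trans (number-suc W (nth false (toList (false ∷ v)))) (cong (2 *_) (number-binary v))

length-unary : ∀ m → length (unary m) ≡ suc m
length-unary zero    = refl
length-unary (suc m) = cong suc (length-unary m)

nth-unary : ∀ m p {zs} → p < m → nth false (unary m ++ zs) p ≡ true
nth-unary (suc m) zero    h       = refl
nth-unary (suc m) (suc p) (s≤s h) = nth-unary m p h

nth-unary-end : ∀ m {zs} → nth false (unary m ++ zs) m ≡ false
nth-unary-end zero    = refl
nth-unary-end (suc m) = nth-unary-end m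

bitsOf : ∀ {n} (S : Schema n) → Tuple S → List Bool
bitsOf S t = tabulate (λ j → is-just (t j))

length-bitsOf : ∀ {n} (S : Schema n) t → length (bitsOf S t) ≡ n
length-bitsOf S t = length-tabulate (λ j → is-just (t j))

length-rows : ∀ {n} (S : Schema n) (T : Database S) → length (concatMap (bitsOf S) T) ≡ length T * n
length-rows S []      = refl
length-rows S (t ∷ T) = trans (length-++ (bitsOf S t)) (cong₂ _+_ (length-bitsOf S t) (length-rows S T))

has : ∀ {n} (S : Schema n) → ℕ → Tuple S → Bool
has S j t = nth false (bitsOf S t) j

hasAll : ∀ {n} (S : Schema n) → List ℕ → Tuple S → Bool
hasAll S []       t = true
hasAll S (j ∷ js) t = has S j t ∧ hasAll S js t

nth-rows : ∀ {n} (S : Schema n) (T : Database S) zs i j → i < length T → j < n →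
           nth false (concatMap (bitsOf S) T ++ zs) (i * n + j) ≡ nth false (map (has S j) T) i
nth-rows S (t ∷ T) zs zero j h l =
  trans (cong (λ ys → nth false ys j) (++-assoc (bitsOf S t) (concatMap (bitsOf S) T) zs))
    (nth-++ˡ (bitsOf S t) (subst (j <_) (sym (length-bitsOf S t)) l))
nth-rows {n} S (t ∷ T) zs (suc i) j (s≤s h) l =
  trans (cong₂ (nth false) (++-assoc (bitsOf S t) (concatMap (bitsOf S) T) zs)
          (trans (+-assoc n (i * n) j) (cong (_+ (i * n + j)) (sym (length-bitsOf S t)))))
    (trans (nth-++ʳ (bitsOf S t) (i * n + j)) (nth-rows S T zs i j h l))

nth-tabulate : ∀ {n} (f : Fin n → Bool) j → nth false (tabulate f) (toℕ j) ≡ f j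
nth-tabulate f zero    = refl
nth-tabulate f (suc j) = nth-tabulate (f ∘ suc) j

module Layout {k} (I : BooleanInstance k) where

  open BooleanInstance I public

  m W n N : ℕ
  m = length database
  W = width
  n = #attributes
  N = length (encode I)

  X : ℕ → Bool
  X = nth false (encode I)

  private module Me = Meaning N X 0

  start startᵃ startᵇ : ℕ
  start  = Me.start m W n
  startᵃ = Me.startᵃ m W n
  startᵇ = Me.startᵇ m W n

  private
    restᵇ restᵃ rest₃ rest₂ rest₁ : List Bool
    restᵇ = toList b
    restᵃ = toList a ++ restᵇ
    rest₃ = concatMap (bitsOf schema) database ++ restᵃ
    rest₂ = unary W ++ rest₃
    rest₁ = unary n ++ rest₂

    skip : ∀ ys {zs o o′ l} → length ys ≡ l → o + l ≡ o′ → (∀ p → X (o + p) ≡ nth false (ys ++ zs) p) →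
           ∀ p → X (o′ + p) ≡ nth false zs p
    skip ys {o = o} {l = l} refl refl h p =
      trans (cong X (+-assoc o (length ys) p)) (trans (h (length ys + p)) (nth-++ʳ ys p))

    at₁ : ∀ p → X (1 + m + p) ≡ nth false rest₁ p
    at₁ = skip (unary m) {o = 0} (length-unary m) refl (λ _ → refl)

    at₂ : ∀ p → X (2 + m + n + p) ≡ nth false rest₂ p
    at₂ = skip (unary n) (length-unary n) (cong suc (+-suc m n)) at₁

    at₃ : ∀ p → X (start + p) ≡ nth false rest₃ p
    at₃ = skip (unary W) (length-unary W) (cong (2 +_) (+-suc (m + n) W)) at₂

    atᵃ : ∀ p → X (startᵃ + p) ≡ nth false restᵃ p
    atᵃ = skip (concatMap (bitsOf schema) database) (length-rows schema database) refl at₃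

    atᵇ : ∀ p → X (startᵇ + p) ≡ nth false restᵇ p
    atᵇ = skip (toList a) (length-toList a) refl atᵃ

  digitᵃ : ∀ q → q < W → X (startᵃ + q) ≡ nth false (toList a) q
  digitᵃ q l = trans (atᵃ q) (nth-++ˡ (toList a) (subst (q <_) (sym (length-toList a)) l))

  numberᵃ≡ : Me.numberᵃ m W n ≡ binary a
  numberᵃ≡ = trans (sum-cong-bits W digitᵃ) (number-binary a)

  numberᵇ≡ : Me.numberᵇ m W n ≡ binary b
  numberᵇ≡ = trans (sum-cong-bits W (λ q _ → atᵇ q)) (number-binary b)

  cell≡ : ∀ i j → i < m → j < n → Me.cell m W n i j ≡ nth false (map (has schema j) database) i
  cell≡ i j h l = trans (cong X (+-assoc start (i * n) j)) (trans (at₃ (i * n + j)) (nth-rows schema database restᵃ i j h l))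

  length-word : Me.wordLength m W n ≡ N
  length-word = sym (trans (length-++ (unary m)) (trans (cong₂ _+_ (length-unary m)
    (trans (length-++ (unary n)) (cong₂ _+_ (length-unary n)
      (trans (length-++ (unary W)) (cong₂ _+_ (length-unary W)
        (trans (length-++ (concatMap (bitsOf schema) database)) (cong₂ _+_ (length-rows schema database)
          (trans (length-++ (toList a)) (cong₂ _+_ (length-toList a) (length-toList b)))))))))) (solve m n W (m * n))))
    where
    solve : ∀ m n W c → suc m + (suc n + (suc W + (c + (W + W)))) ≡ 3 + m + n + W + c + W + W
    solve = solve-∀

  private
    unary-at : ∀ {o l zs} → (∀ p → X (o + p) ≡ nth false (unary l ++ zs) p) → Me.Unary o l
    unary-at {l = l} h = (λ p _ p<l → trans (h p) (nth-unary l p p<l)) ,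
      λ t → not-¬ t (trans (h l) (nth-unary-end l))

  shape : 0 < n → Me.Shape m W n
  shape 0<n = (<-irrefl length-word , <-irrefl (sym length-word)) , unary-at (λ _ → refl) , unary-at at₁ , unary-at at₂ , 0<n

  m<N : m < N
  m<N = ≤-trans (≤-trans (m≤m+n (suc m) (2 + n + W + m * n + W + W)) (≤-reflexive (solve m n W (m * n)))) (≤-reflexive length-word)
    where
    solve : ∀ m n W c → suc m + (2 + n + W + c + W + W) ≡ 3 + m + n + W + c + W + W
    solve = solve-∀

  n<N : n < N
  n<N = ≤-trans (≤-trans (m≤m+n (suc n) (2 + m + W + m * n + W + W)) (≤-reflexive (solve m n W (m * n)))) (≤-reflexive length-word)
    where
    solve : ∀ m n W c → suc n + (2 + m + W + c + W + W) ≡ 3 + m + n + W + c + W + W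
    solve = solve-∀

  W<N : W < N
  W<N = ≤-trans (≤-trans (m≤m+n (suc W) (2 + m + n + m * n + W + W)) (≤-reflexive (solve m n W (m * n)))) (≤-reflexive length-word)
    where
    solve : ∀ m n W c → suc W + (2 + m + n + c + W + W) ≡ 3 + m + n + W + c + W + W
    solve = solve-∀

  nth-map : ∀ {A : Set} (f g : A → Bool) (as : List A) i → nth false (map f as) i ∧ nth false (map g as) i ≡ nth false (map (λ a → f a ∧ g a) as) i
  nth-map f g []       i       = refl
  nth-map f g (a ∷ as) zero    = refl
  nth-map f g (a ∷ as) (suc i) = nth-map f g as i

  row≡ : ∀ js → All (_< n) js → ∀ i → i < m → Me.row m W n js i ≡ nth false (map (hasAll schema js) database) i
  row≡ []       []       i h = sym (truths database i h)
    where
    truths : ∀ {A : Set} (as : List A) i → i < length as → nth false (map (λ _ → true) as) i ≡ true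
    truths (a ∷ as) zero    h       = refl
    truths (a ∷ as) (suc i) (s≤s h) = truths as i h
  row≡ (j ∷ js) (l ∷ ls) i h = trans (cong₂ _∧_ (cell≡ i j h l) (row≡ js ls i h)) (nth-map (has schema j) (hasAll schema js) database i)

  matching≡ : ∀ js → All (_< n) js → Me.matching m W n js ≡ weightedSum m (λ _ → 1) (nth false (map (hasAll schema js) database))
  matching≡ js ls = sum-cong-bits m (row≡ js ls)

-- Instances with a rule are accepted

filter-≤-sum : ∀ {A : Set} {P : A → Set} (P? : Decidable P) g (as : List A) → (∀ a → P a → g a ≡ true) →
               length (filter P? as) ≤ weightedSum (length as) (λ _ → 1) (nth false (map g as))
filter-≤-sum P? g []       h = z≤n
filter-≤-sum P? g (a ∷ as) h = ≤-trans step (≤-reflexive (sym (sum-shift (length as) (λ _ → 1) (nth false (map g (a ∷ as))))))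
  where
  step : length (filter P? (a ∷ as)) ≤ (if g a then 1 else 0) + weightedSum (length as) (λ _ → 1) (nth false (map g as))
  step with P? a
  ... | yes p rewrite h a p = s≤s (filter-≤-sum P? g as h)
  ... | no _  = ≤-trans (filter-≤-sum P? g as h) (m≤n+m _ (if g a then 1 else 0))

sum-≤-filter : ∀ {A : Set} {P : A → Set} (P? : Decidable P) g (as : List A) → (∀ a → g a ≡ true → P a) →
               weightedSum (length as) (λ _ → 1) (nth false (map g as)) ≤ length (filter P? as)
sum-≤-filter P? g []       h = z≤n
sum-≤-filter P? g (a ∷ as) h = ≤-trans (≤-reflexive (sum-shift (length as) (λ _ → 1) (nth false (map g (a ∷ as))))) step
  where
  step : (if g a then 1 else 0) + weightedSum (length as) (λ _ → 1) (nth false (map g as)) ≤ length (filter P? (a ∷ as))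
  step with P? a | g a in eq
  ... | yes _ | true  = s≤s (sum-≤-filter P? g as h)
  ... | yes _ | false = ≤-trans (sum-≤-filter P? g as h) (n≤1+n _)
  ... | no ¬p | true  = ⊥-elim (¬p (h a eq))
  ... | no _  | false = sum-≤-filter P? g as h

all-or-counterexample : ∀ {A : Set} (g : A → Bool) (as : List A) →
  All (λ a → g a ≡ true) as ⊎ ∃[ i ] (i < length as × nth false (map g as) i ≡ false)
all-or-counterexample g []       = inj₁ []
all-or-counterexample g (a ∷ as) with g a in eq | all-or-counterexample g as
... | false | _                = inj₂ (0 , s≤s z≤n , refl)
... | true  | inj₂ (i , l , f) = inj₂ (suc i , s≤s l , f)
... | true  | inj₁ h           = inj₁ (eq ∷ h)

size-disjoint : ∀ {n} (p q : Subset n) → p ∩ q ≡ Subset.⊥ → ∣ p ∣ + ∣ q ∣ ≤ ∣ p ∪ q ∣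
size-disjoint []          []          eq = z≤n
size-disjoint (true ∷ p)  (false ∷ q) eq = s≤s (size-disjoint p q (cong Vec.tail eq))
size-disjoint (false ∷ p) (true ∷ q)  eq = ≤-trans (≤-reflexive (+-suc ∣ p ∣ ∣ q ∣)) (s≤s (size-disjoint p q (cong Vec.tail eq)))
size-disjoint (false ∷ p) (false ∷ q) eq = size-disjoint p q (cong Vec.tail eq)

size-sum : ∀ {n} (p : Subset n) → ∣ p ∣ ≡ weightedSum n (λ _ → 1) (nth false (toList p))
size-sum []                  = refl
size-sum {suc n} (true ∷ p)  = trans (cong suc (size-sum p)) (sym (sum-shift n (λ _ → 1) (nth false (toList (true ∷ p)))))
size-sum {suc n} (false ∷ p) = trans (size-sum p) (sym (sum-shift n (λ _ → 1) (nth false (toList (false ∷ p)))))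

∈-tabulate⁻ : ∀ {n} {f : Fin n → Bool} {j} → j ∈ Vec.tabulate f → f j ≡ true
∈-tabulate⁻ {f = f} {j} h = trans (sym (lookup∘tabulate f j)) ([]=⇒lookup h)

∈-tabulate⁺ : ∀ {n} {f : Fin n → Bool} {j} → f j ≡ true → j ∈ Vec.tabulate f
∈-tabulate⁺ {f = f} {j} h = lookup⇒[]= j _ (trans (lookup∘tabulate f j) h)

satisfied-present : ∀ {A} {c : Atomic A} {d : Domain A} → SatisfiesAtom A c d → is-just d ≡ true
satisfied-present (MaybeAny.just _) = refl

-- All non-null entries have the same value, so a condition satisfied by one of them is satisfied by
-- each.
present-satisfied : ∀ {A} {c : Atomic A} {d d′ : Domain A} → IsBoolean A → SatisfiesAtom A c d → is-just d′ ≡ true → SatisfiesAtom A c d′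
present-satisfied {A} {c} {just v} {just v′} (u , only) (MaybeAny.just f) _ =
  MaybeAny.just (subst (Fulfils A c) (trans (only v) (sym (only v′))) f)

module _ {n} {S : Schema n} (R : Rule S) where

  open Rule R hiding (size)

  attributes : Subset n
  attributes = attributesOf conjunction

  rule-size≤ : Rule.size R ≤ ∣ attributes ∣
  rule-size≤ = ≤-trans (size-disjoint (attributesOf body) (attributesOf head) disjoint)
    (p⊆q⇒∣p∣≤∣q∣ (λ {j} h → ∈-tabulate⁺ (joined j (x∈p∪q⁻ (attributesOf body) (attributesOf head) h))))
    where
    joined : ∀ j → j ∈ attributesOf body ⊎ j ∈ attributesOf head → is-just (body j <∣> head j) ≡ true
    joined j (inj₁ h) with body j | ∈-tabulate⁻ {f = λ j → is-just (body j)} {j = j} h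
    ... | just _ | _ = refl
    joined j (inj₂ h) with body j
    ... | just _  = refl
    ... | nothing = ∈-tabulate⁻ {f = λ j → is-just (head j)} h

  2≤size : 2 ≤ Rule.size R
  2≤size = +-mono-≤ (nonempty body-nonempty) (nonempty head-nonempty)
    where
    nonempty : ∀ {p : Subset n} → Subset.⊥ ⊂ p → 1 ≤ ∣ p ∣
    nonempty {p} h = subst (_< ∣ p ∣) (∣⊥∣≡0 n) (p⊂q⇒∣p∣<∣q∣ h)

module _ {k} (I : BooleanInstance k) where

  open Layout I

  threshold-positive : 0 < binary a
  threshold-positive with binary a in eq
  ... | suc _ = s≤s z≤n
  ... | zero  = ⊥-elim (ℚₚ.<-irrefl refl (ℚₚ.<-≤-trans 0<threshold (fraction-≤ {binary a} {binary b} {0} {1} (≤-reflexive (cong (_* 1) eq)))))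

  threshold≤one : binary a * 1 ≤ binary b * 1
  threshold≤one = ≤-trans (≤-fraction {binary a} {binary b} {1} {1} threshold≤1) (≤-reflexive (*-comm 1 (binary b)))

  module Completeness (K : ℕ) (R : Rule schema) (nontrivial : ¬ Trivial R database) (K≤ : K ≤ ∣ attributes R ∣) (1≤K : 1 ≤ K)
                      (supported : threshold ≤ℚ sup R database) where

    open Meaning N X K

    private
      C : Condition schema
      C = Rule.conjunction R

    support-bound : ∀ T → threshold ≤ℚ sup R T → binary a * length T ≤ length (T ⟦ C ⟧) * binary b × 0 < length T
    -- The support is set to 0 here, below any positive threshold.
    support-bound []      h = ⊥-elim (ℚₚ.<-irrefl refl (ℚₚ.<-≤-trans 0<threshold h))
    support-bound (t ∷ T) h = ≤-fraction {binary a} {binary b} {length ((t ∷ T) ⟦ C ⟧)} {suc (length T)} h , s≤s z≤n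

    matches : ℕ
    matches = length (database ⟦ C ⟧)

    bound : binary a * m ≤ matches * binary b
    bound = proj₁ (support-bound database supported)

    0<m : 0 < m
    0<m = proj₂ (support-bound database supported)

    0<matches : 0 < matches
    0<matches with matches in eq
    ... | suc _ = s≤s z≤n
    ... | zero  = ⊥-elim (<⇒≱ (*-mono-≤ threshold-positive 0<m) (subst (λ c → binary a * m ≤ c * binary b) eq bound))

    -- Positive support provides a row that satisfies the rule; it shows each condition to be
    -- satisfied by the one non-null value of its attribute.
    witness : ∃[ t ] Satisfies C t
    witness with database ⟦ C ⟧ | Allₚ.all-filter (satisfies? C) database | 0<matches
    ... | t ∷ _ | h ∷ _ | _ = t , h

    chosen : ℕ → Bool
    chosen = nth false (toList (attributes R))

    Good : ℕ → Set
    Good j = j < n × chosen j ≡ true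

    chosen-toℕ : ∀ (j : Fin n) → chosen (toℕ j) ≡ is-just (C j)
    chosen-toℕ j = trans (nth-toList (attributes R) j) (lookup∘tabulate (λ j → is-just (C j)) j)

    good-attribute : ∀ {j} → Good j → ∃[ i ] ∃[ c ] (toℕ i ≡ j × C i ≡ just c)
    good-attribute {j} (l , h) with C (fromℕ< l) in eq | trans (sym (chosen-toℕ (fromℕ< l))) (trans (cong chosen (toℕ-fromℕ< l)) h)
    ... | just c | _ = fromℕ< l , c , toℕ-fromℕ< l , eq

    satisfies-atom : ∀ {i c t} → C i ≡ just c → Satisfies C t → SatisfiesAtom (schema i) c (t i)
    satisfies-atom {i} {t = t} eq h with C i | h i
    satisfies-atom refl h | just c | MaybeAll.just q = q

    has-toℕ : ∀ (j : Fin n) (t : Tuple schema) → has schema (toℕ j) t ≡ is-just (t j)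
    has-toℕ j t = nth-tabulate (λ j → is-just (t j)) j

    satisfies-hasAll : ∀ js → All Good js → ∀ t → Satisfies C t → hasAll schema js t ≡ true
    satisfies-hasAll []       []       t h = refl
    satisfies-hasAll (j ∷ js) (g ∷ gs) t h with good-attribute g
    ... | i , c , refl , eq = cong₂ _∧_ (trans (has-toℕ i t) (satisfied-present (satisfies-atom {i} {t = t} eq h))) (satisfies-hasAll js gs t h)

    good-nontrivial : ∀ {j} → Good j → Nontrivial m W n j
    good-nontrivial g@(l , _) with good-attribute g
    ... | i , c , refl , eq with all-or-counterexample (has schema (toℕ i)) database
    ...   | inj₂ (r , r<m , f) = r , <-trans r<m m<N , r<m , λ t → not-¬ t (trans (cell≡ r (toℕ i) r<m l) f)
    -- A full column would satisfy its condition in every row, since the witness shows that presence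
    -- is enough; the rule would be trivial.
    ...   | inj₁ h = ⊥-elim (nontrivial (i , c , eq , filter-all (λ t → satisfiesAtom? (schema i) c (t i))
      (All.map (λ {t} p → present-satisfied {schema i} {c} {proj₁ witness i} {t i} (boolean i) (satisfies-atom {i} {t = proj₁ witness} eq (proj₂ witness)) (trans (sym (has-toℕ i t)) p)) h)))

    good-supported : ∀ js → All Good js → Supported m W n js
    good-supported js gs with matching m W n js in eq | matches≤
      where
      matches≤ : matches ≤ matching m W n js
      matches≤ = ≤-trans (filter-≤-sum (satisfies? C) (hasAll schema js) database (satisfies-hasAll js gs))
        (≤-reflexive (sym (matching≡ js (All.map proj₁ gs))))
    ... | zero  | h = ⊥-elim (<⇒≱ 0<matches h)
    -- The guess v + 1 is the exact number of matching rows.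
    ... | suc v | h = v , ≤-trans v<m (<⇒≤ m<N) , ≤-refl ,
      ≤-trans (≤-reflexive (cong₂ _*_ numberᵃ≡ (m+[n∸m]≡n {1} 0<m)))
        (≤-trans bound (≤-trans (*-monoˡ-≤ (binary b) h) (≤-reflexive (trans (*-comm (suc v) (binary b)) (cong (_* suc v) (sym numberᵇ≡))))))
      where
      v<m : suc v ≤ m
      v<m = subst (_≤ m) eq (≤-trans (sum-≤ (λ _ → 1) m (row m W n js) 1 (λ _ _ → ≤-refl)) (≤-reflexive (*-identityʳ m)))

    -- Scans the columns of the rule from u downwards and takes the first r, of which enough remain
    -- below u. A rule may have more than `K` columns; leaving some out can only increase the number
    -- of matching rows.
    choose : ∀ u r js → r ≤ weightedSum u (λ _ → 1) chosen → u ≤ last m W n js → u ≤ n → All Good js → Chosen m W n r js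
    choose u       zero    js h l u≤n gs = good-supported js gs
    choose (suc u) (suc r) js h l u≤n gs with chosen u in eq
    ... | true  = u , <-trans u≤n n<N , l , good-nontrivial (u≤n , eq) ,
      choose u r (u ∷ js) (≤-pred (≤-trans h (≤-reflexive (+-comm _ 1)))) ≤-refl (<⇒≤ u≤n) ((u≤n , eq) ∷ gs)
    ... | false = choose u (suc r) js (≤-trans h (≤-reflexive (+-identityʳ _))) (<⇒≤ l) (<⇒≤ u≤n) gs

    accept : Accept
    accept = m , m<N , W , W<N , n , n<N , shape 0<n , positive ,
      ≤-trans (≤-reflexive (cong (_* 1) numberᵃ≡)) (≤-trans threshold≤one (≤-reflexive (cong (_* 1) (sym numberᵇ≡)))) ,
      choose n K [] (≤-trans K≤ (≤-reflexive (size-sum (attributes R)))) ≤-refl ≤-refl []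
      where
      0<n : 0 < n
      0<n = ≤-trans 1≤K (≤-trans K≤ (≤-trans (≤-reflexive (size-sum (attributes R)))
        (≤-trans (sum-≤ (λ _ → 1) n chosen 1 (λ _ _ → ≤-refl)) (≤-reflexive (*-identityʳ n)))))
      positive : Positive m W n
      positive = let q , l , t = positive-sum (2 ^_) W _ (subst (0 <_) (sym numberᵃ≡) threshold-positive) in q , <-trans l W<N , l , t

-- Accepted words encode instances with a rule

applyUpTo-split : ∀ (f : ℕ → A) a b → applyUpTo f (a + b) ≡ applyUpTo f a ++ applyUpTo (λ p → f (a + p)) b
applyUpTo-split f zero    b = refl
applyUpTo-split f (suc a) b = cong (f 0 ∷_) (applyUpTo-split (f ∘ suc) a b)

applyUpTo-nth : ∀ (z : A) as → applyUpTo (nth z as) (length as) ≡ as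
applyUpTo-nth z []       = refl
applyUpTo-nth z (a ∷ as) = cong (a ∷_) (applyUpTo-nth z as)

applyUpTo-unary : ∀ f l → (∀ p → p < l → f p ≡ true) → f l ≡ false → applyUpTo f (suc l) ≡ unary l
applyUpTo-unary f zero    h e = cong [_] e
applyUpTo-unary f (suc l) h e = cong₂ _∷_ (h 0 (s≤s z≤n)) (applyUpTo-unary (f ∘ suc) l (λ p p<l → h (suc p) (s≤s p<l)) e)

applyUpTo-tabulate : ∀ {n} (f : ℕ → A) (g : Fin n → A) → (∀ j → g j ≡ f (toℕ j)) → applyUpTo f n ≡ tabulate g
applyUpTo-tabulate {n = zero}  f g h = refl
applyUpTo-tabulate {n = suc n} f g h = cong₂ _∷_ (sym (h zero)) (applyUpTo-tabulate (f ∘ suc) (g ∘ suc) (h ∘ suc))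

applyUpTo-toList : ∀ {n} (f : ℕ → A) → applyUpTo f n ≡ toList (Vec.tabulate {n = n} (f ∘ toℕ))
applyUpTo-toList {n = zero}  f = refl
applyUpTo-toList {n = suc n} f = cong (f 0 ∷_) (applyUpTo-toList (f ∘ suc))

applyUpTo-rows : ∀ {n} (S : Schema n) (t : ℕ → Tuple S) f m → (∀ i j → is-just (t i j) ≡ f (i * n + toℕ j)) →
                 applyUpTo f (m * n) ≡ concatMap (bitsOf S) (applyUpTo t m)
applyUpTo-rows     S t f zero    h = refl
applyUpTo-rows {n} S t f (suc m) h = trans (applyUpTo-split f n (m * n)) (cong₂ _++_
  (applyUpTo-tabulate f _ (h 0))
  (applyUpTo-rows S (t ∘ suc) (λ p → f (n + p)) m (λ i j → trans (h (suc i) j) (cong f (+-assoc n (i * n) (toℕ j))))))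

binary-tabulate : ∀ W f → binary (Vec.tabulate {n = W} (f ∘ toℕ)) ≡ number W f
binary-tabulate zero    f = refl
binary-tabulate (suc W) f = trans (step (f 0)) (sym (number-suc W f))
  where
  step : ∀ b → binary (b Vec.∷ Vec.tabulate {n = W} (f ∘ suc ∘ toℕ)) ≡ (if b then 1 else 0) + 2 * number W (f ∘ suc)
  step true  = cong (λ n → 1 + 2 * n) (binary-tabulate W (f ∘ suc))
  step false = cong (2 *_) (binary-tabulate W (f ∘ suc))

mem : List ℕ → ℕ → Bool
mem []       i = false
mem (j ∷ js) i = (j ≡ᵇ i) ∨ mem js i

≡ᵇ-sound : ∀ {i j} → (i ≡ᵇ j) ≡ true → i ≡ j
≡ᵇ-sound {zero}  {zero}  _ = refl
≡ᵇ-sound {suc i} {suc j} h = cong suc (≡ᵇ-sound h)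

mem-here : ∀ j js → mem (j ∷ js) j ≡ true
mem-here j js = cong (_∨ mem js j) (≡ᵇ-refl j)

mem-there : ∀ j js i → mem js i ≡ true → mem (j ∷ js) i ≡ true
mem-there j js i h with j ≡ᵇ i
... | true  = refl
... | false = h

all-mem : ∀ {P : ℕ → Set} js → All P js → ∀ {i} → mem js i ≡ true → P i
all-mem {P} (j ∷ js) (p ∷ ps) {i} h with j ≡ᵇ i in eq
... | true  = subst P (≡ᵇ-sound eq) p
... | false = all-mem js ps h

not-mem : ∀ {j} js → All (j <_) js → ¬ mem js j ≡ true
not-mem js h q = <-irrefl refl (all-mem js h q)

-- A word records only which entries are present, so for decoding any boolean schema will do.
plain : ∀ n → Schema n
plain n _ = categorical Unit Unitₚ._≟_

present : ∀ {n} → List ℕ → Condition (plain n)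
present js j = if mem js (toℕ j) then just (equal tt) else nothing

module _ {n : ℕ} where

  present-just : ∀ js (j : Fin n) → is-just (present js j) ≡ mem js (toℕ j)
  present-just js j with mem js (toℕ j)
  ... | true  = refl
  ... | false = refl

  members : List ℕ → Subset n
  members js = attributesOf {S = plain n} (present js)

  ∈-present⁻ : ∀ {js} {j : Fin n} → j ∈ members js → mem js (toℕ j) ≡ true
  ∈-present⁻ {js} {j} h = trans (sym (present-just js j)) (∈-tabulate⁻ {f = λ j → is-just (present js j)} h)

  ∈-present⁺ : ∀ {js} {j : Fin n} → mem js (toℕ j) ≡ true → j ∈ members js
  ∈-present⁺ {js} {j} h = ∈-tabulate⁺ {f = λ j → is-just (present js j)} (trans (present-just js j) h)

  ∈-present-head : ∀ {j js} (l : j < n) → fromℕ< l ∈ members (j ∷ js)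
  ∈-present-head {j} {js} l = ∈-present⁺ {j ∷ js} (trans (cong (mem (j ∷ js)) (toℕ-fromℕ< l)) (mem-here j js))

  ∉-present : ∀ {j js} (l : j < n) → All (j <_) js → fromℕ< l ∉ members js
  ∉-present {j} {js} l h q = not-mem js h (trans (cong (mem js) (sym (toℕ-fromℕ< l))) (∈-present⁻ {js} q))

  data Ascending : List ℕ → Set where
    []  : Ascending []
    _∷_ : ∀ {j js} → j < n × All (j <_) js → Ascending js → Ascending (j ∷ js)

  size-present : ∀ {js} → Ascending js → length js ≤ sizeᶜ {S = plain n} (present js)
  size-present []                    = z≤n
  size-present {j ∷ js} ((l , h) ∷ a) = ≤-trans (s≤s (size-present a)) (p⊂q⇒∣p∣<∣q∣
    ((λ {i} q → ∈-present⁺ {j ∷ js} (mem-there j js (toℕ i) (∈-present⁻ {js} q))) ,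
     fromℕ< l , ∈-present-head {js = js} l , ∉-present l h))

  all-below : ∀ {js} → Ascending js → All (_< n) js
  all-below []            = []
  all-below ((l , _) ∷ a) = l ∷ all-below a

  -- The smallest column forms the body and the others the head. Having two columns makes both
  -- non-empty, and each is proper because it misses a column of the other.
  listRule : ∀ {j₁ j₂ js} → Ascending (j₁ ∷ j₂ ∷ js) → Rule (plain n)
  listRule {j₁} {j₂} {js} ((l₁ , h₁) ∷ (l₂ , h₂) ∷ _) = record
    { body = present [ j₁ ] ; head = present (j₂ ∷ js)
    ; body-nonempty = ⊥⊆ , fromℕ< l₁ , ∈-present-head {js = []} l₁ , ∉⊥
    ; body-proper = ⊆⊤ , fromℕ< l₂ , ∈⊤ , λ q → <⇒≢ (All.head h₁) (sym (single (∈-present⁻ {[ j₁ ]} q)))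
    ; head-nonempty = ⊥⊆ , fromℕ< l₂ , ∈-present-head {js = js} l₂ , ∉⊥
    ; head-proper = ⊆⊤ , fromℕ< l₁ , ∈⊤ , ∉-present {js = j₂ ∷ js} l₁ h₁
    ; disjoint = Empty-unique λ (i , q) → let q₁ , q₂ = x∈p∩q⁻ _ _ q in
        not-mem (j₂ ∷ js) h₁ (subst (λ i → mem (j₂ ∷ js) i ≡ true) (equal-to i (∈-present⁻ {[ j₁ ]} q₁)) (∈-present⁻ {j₂ ∷ js} q₂))
    }
    where
    equal-to : ∀ (i : Fin n) → mem [ j₁ ] (toℕ i) ≡ true → toℕ i ≡ j₁
    equal-to i h = all-mem {λ i → i ≡ j₁} [ j₁ ] (refl ∷ []) h
    single : mem [ j₁ ] (toℕ (fromℕ< l₂)) ≡ true → j₂ ≡ j₁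
    single h = trans (sym (toℕ-fromℕ< l₂)) (equal-to (fromℕ< l₂) h)

  listRule-conjunction : ∀ {j₁ j₂ js} (a : Ascending (j₁ ∷ j₂ ∷ js)) j →
    Rule.conjunction (listRule a) j ≡ present (j₁ ∷ j₂ ∷ js) j
  listRule-conjunction {j₁} (_ ∷ _ ∷ _) j with j₁ ≡ᵇ toℕ j
  ... | true  = refl
  ... | false = refl

  listRule-size : ∀ {j₁ j₂ js} (a : Ascending (j₁ ∷ j₂ ∷ js)) → 2 + length js ≤ Rule.size (listRule a)
  listRule-size (h ∷ h′ ∷ a) = +-mono-≤ (size-present ((proj₁ h , []) ∷ [])) (size-present (h′ ∷ a))

hasAll-mem : ∀ {n} (S : Schema n) js t i → hasAll S js t ≡ true → mem js i ≡ true → has S i t ≡ true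
hasAll-mem S (j ∷ js) t i h q with has S j t in eq | j ≡ᵇ i in eq′
... | true | true  = subst (λ i → has S i t ≡ true) (≡ᵇ-sound eq′) eq
... | true | false = hasAll-mem S js t i h q

nth-all : ∀ (g : A → Bool) as i → i < length as → All (λ a → g a ≡ true) as → nth false (map g as) i ≡ true
nth-all g (a ∷ as) zero    l       (h ∷ _)  = h
nth-all g (a ∷ as) (suc i) (s≤s l) (_ ∷ hs) = nth-all g as i l hs

module Columns (N : ℕ) (X : ℕ → Bool) (K : ℕ) {m W n : ℕ} where

  open Meaning N X K

  Valid : List ℕ → Set
  Valid []       = Unit
  Valid (j ∷ js) = j < last m W n js × Nontrivial m W n j × Valid js

  last≤n : ∀ js → Valid js → last m W n js ≤ n
  last≤n []       _           = ≤-refl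
  last≤n (j ∷ js) (l , _ , v) = ≤-trans (<⇒≤ l) (last≤n js v)

  below-all : ∀ {j} js → Valid js → j < last m W n js → All (j <_) js
  below-all []        _            l = []
  below-all (j′ ∷ js) (l′ , _ , v) l = l ∷ below-all js v (<-trans l l′)

  ascending : ∀ js → Valid js → Ascending {n} js
  ascending []       _           = []
  ascending (j ∷ js) (l , _ , v) = (<-≤-trans l (last≤n js v) , below-all js v l) ∷ ascending js v

  all-nontrivial : ∀ js → Valid js → All (Nontrivial m W n) js
  all-nontrivial []       _           = []
  all-nontrivial (j ∷ js) (_ , t , v) = t ∷ all-nontrivial js v

  collect : ∀ r js → Valid js → Chosen m W n r js → ∃[ ks ] (length ks ≡ r + length js × Valid ks × Supported m W n ks)
  collect zero    js v s                   = js , refl , v , s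
  collect (suc r) js v (j , _ , l , t , c) with collect r (j ∷ js) (l , t , v) c
  ... | ks , eq , rest = ks , trans eq (+-suc r (length js)) , rest

  chosen-bound : ∀ r js → Chosen m W n r js → r ≤ last m W n js
  chosen-bound zero    js _                   = z≤n
  chosen-bound (suc r) js (j , _ , l , _ , c) = ≤-trans (s≤s (chosen-bound r (j ∷ js) c)) l

module Soundness {k n W : ℕ} (k≤n : k ≤ n) (T : Database (plain n)) (a b : Vec Bool W) .{{b≢0 : NonZero (binary b)}}
                 (0<t : 0ℚ <ℚ pos (binary a) /ℚ binary b) (t≤1 : pos (binary a) /ℚ binary b ≤ℚ 1ℚ) where

  instanceOf : BooleanInstance k
  instanceOf = record
    { schema = plain n ; boolean = λ _ → tt , λ _ → refl ; k≤#attributes = k≤n ; database = T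
    ; a = a ; b = b ; 0<threshold = 0<t ; threshold≤1 = t≤1 }

  private module I = Layout instanceOf

  matches : Rule (plain n) → Database (plain n) → ℕ
  matches R T = length (_⟦_⟧ {S = plain n} T (Rule.conjunction R))

  sup-bound : ∀ (R : Rule (plain n)) T → 0 < length T →
    binary a * length T ≤ matches R T * binary b → pos (binary a) /ℚ binary b ≤ℚ sup R T
  sup-bound R (t ∷ T) _ h = fraction-≤ {binary a} {binary b} {matches R (t ∷ T)} {suc (length T)} h

  module _ (K : ℕ) where

    open Columns I.N I.X K {length T} {W} {n}
    open Meaning I.N I.X K

    present-satisfied-by : ∀ {j₁ j₂ js} (as : Ascending {n} (j₁ ∷ j₂ ∷ js)) t →
      hasAll (plain n) (j₁ ∷ j₂ ∷ js) t ≡ true → Satisfies {S = plain n} (Rule.conjunction (listRule as)) t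
    present-satisfied-by {j₁} {j₂} {js} as t h j rewrite listRule-conjunction as j with mem (j₁ ∷ j₂ ∷ js) (toℕ j) in eq
    ... | false = MaybeAll.nothing
    ... | true with t j | trans (sym (nth-tabulate (λ j → is-just (t j)) j)) (hasAll-mem (plain n) (j₁ ∷ j₂ ∷ js) t (toℕ j) h eq)
    ...   | just tt | _ = MaybeAll.just (MaybeAny.just refl)

    problem : 2 ≤ K → k ≤ K → Chosen (length T) W n K [] → Problem (plain n) T sup k (pos (binary a) /ℚ binary b)
    problem 2≤K k≤K chosen with collect K [] tt chosen
    ... | []           , eq , _ = ⊥-elim (<⇒≱ (s≤s z≤n) (subst (2 ≤_) (trans (sym (+-identityʳ K)) (sym eq)) 2≤K))
    ... | _ ∷ []       , eq , _ = ⊥-elim (<⇒≱ (s≤s (s≤s z≤n)) (subst (2 ≤_) (trans (sym (+-identityʳ K)) (sym eq)) 2≤K))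
    ... | ks@(j₁ ∷ j₂ ∷ js) , eq , valid , v , _ , v< , enough =
      R , nontrivial , ≤-trans k≤K (≤-trans (≤-reflexive (trans (sym (+-identityʳ K)) (sym eq))) (listRule-size as)) ,
      sup-bound R T 0<m (≤-trans (≤-reflexive (cong₂ _*_ (sym I.numberᵃ≡) (sym (m+[n∸m]≡n {1} 0<m))))
        (≤-trans enough (≤-trans (≤-reflexive (cong (_* suc v) I.numberᵇ≡)) (≤-trans (*-monoʳ-≤ (binary b) count) (≤-reflexive (*-comm (binary b) _))))))
      where
      as : Ascending {n} ks
      as = ascending ks valid
      R : Rule (plain n)
      R = listRule as
      below : All (_< n) ks
      below = all-below as
      0<m : 0 < length T
      0<m = ≤-trans (≤-trans (s≤s z≤n) v<) (≤-trans (sum-≤ (λ _ → 1) (length T) (row (length T) W n ks) 1 (λ _ _ → ≤-refl)) (≤-reflexive (*-identityʳ _)))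
      count : suc v ≤ matches R T
      count = ≤-trans v< (≤-trans (≤-reflexive (I.matching≡ ks below))
        (sum-≤-filter (satisfies? {S = plain n} (Rule.conjunction R)) (hasAll (plain n) ks) T (present-satisfied-by as)))
      nontrivial : ¬ Trivial R T
      nontrivial (j , c , is-c , all-T) with mem ks (toℕ j) in eq′ | trans (sym (listRule-conjunction as j)) is-c
      -- Triviality would make column j full, whereas a row without an entry in it was found when it
      -- was chosen.
      ... | true | _ with all-mem ks (all-nontrivial ks valid) eq′
      ...   | i , _ , i<m , not-cell = not-cell (trans (I.cell≡ i (toℕ j) i<m (toℕ<n j)) (nth-all (has (plain n) (toℕ j)) T i i<m
        (All.map (λ {t} q → trans (nth-tabulate (λ j → is-just (t j)) j) (satisfied-present {plain n j} {c} {t j} q))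
          (subst (All (λ t → SatisfiesAtom (plain n j) c (t j))) all-T (Allₚ.all-filter (λ t → satisfiesAtom? (plain n j) c (t j)) T)))))

module Decoding (k : ℕ) (w : Word) where

  private
    K N : ℕ
    K = max k 2
    N = length w
    X : ℕ → Bool
    X = nth false w

  open Meaning N X K
  open Columns N X K using (chosen-bound)

  module _ {m W n : ℕ} where

    module _ (shape : Shape m W n) (positive : Positive m W n) (a≤b : numberᵃ m W n * 1 ≤ numberᵇ m W n * 1)
             (chosen : Chosen m W n K []) where

      private
        0<a : 0 < numberᵃ m W n
        0<a = let q , _ , l , t = positive in sum-positive (2 ^_) W (λ q → X (startᵃ m W n + q)) q l t (m^n>0 2 q)

        digits : ℕ → Vec Bool W
        digits o = Vec.tabulate (λ q → X (o + toℕ q))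

        value-digits : ∀ o → binary (digits o) ≡ number W (λ q → X (o + q))
        value-digits o = binary-tabulate W (λ q → X (o + q))

        0<binary-a : 0 < binary (digits (startᵃ m W n))
        0<binary-a = subst (0 <_) (sym (value-digits (startᵃ m W n))) 0<a

        a≤b′ : binary (digits (startᵃ m W n)) * 1 ≤ binary (digits (startᵇ m W n)) * 1
        a≤b′ = subst₂ (λ a b → a * 1 ≤ b * 1) (sym (value-digits (startᵃ m W n))) (sym (value-digits (startᵇ m W n))) a≤b

        -- An instance requires b to be non-zero, which follows from 0 < a ≤ b.
        0<binary-b : 0 < binary (digits (startᵇ m W n))
        0<binary-b = subst (0 <_) (*-identityʳ _) (≤-trans (≤-trans 0<binary-a (≤-reflexive (sym (*-identityʳ _)))) a≤b′)

        instance
          b-nonZero : NonZero (binary (digits (startᵇ m W n)))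
          b-nonZero = >-nonZero 0<binary-b

        tuple : ℕ → Tuple (plain n)
        tuple i j = if cell m W n i (toℕ j) then just tt else nothing

        tuple-just : ∀ i j → is-just (tuple i j) ≡ cell m W n i (toℕ j)
        tuple-just i j with cell m W n i (toℕ j)
        ... | true  = refl
        ... | false = refl

      private
        threshold-above-0 : 0ℚ <ℚ pos (binary (digits (startᵃ m W n))) /ℚ binary (digits (startᵇ m W n))
        threshold-above-0 = ℚₚ.≰⇒> (λ h → <⇒≱ 0<binary-a (≤-trans (≤-reflexive (sym (*-identityʳ _)))
          (≤-fraction {binary (digits (startᵃ m W n))} {binary (digits (startᵇ m W n))} {0} {1} h)))

        threshold-below-1 : pos (binary (digits (startᵃ m W n))) /ℚ binary (digits (startᵇ m W n)) ≤ℚ 1ℚ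
        threshold-below-1 = fraction-≤ {binary (digits (startᵃ m W n))} {binary (digits (startᵇ m W n))} {1} {1}
          (≤-trans a≤b′ (≤-reflexive (*-comm _ 1)))

        -- Choosing `K` columns in decreasing order below n shows K ≤ n, and thereby the bound k ≤ n
        -- that an instance requires.
        module Decoded = Soundness {k} (≤-trans (m≤m⊔n k 2) (chosen-bound {m} {W} {n} K [] chosen)) (applyUpTo tuple m)
          (digits (startᵃ m W n)) (digits (startᵇ m W n)) threshold-above-0 threshold-below-1

      decoded : BooleanInstance k
      decoded = Decoded.instanceOf

      private
        unary-part : ∀ {o l} → l < N → Unary o l → ∀ f → (∀ p → f p ≡ X (o + p)) → applyUpTo f (suc l) ≡ unary l
        unary-part {l = l} l<N (h , e) f same = applyUpTo-unary f l
          (λ p p<l → trans (same p) (h p (<-trans p<l l<N) p<l)) (trans (same l) (¬-not e))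

      -- The word is the list of the values of `X`; it is cut at the block boundaries, and `Shape`
      -- together with the definition of the decoded data identifies each block.
      encode-decoded : m < N → W < N → n < N → encode decoded ≡ w
      encode-decoded m<N W<N n<N = trans
        (cong (λ l → unary l ++ unary n ++ unary W ++ concatMap (bitsOf (plain n)) (applyUpTo tuple m)
                     ++ toList (digits (startᵃ m W n)) ++ toList (digits (startᵇ m W n))) (length-applyUpTo tuple m))
        (sym (trans (sym (applyUpTo-nth false w)) (trans (cong (applyUpTo X) N≡)
          (trans (applyUpTo-split X (suc m) _) (cong₂ _++_ (unary-part m<N sh₁ X (λ _ → refl))
          (trans (applyUpTo-split X₁ (suc n) _) (cong₂ _++_ (unary-part n<N sh₂ X₁ (λ _ → refl))
          (trans (applyUpTo-split X₂ (suc W) _) (cong₂ _++_ (unary-part W<N sh₃ X₂ (λ p → cong X (pos₃ p)))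
          (trans (applyUpTo-split X₃ (m * n) _) (cong₂ _++_
            (applyUpTo-rows (plain n) tuple X₃ m (λ i j → trans (tuple-just i j) (cong X (pos₄ (i * n) (toℕ j)))))
          (trans (applyUpTo-split X₄ W W) (cong₂ _++_
            (trans (applyUpTo-cong W (λ p → cong X (pos₅ p))) (applyUpTo-toList (λ q → X (startᵃ m W n + q))))
            (trans (applyUpTo-cong W (λ p → cong X (pos₆ p))) (applyUpTo-toList (λ q → X (startᵇ m W n + q)))))))))))))))))
        where
        X₁ X₂ X₃ X₄ : ℕ → Bool
        X₁ p = X (suc m + p)
        X₂ p = X₁ (suc n + p)
        X₃ p = X₂ (suc W + p)
        X₄ p = X₃ (m * n + p)
        sh₁ = proj₁ (proj₂ shape)
        sh₂ = proj₁ (proj₂ (proj₂ shape))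
        sh₃ = proj₁ (proj₂ (proj₂ (proj₂ shape)))
        applyUpTo-cong : ∀ {f g : ℕ → Bool} n → (∀ p → f p ≡ g p) → applyUpTo f n ≡ applyUpTo g n
        applyUpTo-cong zero    h = refl
        applyUpTo-cong (suc n) h = cong₂ _∷_ (h 0) (applyUpTo-cong n (h ∘ suc))
        N≡ : N ≡ suc m + (suc n + (suc W + (m * n + (W + W))))
        N≡ = trans (≤-antisym (≮⇒≥ (proj₁ (proj₁ shape))) (≮⇒≥ (proj₂ (proj₁ shape)))) (solve m n W (m * n))
          where
          solve : ∀ m n W c → 3 + m + n + W + c + W + W ≡ suc m + (suc n + (suc W + (c + (W + W))))
          solve = solve-∀
        pos₃ : ∀ p → suc m + (suc n + p) ≡ 2 + m + n + p
        pos₃ = solve m n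
          where
          solve : ∀ m n p → suc m + (suc n + p) ≡ 2 + m + n + p
          solve = solve-∀
        pos₄ : ∀ i j → start m W n + i + j ≡ suc m + (suc n + (suc W + (i + j)))
        pos₄ = solve m n W
          where
          solve : ∀ m n W i j → 3 + m + n + W + i + j ≡ suc m + (suc n + (suc W + (i + j)))
          solve = solve-∀
        pos₅ : ∀ p → suc m + (suc n + (suc W + (m * n + p))) ≡ startᵃ m W n + p
        pos₅ = solve m n W (m * n)
          where
          solve : ∀ m n W c p → suc m + (suc n + (suc W + (c + p))) ≡ 3 + m + n + W + c + p
          solve = solve-∀
        pos₆ : ∀ p → suc m + (suc n + (suc W + (m * n + (W + p)))) ≡ startᵇ m W n + p
        pos₆ = solve m n W (m * n)
          where
          solve : ∀ m n W c p → suc m + (suc n + (suc W + (c + (W + p)))) ≡ 3 + m + n + W + c + W + p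
          solve = solve-∀

      decoded-problem : m < N → W < N → n < N → BooleanProblem sup k w
      decoded-problem m<N W<N n<N = decoded , encode-decoded m<N W<N n<N ,
        Decoded.problem K (m≤n⊔m k 2) (m≤m⊔n k 2)
          -- The choice of columns was made in the given word with m rows; it is carried over to the
          -- encoding of the decoded instance and the length of its database.
          (subst₂ (λ u m′ → Meaning.Chosen (length u) (nth false u) K m′ W n K [])
            (sym (encode-decoded m<N W<N n<N)) (sym (length-applyUpTo tuple m)) chosen)

problem-accepted : ∀ k w → BooleanProblem sup k w → Meaning.Accept (length w) (nth false w) (max k 2)
problem-accepted k w (I , refl , R , nontrivial , k≤ , supported) =
  Completeness.accept I (max k 2) R nontrivial (≤-trans (⊔-lub k≤ (2≤size R)) (rule-size≤ R)) (≤-trans (s≤s z≤n) (m≤n⊔m k 2)) supported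

accepted-problem : ∀ k w → Meaning.Accept (length w) (nth false w) (max k 2) → BooleanProblem sup k w
accepted-problem k w (m , m<N , W , W<N , n , n<N , shape , positive , a≤b , chosen) =
  Decoding.decoded-problem k w shape positive a≤b chosen m<N W<N n<N

theorem6p2 : (k : ℕ) → 1 ≤ k → TC⁰ (BooleanProblem sup k)
theorem6p2 k _ = sentence-TC⁰ (sentence (max k 2)) λ w →
  let r = r-sentence (length w) w refl (max k 2)
  in mk⇔ (λ t → accepted-problem k w (Reflection.Ref.sound r t)) (λ p → Reflection.Ref.complete r (problem-accepted k w p))
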